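{- Let $(\mathbf A_n)_{n\in\mathbb N}$ be a local convergent sequence of finite base structures satisfying $\lim_{n\to\infty}\langle R,\mathbf A_n\rangle>0$, and let $(\mathbf G_n)_{n\in\mathbb N}$ be a constant-local convergent sequence of finite gadgets. Then the sequence $(\mathbf A_n*\mathbf G_n)_n$ is local convergent. Moreover, if $|V(\mathbf A_n)|\to\infty$, then the same conclusion holds when $(\mathbf G_n)_n$ is only assumed to be $\mathrm{FO}^{\text{c-loc}}_1$-convergent.
   Context: Fix a finite purely relational first-order language $L$ (with equality, positive arities) and a relation symbol $R\notin L$ of arity $\mathrm{ar}(R)\ge1$. All structures are finite and nonempty; $V(\mathbf A)$ is the universe of $\mathbf A$. Base structures and gadgets. $L_R=L\cup\{R\}$; a base structure is an $L_R$-structure. $L_G$ is $L$ extended by constants $z_1,\dots,z_{\mathrm{ar}(R)}$; a gadget is an $L_G$-structure $\mathbf G$ in which the vertices $z_i^{\mathbf G}$ (the roots) are pairwise distinct. Gadget construction. $\mathbf A*\mathbf G$ is the $L$-structure with universe $\big(V(\mathbf A)\sqcup(R^{\mathbf A}\times V(\mathbf G))\big)/\!\sim$, where $\sim$ is generated by $e_i\sim(\boldsymbol e,z_i^{\mathbf G})$ for $\boldsymbol e\in R^{\mathbf A}$, $1\le i\le\mathrm{ar}(R)$. For $S\in L$ of arity $s$, $S^{\mathbf A*\mathbf G}=\{([a_1],\dots,[a_s]):(a_1,\dots,a_s)\in S^{\mathbf A}\}\cup\{([(\boldsymbol e,v_1)],\dots,[(\boldsymbol e,v_s)]):\boldsymbol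 e\in R^{\mathbf A},(v_1,\dots,v_s)\in S^{\mathbf G}\}$. Locality and convergence. Distances are in the Gaifman graph. A formula is local if for some $r\in\mathbb N_0$ its satisfaction by a tuple depends only on the substructure induced by the $r$-neighborhood of the free variables; it is constant-local if for some $r$ its satisfaction depends only on the substructure induced by the $r$-neighborhood of the free variables and the constants (constant-local sentences are allowed). $\mathrm{FO}^{\text{c-loc}}_p$ is the set of constant-local formulas with free variables among $x_1,\dots,x_p$. For a formula $\phi$ with $p\ge1$ free variables, $\langle\phi,\mathbf A\rangle$ is the probability that a uniformly random $p$-tuple of vertices of $\mathbf A$ satisfies $\phi$; for sentences it is $1$ or $0$ according to truth. In particular $\langle R,\mathbf A\rangle=|R^{\mathbf A}|/|V(\mathbf A)|^{\mathrm{ar}(R)}$. A sequence $(\mathbf A_n)$ is $X$-convergent if $\langle\phi,\mathbf A_n\rangle$ converges for every $\phi\in X$; local (constant-local) convergent means $X$-convergent for $X$ the set of all local (constant-local) formulas of the language. -}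

module Defs where

open import Data.Bool.Base using (Bool; T)
open import Data.Bool.Properties using (T?; T-irrelevant)
open import Data.Fin.Base as Fin using (Fin; zero; suc)
import Data.Fin.Properties as Fin
open import Data.Integer.Base using (+_)
open import Data.List.Base as List
  using (List; []; _∷_; _++_; allFin; cartesianProduct; cartesianProductWith;
         deduplicate; filter; length)
open import Data.List.Membership.Propositional using (_∈_)
open import Data.List.Membership.Propositional.Properties
  using (∈-allFin; ∈-filter⁺; ∈-map⁺; ∈-++⁺ˡ; ∈-++⁺ʳ; ∈-cartesianProduct⁺;
         ∈-cartesianProductWith⁺; ∈-lookup)
import Data.List.Membership.DecPropositional as DecMembership
open import Data.List.Relation.Unary.All as All using (All)
open import Data.List.Relation.Unary.All.Properties using (all-filter)
open import Data.List.Relation.Unary.AllPairs using (AllPairs; _∷_)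
open import Data.List.Relation.Unary.Any as Any using (Any; here; there)
import Data.List.Relation.Unary.Any.Properties as Any
open import Data.List.Relation.Unary.Unique.DecSetoid.Properties using (deduplicate-!)
open import Data.Nat.Base as ℕ using (ℕ; zero; suc; NonZero; _^_; _≤_)
import Data.Nat.Properties as ℕ
open import Data.Product.Base using (Σ; ∃; _×_; _,_; proj₁)
import Data.Product.Properties as Product
open import Data.Rational.Base as ℚ using (ℚ; 0ℚ; _/_; ∣_∣)
open import Data.Sum.Base using (_⊎_; inj₁; inj₂)
import Data.Sum.Properties as Sum
open import Data.Vec.Base as Vec using (Vec; []; _∷_; lookup; tabulate)
import Data.Vec.Properties as Vec
import Data.Vec.Membership.Propositional as VecMem
import Data.Vec.Relation.Unary.All as VecAll
open import Function.Base using (_∘_)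
open import Function.Bundles using (_⇔_; mk⇔)
open import Function.Definitions using (Injective)
open import Relation.Binary.Bundles using (DecSetoid)
open import Relation.Binary.Construct.Closure.Equivalence as EqC using (EqClosure)
open import Relation.Binary.Construct.Closure.ReflexiveTransitive using (_◅_; ε)
open import Relation.Binary.Construct.Closure.Symmetric using (bwd)
open import Relation.Binary.Definitions using (Decidable; DecidableEquality)
open import Relation.Binary.PropositionalEquality
  using (_≡_; _≢_; refl; sym; trans; cong; subst; isEquivalence)
open import Relation.Nullary.Decidable
  using (Dec; yes; no; does; map′; ¬?; _×-dec_)
open import Relation.Nullary.Negation using (¬_; contradiction)

------------------------------------------------------------------------
-- Languages, structures and first-order formulas

record Signature : Set where
  field
    symbols       : ℕ
    arity         : Fin symbols → ℕ
    arity-nonZero : ∀ S → NonZero (arity S)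

open Signature public

-- L ∪ {R}, where R is the symbol `zero` and has arity k.
_∪R_ : Signature → (k : ℕ) .{{_ : NonZero k}} → Signature
(σ ∪R k) .symbols               = suc (symbols σ)
(σ ∪R k) .arity zero            = k
(σ ∪R k) .arity (suc S)         = arity σ S
_∪R_ σ (suc k) .arity-nonZero zero = _
(σ ∪R k) .arity-nonZero (suc S) = arity-nonZero σ S

-- Finite nonempty structures, with universe Fin size, for the language
-- consisting of σ and c constants.
record Structure (σ : Signature) (c : ℕ) : Set where
  field
    size          : ℕ
    {{size≢0}}    : NonZero size
    interp        : (S : Fin (symbols σ)) → Vec (Fin size) (arity σ S) → Bool
    constant      : Fin c → Fin size

  V : Set
  V = Fin size

open Structure public

someVertex : ∀ {σ c} (A : Structure σ c) → V A
someVertex A = Fin.fromℕ< (ℕ.>-nonZero⁻¹ (size A))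

-- c constants are available, and n variables are in scope.
data Term (c n : ℕ) : Set where
  var : Fin n → Term c n
  con : Fin c → Term c n

infix  6 _≐_
infixr 5 _∧′_

data Formula (σ : Signature) (c : ℕ) : ℕ → Set where
  _≐_  : ∀ {n} → Term c n → Term c n → Formula σ c n
  rel  : ∀ {n} (S : Fin (symbols σ)) → Vec (Term c n) (arity σ S) → Formula σ c n
  ¬′_  : ∀ {n} → Formula σ c n → Formula σ c n
  _∧′_ : ∀ {n} → Formula σ c n → Formula σ c n → Formula σ c n
  -- The bound variable is `zero` in the scope of the quantifier.
  ∃′_  : ∀ {n} → Formula σ c (suc n) → Formula σ c n

module _ {σ : Signature} {c : ℕ} (A : Structure σ c) where

  eval : ∀ {n} → Vec (V A) n → Term c n → V A
  eval ρ (var i) = lookup ρ i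
  eval ρ (con j) = constant A j

  infix 4 _⊨_[_] _⊨?_[_]

  _⊨_[_] : ∀ {n} → Formula σ c n → Vec (V A) n → Set
  _⊨_[_] (s ≐ t)    ρ = eval ρ s ≡ eval ρ t
  _⊨_[_] (rel S ts) ρ = T (interp A S (Vec.map (eval ρ) ts))
  _⊨_[_] (¬′ φ)     ρ = ¬ (_⊨_[_] φ ρ)
  _⊨_[_] (φ ∧′ ψ)   ρ = _⊨_[_] φ ρ × _⊨_[_] ψ ρ
  _⊨_[_] (∃′ φ)     ρ = ∃ λ a → _⊨_[_] φ (a ∷ ρ)

  _⊨?_[_] : ∀ {n} (φ : Formula σ c n) (ρ : Vec (V A) n) → Dec (_⊨_[_] φ ρ)
  _⊨?_[_] (s ≐ t)    ρ = eval ρ s Fin.≟ eval ρ t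
  _⊨?_[_] (rel S ts) ρ = T? _
  _⊨?_[_] (¬′ φ)     ρ = ¬? (_⊨?_[_] φ ρ)
  _⊨?_[_] (φ ∧′ ψ)   ρ = _⊨?_[_] φ ρ ×-dec _⊨?_[_] ψ ρ
  _⊨?_[_] (∃′ φ)     ρ = Fin.any? λ a → _⊨?_[_] φ (a ∷ ρ)

------------------------------------------------------------------------
-- Probability of satisfaction

-- All elements of (Fin n)^p, each listed exactly once.
tuples : (n p : ℕ) → List (Vec (Fin n) p)
tuples n zero    = [] ∷ []
tuples n (suc p) = cartesianProductWith _∷_ (allFin n) (tuples n p)

-- For p = 0 this is 1 or 0 according to the truth of the sentence φ.
⟨_,_⟩ : ∀ {σ c p} → Formula σ c p → Structure σ c → ℚ
⟨_,_⟩ {p = p} φ A =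
  _/_ (+ length (filter (λ ρ → A ⊨? φ [ ρ ]) (tuples (size A) p)))
      (size A ^ p)
      {{ℕ.m^n≢0 (size A) p}}

------------------------------------------------------------------------
-- Locality

module _ {σ : Signature} {c : ℕ} (A : Structure σ c) where

  -- Gaifman adjacency: distinct and contained in a common tuple of a relation.
  Adjacent : V A → V A → Set
  Adjacent u v = u ≢ v ×
    ∃ λ S → ∃ λ t → T (interp A S t) × (u VecMem.∈ t) × (v VecMem.∈ t)

  data Distance≤ : ℕ → V A → V A → Set where
    here : ∀ {r u} → Distance≤ r u u
    step : ∀ {r u v w} → Adjacent u v → Distance≤ r v w → Distance≤ (suc r) u w

  -- The r-neighbourhood of the elements of ρ together with all constants.
  Ball : ∀ {p} → ℕ → Vec (V A) p → V A → Set
  Ball {p} r ρ v = ∃ λ (t : Term c p) → Distance≤ r (eval A ρ t) v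

-- An isomorphism between the substructures of A and B induced by the
-- r-neighbourhoods of ρ and τ (and of the constants), matching ρ with τ and
-- constants with constants.  The mutually inverse maps are given as the
-- restrictions of total maps; since universes are nonempty this is no loss.
record BallIso {σ c p} (r : ℕ)
               (A : Structure σ c) (ρ : Vec (V A) p)
               (B : Structure σ c) (τ : Vec (V B) p) : Set where
  field
    to        : V A → V B
    from      : V B → V A
    to-ball   : ∀ {v} → Ball A r ρ v → Ball B r τ (to v)
    from-ball : ∀ {w} → Ball B r τ w → Ball A r ρ (from w)
    from-to   : ∀ {v} → Ball A r ρ v → from (to v) ≡ v
    to-from   : ∀ {w} → Ball B r τ w → to (from w) ≡ w
    to-interp : ∀ S t → VecAll.All (Ball A r ρ) t →
                interp A S t ≡ interp B S (Vec.map to t)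
    to-term   : ∀ (t : Term c p) → to (eval A ρ t) ≡ eval B τ t

-- Constant-locality; for c = 0 there are no constants and this is locality.
ConstantLocal : ∀ {σ c p} → Formula σ c p → Set
ConstantLocal {σ} {c} {p} φ = ∃ λ (r : ℕ) →
  ∀ (A : Structure σ c) (ρ : Vec (V A) p) (B : Structure σ c) (τ : Vec (V B) p) →
  BallIso r A ρ B τ → (A ⊨ φ [ ρ ]) ⇔ (B ⊨ φ [ τ ])

Local : ∀ {σ p} → Formula σ 0 p → Set
Local = ConstantLocal

------------------------------------------------------------------------
-- Convergence

-- Convergence to a real number, expressed by the Cauchy criterion.
Convergent : (ℕ → ℚ) → Set
Convergent x = ∀ ε → 0ℚ ℚ.< ε →
  ∃ λ N → ∀ m n → N ≤ m → N ≤ n → ∣ x m ℚ.- x n ∣ ℚ.< ε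

-- For a convergent sequence: its limit is a positive real number.
PositiveLimit : (ℕ → ℚ) → Set
PositiveLimit x = ∃ λ ε → 0ℚ ℚ.< ε × ∃ λ N → ∀ n → N ≤ n → ε ℚ.≤ x n

TendsToInfinity : (ℕ → ℕ) → Set
TendsToInfinity s = ∀ M → ∃ λ N → ∀ n → N ≤ n → M ≤ s n

LocalConvergent : ∀ {σ} → (ℕ → Structure σ 0) → Set
LocalConvergent {σ} A =
  ∀ p (φ : Formula σ 0 p) → Local φ → Convergent (λ n → ⟨ φ , A n ⟩)

FOcLocConvergent : ∀ {σ c} → ℕ → (ℕ → Structure σ c) → Set
FOcLocConvergent {σ} {c} p A =
  ∀ (φ : Formula σ c p) → ConstantLocal φ → Convergent (λ n → ⟨ φ , A n ⟩)

ConstantLocalConvergent : ∀ {σ c} → (ℕ → Structure σ c) → Set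
ConstantLocalConvergent A = ∀ p → FOcLocConvergent p A

------------------------------------------------------------------------
-- Base structures and gadgets

BaseStructure : Signature → (k : ℕ) .{{_ : NonZero k}} → Set
BaseStructure σ k = Structure (σ ∪R k) 0

record Gadget (σ : Signature) (k : ℕ) : Set where
  field
    structure     : Structure σ k
    root-distinct : Injective _≡_ _≡_ (constant structure)

  root : Fin k → V structure
  root = constant structure

open Gadget public

-- The atomic formula R(x₁,…,x_k).
R[x] : ∀ {σ} k .{{_ : NonZero k}} → Formula (σ ∪R k) 0 k
R[x] k = rel zero (tabulate var)

∈-tuples : ∀ {n p} (t : Vec (Fin n) p) → t ∈ tuples n p
∈-tuples []      = here refl
∈-tuples (a ∷ t) = ∈-cartesianProductWith⁺ _∷_ (∈-allFin a) (∈-tuples t)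

relationTuples : ∀ {σ c} (A : Structure σ c) (S : Fin (symbols σ)) →
                 List (Vec (V A) (arity σ S))
relationTuples A S = filter (λ t → T? (interp A S t)) (tuples (size A) _)

------------------------------------------------------------------------
-- The gadget construction

module GadgetConstruction {σ : Signature} {k : ℕ} .{{_ : NonZero k}}
                          (A : BaseStructure σ k) (G : Gadget σ k) where

  H : Structure σ k
  H = structure G

  Edge : Set
  Edge = Σ (Vec (V A) k) (λ e → T (interp A zero e))

  Point : Set
  Point = V A ⊎ (Edge × V H)

  data Glue : Point → Point → Set where
    glue : ∀ (e : Edge) (i : Fin k) →
           Glue (inj₁ (lookup (proj₁ e) i)) (inj₂ (e , root G i))

  infix 4 _∼_ _∼?_

  _∼_ : Point → Point → Set
  _∼_ = EqClosure Glue

  edges : List Edge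
  edges = All.toList (all-filter (λ e → T? (interp A zero e)) (tuples (size A) k))

  points : List Point
  points = List.map inj₁ (allFin (size A))
        ++ List.map inj₂ (cartesianProduct edges (allFin (size H)))

  -- To decide ∼, move a root of a gadget copy to the base vertex it is
  -- identified with; this yields a normal form because roots are distinct.

  normal-aux : (e : Edge) (v : V H) → Dec (∃ λ i → root G i ≡ v) → Point
  normal-aux e v (yes (i , _)) = inj₁ (lookup (proj₁ e) i)
  normal-aux e v (no _)        = inj₂ (e , v)

  normal : Point → Point
  normal (inj₁ a)       = inj₁ a
  normal (inj₂ (e , v)) = normal-aux e v (Fin.any? λ i → root G i Fin.≟ v)

  ∼-normal : ∀ x → x ∼ normal x
  ∼-normal (inj₁ a) = ε
  ∼-normal (inj₂ (e , v)) with Fin.any? (λ i → root G i Fin.≟ v)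
  ... | yes (i , refl) = bwd (glue e i) ◅ ε
  ... | no _           = ε

  glue-normal : ∀ {x y} → Glue x y → normal x ≡ normal y
  glue-normal (glue e i) with Fin.any? (λ j → root G j Fin.≟ root G i)
  ... | yes (j , eq) = cong (inj₁ ∘ lookup (proj₁ e)) (sym (root-distinct G eq))
  ... | no  none     = contradiction (i , refl) none

  normal-≡ : ∀ {x y} → x ∼ y → normal x ≡ normal y
  normal-≡ = EqC.gfold isEquivalence normal glue-normal

  _≟E_ : DecidableEquality Edge
  _≟E_ = Product.≡-dec (Vec.≡-dec Fin._≟_) (λ p q → yes (T-irrelevant p q))

  _≟P_ : DecidableEquality Point
  _≟P_ = Sum.≡-dec Fin._≟_ (Product.≡-dec _≟E_ Fin._≟_)

  _∼?_ : Decidable _∼_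
  x ∼? y = map′ normal-∼ normal-≡ (normal x ≟P normal y)
    where
    normal-∼ : normal x ≡ normal y → x ∼ y
    normal-∼ eq = EqC.transitive Glue (∼-normal x)
      (subst (_∼ y) (sym eq) (EqC.symmetric Glue (∼-normal y)))

  ∼-decSetoid : DecSetoid _ _
  ∼-decSetoid = record
    { isDecEquivalence = record
      { isEquivalence = EqC.isEquivalence Glue ; _≟_ = _∼?_ } }

  -- One representative of every ∼-class; the quotient by ∼ is then the set of
  -- positions in this list.
  representatives : List Point
  representatives = deduplicate _∼?_ points

  Quotient : Set
  Quotient = Fin (length representatives)

  ∈-toList : ∀ {xs : List (Vec (V A) k)}
             (pxs : All (λ e → T (interp A zero e)) xs) {e} p →
             e ∈ xs → (e , p) ∈ All.toList pxs
  ∈-toList (q All.∷ _)   p (here refl) = here (cong (_ ,_) (T-irrelevant p q))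
  ∈-toList (_ All.∷ pxs) p (there e∈)  = there (∈-toList pxs p e∈)

  ∈-edges : ∀ e → e ∈ edges
  ∈-edges (e , p) = ∈-toList (all-filter R? (tuples (size A) k)) p
    (∈-filter⁺ R? (∈-tuples e) p)
    where
    R? : ∀ t → Dec (T (interp A zero t))
    R? t = T? (interp A zero t)

  ∈-points : ∀ x → x ∈ points
  ∈-points (inj₁ a)       = ∈-++⁺ˡ (∈-map⁺ inj₁ (∈-allFin a))
  ∈-points (inj₂ (e , v)) = ∈-++⁺ʳ (List.map inj₁ (allFin (size A)))
    (∈-map⁺ inj₂ (∈-cartesianProduct⁺ (∈-edges e) (∈-allFin v)))

  represented : ∀ x → Any (x ∼_) representatives
  represented x = Any.deduplicate⁺ _∼?_
    (λ z∼y x∼y → EqC.transitive Glue x∼y (EqC.symmetric Glue z∼y))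
    (Any.map (λ { refl → ε }) (∈-points x))

  [_]∼ : Point → Quotient
  [ x ]∼ = Any.index (represented x)

  -- [_]∼ is surjective and its kernel is exactly ∼.

  representative : Quotient → Point
  representative = List.lookup representatives

  ∼-representative : ∀ x → x ∼ representative [ x ]∼
  ∼-representative x = Any.lookup-index (represented x)

  lookup-injective : ∀ {xs} → AllPairs (λ x y → ¬ x ∼ y) xs → ∀ i j →
                     List.lookup xs i ∼ List.lookup xs j → i ≡ j
  lookup-injective (_ ∷ _)   zero    zero    _  = refl
  lookup-injective (x≁ ∷ _)  zero    (suc j) eq =
    contradiction eq (All.lookup x≁ (∈-lookup j))
  lookup-injective (x≁ ∷ _)  (suc i) zero    eq =
    contradiction (EqC.symmetric Glue eq) (All.lookup x≁ (∈-lookup i))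
  lookup-injective (_ ∷ xs!) (suc i) (suc j) eq =
    cong suc (lookup-injective xs! i j eq)

  representative-injective : ∀ {i j} → representative i ∼ representative j → i ≡ j
  representative-injective =
    lookup-injective (deduplicate-! ∼-decSetoid points) _ _

  []∼-kernel : ∀ {x y} → ([ x ]∼ ≡ [ y ]∼) ⇔ (x ∼ y)
  []∼-kernel {x} {y} = mk⇔
    (λ eq → EqC.transitive Glue (∼-representative x)
      (subst (λ i → representative i ∼ y) (sym eq)
        (EqC.symmetric Glue (∼-representative y))))
    (λ x∼y → representative-injective
      (EqC.transitive Glue (EqC.symmetric Glue (∼-representative x))
        (EqC.transitive Glue x∼y (∼-representative y))))

  []∼-surjective : ∀ i → [ representative i ]∼ ≡ i
  []∼-surjective i = representative-injective
    (EqC.symmetric Glue (∼-representative (representative i)))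

  baseClass : V A → Quotient
  baseClass a = [ inj₁ a ]∼

  copyClass : Edge → V H → Quotient
  copyClass e v = [ inj₂ (e , v) ]∼

  -- The interpretation of S in A * G, as a list that may contain repetitions.
  productTuples : (S : Fin (symbols σ)) → List (Vec Quotient (arity σ S))
  productTuples S =
       List.map (Vec.map baseClass) (relationTuples A (suc S))
    ++ cartesianProductWith (λ e → Vec.map (copyClass e)) edges (relationTuples H S)

  product : Structure σ 0
  product .size       = length representatives
  product .size≢0     = Fin.nonZeroIndex (baseClass (someVertex A))
  product .interp S t = does (t ∈? productTuples S)
    where open DecMembership (Vec.≡-dec Fin._≟_) using (_∈?_)
  product .constant ()

infixl 7 _⊛_

_⊛_ : ∀ {σ k} .{{_ : NonZero k}} → BaseStructure σ k → Gadget σ k → Structure σ 0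
A ⊛ G = GadgetConstruction.product A G

{-# OPTIONS --safe #-}
module Submission where

-- Relativised to a ball, a local formula becomes guarded, and guarded formulas
-- are local.  Let the variables of a guarded formula be assigned to base vertices
-- and to vertices in the gadget copies on distinct edges.  By a Feferman–Vaught
-- argument, its truth in A * G is a disjunction of rectangles: conjunctions of a
-- guarded formula of A, one guarded formula of G per copy, and a guarded sentence
-- of G.  A random tuple of A * G is sampled one vertex at a time: a base vertex,
-- a vertex of a copy met before, or a vertex of a new copy.  The weights of these
-- choices converge because 1 / |A|, 1 / |G| and ⟨R, A⟩ do and the limit of the
-- latter is positive; by inclusion–exclusion, each pattern of choices contributes
-- products of probabilities in A and in G.  If |A| → ∞, the patterns that return
-- to a copy have vanishing weight, and in the others each copy contains a single
-- vertex, so that formulas of G with one free variable suffice.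

open import Algebra.Bundles using (CommutativeRing)
import Algebra.Properties.Semiring.Sum as SemiringSum
open import Data.Bool.Base using (false; T)
open import Data.Bool.Properties using (T?; T-irrelevant)
open import Data.Empty using (⊥)
open import Data.Fin.Base as Fin using (Fin; zero; suc; _↑ˡ_; _↑ʳ_)
import Data.Fin.Properties as Fin
open import Data.Integer.Base as ℤ using (+_)
import Data.Integer.Properties as ℤ
open import Data.List.Base as List
  using (List; []; _∷_; _++_; allFin; cartesianProductWith; filter; length)
open import Data.List.Membership.Propositional using (_∈_)
import Data.List.Membership.Propositional.Properties as ListMem
import Data.List.Membership.DecPropositional as DecMembership
open import Data.List.Relation.Unary.All as All using (All; []; _∷_)
open import Data.List.Relation.Unary.Any as Any using (Any; here; there)
import Data.List.Relation.Unary.Any.Properties as Any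
open import Data.Nat.Base as ℕ using (ℕ; zero; suc; NonZero; _+_; _≤_; _<_; z≤n; s≤s; _⊔_)
import Data.Nat.Properties as ℕ
open import Data.Product.Base using (∃; _×_; _,_; proj₁; proj₂)
open import Data.Rational.Base as ℚ using (ℚ; 0ℚ; 1ℚ; ½; _*_)
import Data.Rational.Properties as ℚ
open import Data.Rational.Solver using (module +-*-Solver)
import Data.Rational.Unnormalised.Base as ℚᵘ
import Data.Rational.Unnormalised.Properties as ℚᵘ
open import Data.Sum.Base using (_⊎_; inj₁; inj₂; [_,_]′)
open import Data.Unit.Base using (⊤; tt)
open import Data.Vec.Base as Vec using (Vec; []; _∷_; lookup; tabulate)
import Data.Vec.Properties as Vec
import Data.Vec.Membership.Propositional as VecMem
import Data.Vec.Membership.Propositional.Properties as VecMem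
open import Data.Vec.Relation.Unary.All as VecAll using ([]; _∷_)
import Data.Vec.Relation.Unary.All.Properties as VecAll
open import Data.Vec.Relation.Unary.Any as VecAny using (here; there)
import Data.Vec.Relation.Unary.Any.Properties as VecAny
open import Function.Base using (_∘_; id)
open import Function.Bundles using (_⇔_; mk⇔; module Equivalence)
import Function.Properties.Equivalence as ⇔
open import Relation.Binary.PropositionalEquality
  using (_≡_; _≢_; refl; sym; trans; cong; cong₂; subst; module ≡-Reasoning)
open import Relation.Nullary.Decidable
  using (Dec; yes; no; does; map′; ¬?; _×-dec_; decidable-stable)
open import Relation.Nullary.Negation using (¬_; contradiction)
import Relation.Binary.Construct.Closure.Equivalence as EqClosure
import Data.List.Relation.Unary.Unique.Propositional.Properties as Unique
open import Data.List.Relation.Unary.AllPairs using (AllPairs; _∷_)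
open import Defs
open Equivalence using (to; from)
open SemiringSum (CommutativeRing.semiring ℚ.+-*-commutativeRing)
  using (sum; sum-cong-≗; *-distribˡ-sum; ∑-distrib-+; ∑-comm; sum-replicate-zero)
open +-*-Solver using (solve; _:=_; _:+_; _:*_; :-_; con)

-- Guards are what confines the quantifiers to boundedly many copies. A quantifier can enter a copy
-- without named vertices only through a base vertex on its edge, and guarded formulas of `A` reach
-- such an edge by using `R` itself as a guard. Nothing in that copy but its roots is named, so what
-- is said about it speaks of the roots alone. This is the origin of the gadget sentences, and the
-- reason why `G` has to converge for constant-local formulas. The weights rest on |A * G| = |A| +
-- |R| (|G| - k). The weight of a new copy is the inverse of |A|^(1-k) / |G| + ⟨R, A⟩ (1 - k / |G|).
-- This sum converges, but it also has to stay away from 0. Positive density of `R` guarantees that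
-- once |G| > k; when |G| = k the sum may tend to 0, so this case is split off, which is possible
-- because 1 / |G| converges.

variable
  σ : Signature
  c l m n p : ℕ

∃-⇔ : ∀ {X : Set} {P Q : X → Set} → (∀ x → P x ⇔ Q x) → ∃ P ⇔ ∃ Q
∃-⇔ e = mk⇔ (λ (x , p) → x , to (e x) p) (λ (x , q) → x , from (e x) q)

×-⇔ : {P P′ Q Q′ : Set} → P ⇔ Q → P′ ⇔ Q′ → (P × P′) ⇔ (Q × Q′)
×-⇔ e e′ = mk⇔ (λ (p , p′) → to e p , to e′ p′) (λ (q , q′) → from e q , from e′ q′)

⊎-⇔ : {P P′ Q Q′ : Set} → P ⇔ Q → P′ ⇔ Q′ → (P ⊎ P′) ⇔ (Q ⊎ Q′)
⊎-⇔ e e′ = mk⇔ [ inj₁ ∘ to e , inj₂ ∘ to e′ ]′ [ inj₁ ∘ from e , inj₂ ∘ from e′ ]′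

¬-⇔ : {P Q : Set} → P ⇔ Q → (¬ P) ⇔ (¬ Q)
¬-⇔ e = mk⇔ (_∘ from e) (_∘ to e)

≡-⇔ : {P Q : Set} → P ≡ Q → P ⇔ Q
≡-⇔ refl = ⇔.refl

-- Guarded formulas

-- Quantifiers only reach elements that share a tuple with a named element, so
-- every guarded formula is constant-local.
data Guarded (σ : Signature) (c : ℕ) : ℕ → Set where
  eqᵍ  : Term c n → Term c n → Guarded σ c n
  relᵍ : (S : Fin (symbols σ)) → Vec (Term c n) (arity σ S) → Guarded σ c n
  notᵍ : Guarded σ c n → Guarded σ c n
  andᵍ : Guarded σ c n → Guarded σ c n → Guarded σ c n
  orᵍ  : (m : ℕ) → (Fin m → Guarded σ c n) → Guarded σ c n
  exᵍ  : Fin (symbols σ) → Term c n → Guarded σ c (suc n) → Guarded σ c n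

module _ {σ : Signature} {c : ℕ} (A : Structure σ c) where

  -- In contrast to `Adjacent`, the symbol is fixed and `u` and `v` may coincide. Links therefore
  -- survive the non-injective maps `copy e`, and a link in A * G comes from a link in `A` or in one
  -- gadget copy.
  Linked : Fin (symbols σ) → V A → V A → Set
  Linked S u v = ∃ λ t → T (interp A S t) × (∃ λ i → lookup t i ≡ u) × (∃ λ j → lookup t j ≡ v)

  infix 4 _⊩_[_]

  _⊩_[_] : Guarded σ c n → Vec (V A) n → Set
  _⊩_[_] (eqᵍ s t)    ρ = eval A ρ s ≡ eval A ρ t
  _⊩_[_] (relᵍ S ts)  ρ = T (interp A S (Vec.map (eval A ρ) ts))
  _⊩_[_] (notᵍ φ)     ρ = ¬ _⊩_[_] φ ρ
  _⊩_[_] (andᵍ φ ψ)   ρ = _⊩_[_] φ ρ × _⊩_[_] ψ ρ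
  _⊩_[_] (orᵍ m φ)    ρ = ∃ λ i → _⊩_[_] (φ i) ρ
  _⊩_[_] (exᵍ S t φ)  ρ = ∃ λ a → Linked S (eval A ρ t) a × _⊩_[_] φ (a ∷ ρ)

weakenTerm : Term c n → Term c (suc n)
weakenTerm (var i) = var (suc i)
weakenTerm (con j) = con j

shiftTerm : ∀ l → Term c n → Term c (l + n)
shiftTerm l (var i) = var (l ↑ʳ i)
shiftTerm l (con j) = con j

substTerm : (Fin n → Term c m) → Term c n → Term c m
substTerm f (var i) = f i
substTerm f (con j) = con j

liftSubst : (Fin n → Term c m) → Fin (suc n) → Term c (suc m)
liftSubst f zero    = var zero
liftSubst f (suc i) = weakenTerm (f i)

substᵍ : (Fin n → Term c m) → Guarded σ c n → Guarded σ c m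
substᵍ f (eqᵍ s t)   = eqᵍ (substTerm f s) (substTerm f t)
substᵍ f (relᵍ S ts) = relᵍ S (Vec.map (substTerm f) ts)
substᵍ f (notᵍ φ)    = notᵍ (substᵍ f φ)
substᵍ f (andᵍ φ ψ)  = andᵍ (substᵍ f φ) (substᵍ f ψ)
substᵍ f (orᵍ m φ)   = orᵍ m (λ i → substᵍ f (φ i))
substᵍ f (exᵍ S t φ) = exᵍ S (substTerm f t) (substᵍ (liftSubst f) φ)

module _ (A : Structure σ c) where

  eval-weaken : ∀ {a} {ρ : Vec (V A) n} t → eval A (a ∷ ρ) (weakenTerm t) ≡ eval A ρ t
  eval-weaken (var i) = refl
  eval-weaken (con j) = refl

  eval-shift : ∀ (xs : Vec (V A) l) {ρ : Vec (V A) n} t →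
               eval A (xs Vec.++ ρ) (shiftTerm l t) ≡ eval A ρ t
  eval-shift xs {ρ} (var i) = Vec.lookup-++ʳ xs ρ i
  eval-shift xs     (con j) = refl

  eval-subst : ∀ {f : Fin n → Term c m} {ρ τ} → (∀ i → eval A τ (f i) ≡ lookup ρ i) →
               ∀ t → eval A τ (substTerm f t) ≡ eval A ρ t
  eval-subst h (var i) = h i
  eval-subst h (con j) = refl

  ⊩-subst : ∀ {f : Fin n → Term c m} {ρ τ} → (∀ i → eval A τ (f i) ≡ lookup ρ i) →
            ∀ (φ : Guarded σ c n) → (A ⊩ substᵍ f φ [ τ ]) ⇔ (A ⊩ φ [ ρ ])
  ⊩-subst h (eqᵍ s t) = ≡-⇔ (cong₂ _≡_ (eval-subst h s) (eval-subst h t))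
  ⊩-subst {f = f} h (relᵍ S ts) = ≡-⇔ (cong (T ∘ interp A S)
    (trans (sym (Vec.map-∘ _ (substTerm f) ts)) (Vec.map-cong (eval-subst h) ts)))
  ⊩-subst h (notᵍ φ)   = ¬-⇔ (⊩-subst h φ)
  ⊩-subst h (andᵍ φ ψ) = ×-⇔ (⊩-subst h φ) (⊩-subst h ψ)
  ⊩-subst h (orᵍ m φ)  = ∃-⇔ λ i → ⊩-subst h (φ i)
  ⊩-subst {f = f} {ρ} {τ} h (exᵍ S t φ) = ∃-⇔ λ a →
    ×-⇔ (≡-⇔ (cong (λ u → Linked A S u a) (eval-subst h t))) (⊩-subst (lifted a) φ)
    where
    lifted : ∀ a i → eval A (a ∷ τ) (liftSubst f i) ≡ lookup (a ∷ ρ) i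
    lifted a zero    = refl
    lifted a (suc i) = trans (eval-weaken (f i)) (h i)

-- Guarded formulas as first-order formulas

-- False because universes are nonempty.
⊥ᶠ : Formula σ c n
⊥ᶠ = ¬′ (∃′ (var zero ≐ var zero))

anyᶠ : ∀ m → (Fin m → Formula σ c n) → Formula σ c n
anyᶠ zero    φ = ⊥ᶠ
anyᶠ (suc m) φ = ¬′ (¬′ φ zero ∧′ ¬′ anyᶠ m (φ ∘ suc))

∃ᶠ : ∀ s → Formula σ c (s + n) → Formula σ c n
∃ᶠ zero    φ = φ
∃ᶠ (suc s) φ = ∃ᶠ s (∃′ φ)

linkedᶠ : (S : Fin (symbols σ)) → Term c n → Term c n → Formula σ c n
linkedᶠ {σ = σ} {n = n} S u v = ∃ᶠ s
  (rel S (tabulate new) ∧′ anyᶠ s (λ i → new i ≐ shiftTerm s u) ∧′ anyᶠ s (λ i → new i ≐ shiftTerm s v))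
  where
  s = arity σ S
  new : Fin s → Term _ (s + n)
  new i = var (i ↑ˡ n)

compile : Guarded σ c n → Formula σ c n
compile (eqᵍ s t)   = s ≐ t
compile (relᵍ S ts) = rel S ts
compile (notᵍ φ)    = ¬′ compile φ
compile (andᵍ φ ψ)  = compile φ ∧′ compile ψ
compile (orᵍ m φ)   = anyᶠ m (λ i → compile (φ i))
compile (exᵍ S t φ) = ∃′ (linkedᶠ S (weakenTerm t) (var zero) ∧′ compile φ)

module _ (A : Structure σ c) where

  ⊨-any : ∀ m (φ : Fin m → Formula σ c n) {ρ} → (A ⊨ anyᶠ m φ [ ρ ]) ⇔ (∃ λ i → A ⊨ φ i [ ρ ])
  ⊨-any zero    φ = mk⇔ (λ none → contradiction (someVertex A , refl) none) (λ ())
  ⊨-any (suc m) φ {ρ} = mk⇔ there′ back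
    where
    there′ : A ⊨ anyᶠ (suc m) φ [ ρ ] → ∃ λ i → A ⊨ φ i [ ρ ]
    there′ nn with A ⊨? φ zero [ ρ ] | A ⊨? anyᶠ m (φ ∘ suc) [ ρ ]
    ... | yes y | _     = zero , y
    ... | no _  | yes y = let (i , q) = to (⊨-any m (φ ∘ suc)) y in suc i , q
    ... | no a  | no b  = contradiction (a , b) nn
    back : (∃ λ i → A ⊨ φ i [ ρ ]) → A ⊨ anyᶠ (suc m) φ [ ρ ]
    back (zero  , q) (a , _) = a q
    back (suc i , q) (_ , b) = b (from (⊨-any m (φ ∘ suc)) (i , q))

  ⊨-∃ᶠ : ∀ s {φ : Formula σ c (s + n)} {ρ} →
         (A ⊨ ∃ᶠ s φ [ ρ ]) ⇔ (∃ λ xs → A ⊨ φ [ xs Vec.++ ρ ])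
  ⊨-∃ᶠ zero    = mk⇔ ([] ,_) (λ { ([] , q) → q })
  ⊨-∃ᶠ (suc s) = ⇔.trans (⊨-∃ᶠ s)
    (mk⇔ (λ (xs , x , q) → x ∷ xs , q) (λ { (x ∷ xs , q) → xs , x , q }))

  ⊨-linked : ∀ S (u v : Term c n) {ρ} →
             (A ⊨ linkedᶠ S u v [ ρ ]) ⇔ Linked A S (eval A ρ u) (eval A ρ v)
  ⊨-linked S u v {ρ} = ⇔.trans (⊨-∃ᶠ (arity σ S)) (∃-⇔ λ t →
    ×-⇔ (≡-⇔ (cong (T ∘ interp A S) (tuple t))) (×-⇔ (member t u) (member t v)))
    where
    new : Fin (arity σ S) → Term c (arity σ S + _)
    new i = var (i ↑ˡ _)
    tuple : ∀ t → Vec.map (eval A (t Vec.++ ρ)) (tabulate new) ≡ t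
    tuple t = trans (sym (Vec.tabulate-∘ _ new))
      (trans (Vec.tabulate-cong (Vec.lookup-++ˡ t ρ)) (Vec.tabulate∘lookup t))
    member : ∀ t w → (A ⊨ anyᶠ _ (λ i → new i ≐ shiftTerm _ w) [ t Vec.++ ρ ]) ⇔
                     (∃ λ i → lookup t i ≡ eval A ρ w)
    member t w = ⇔.trans (⊨-any _ _) (∃-⇔ λ i →
      ≡-⇔ (cong₂ _≡_ (Vec.lookup-++ˡ t ρ i) (eval-shift A t w)))

  ⊨-compile : ∀ (φ : Guarded σ c n) {ρ} → (A ⊨ compile φ [ ρ ]) ⇔ (A ⊩ φ [ ρ ])
  ⊨-compile (eqᵍ s t)   = ⇔.refl
  ⊨-compile (relᵍ S ts) = ⇔.refl
  ⊨-compile (notᵍ φ)    = ¬-⇔ (⊨-compile φ)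
  ⊨-compile (andᵍ φ ψ)  = ×-⇔ (⊨-compile φ) (⊨-compile ψ)
  ⊨-compile (orᵍ m φ)   = ⇔.trans (⊨-any m _) (∃-⇔ λ i → ⊨-compile (φ i))
  ⊨-compile (exᵍ S t φ) = ∃-⇔ λ a → ×-⇔
    (⇔.trans (⊨-linked S (weakenTerm t) (var zero))
      (≡-⇔ (cong (λ u → Linked A S u a) (eval-weaken A t))))
    (⊨-compile φ)

  infix 4 _⊩?_[_]

  _⊩?_[_] : ∀ (φ : Guarded σ c n) ρ → Dec (A ⊩ φ [ ρ ])
  _⊩?_[_] φ ρ = map′ (to (⊨-compile φ)) (from (⊨-compile φ)) (A ⊨? compile φ [ ρ ])

-- Invariance of guarded formulas under isomorphisms of balls

module _ (A : Structure σ c) where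

  Distance≤-mono : ∀ {d e u v} → d ≤ e → Distance≤ A d u v → Distance≤ A e u v
  Distance≤-mono d≤e       here       = here
  Distance≤-mono (s≤s d≤e) (step a δ) = step a (Distance≤-mono d≤e δ)

  Distance≤-trans : ∀ {d e u v w} → Distance≤ A d u v → Distance≤ A e v w → Distance≤ A (d + e) u w
  Distance≤-trans {d} {e} here δ = Distance≤-mono (ℕ.m≤n+m e d) δ
  Distance≤-trans (step a δ) ε   = step a (Distance≤-trans δ ε)

  Ball-mono : ∀ {d e} {ρ : Vec (V A) p} {v} → d ≤ e → Ball A d ρ v → Ball A e ρ v
  Ball-mono d≤e (t , δ) = t , Distance≤-mono d≤e δ

  Ball-extend : ∀ {d e f} {ρ : Vec (V A) p} {u v} → d + e ≤ f →
                Ball A d ρ u → Distance≤ A e u v → Ball A f ρ v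
  Ball-extend le (t , δ) ε = t , Distance≤-mono le (Distance≤-trans δ ε)

  tuple-distance : ∀ {S t u v} → T (interp A S t) → u VecMem.∈ t → v VecMem.∈ t → Distance≤ A 1 u v
  tuple-distance {u = u} {v} q u∈ v∈ with u Fin.≟ v
  ... | yes refl = here
  ... | no u≢v   = step (u≢v , _ , _ , q , u∈ , v∈) here

  tuple-ball : ∀ {S t u d} {ρ : Vec (V A) p} → T (interp A S t) → u VecMem.∈ t →
               Ball A d ρ u → VecAll.All (Ball A (suc d) ρ) t
  tuple-ball {d = d} q u∈ b = VecAll.lookup⁻ λ i →
    Ball-extend (ℕ.≤-reflexive (ℕ.+-comm d 1)) b (tuple-distance q u∈ (VecMem.∈-lookup i _))

  linked-distance : ∀ {S u v} → Linked A S u v → Distance≤ A 1 u v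
  linked-distance (t , q , (i , refl) , (j , refl)) =
    tuple-distance q (VecMem.∈-lookup i t) (VecMem.∈-lookup j t)

  Ball-cons : ∀ {d e f a} {ρ : Vec (V A) p} {v} → Ball A d ρ a → d + e ≤ f →
              Ball A e (a ∷ ρ) v → Ball A f ρ v
  Ball-cons b le (var zero    , δ) = Ball-extend le b δ
  Ball-cons {d = d} b le (var (suc i) , δ) = var i , Distance≤-mono (ℕ.m+n≤o⇒n≤o d le) δ
  Ball-cons {d = d} b le (con j       , δ) = con j , Distance≤-mono (ℕ.m+n≤o⇒n≤o d le) δ

module _ {A B : Structure σ c} where

  BallIso-sym : ∀ {r} {ρ : Vec (V A) p} {τ : Vec (V B) p} → BallIso r A ρ B τ → BallIso r B τ A ρ
  BallIso-sym {ρ = ρ} {τ} I = record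
    { to        = I.from ; from = I.to
    ; to-ball   = I.from-ball ; from-ball = I.to-ball
    ; from-to   = I.to-from ; to-from = I.from-to
    ; to-interp = λ S t bs → trans
        (cong (interp B S) (sym (trans (sym (Vec.map-∘ I.to I.from t)) (map-id bs))))
        (sym (I.to-interp S (Vec.map I.from t) (VecAll.map⁺ (VecAll.map I.from-ball bs))))
    ; to-term   = λ t → trans (cong I.from (sym (I.to-term t))) (I.from-to (t , here))
    }
    where
    module I = BallIso I
    map-id : ∀ {t : Vec (V B) l} → VecAll.All (Ball B _ τ) t → Vec.map (I.to ∘ I.from) t ≡ t
    map-id []       = refl
    map-id (b ∷ bs) = cong₂ _∷_ (I.to-from b) (map-id bs)

module _ {A B : Structure σ c} {ρ : Vec (V A) p} {τ : Vec (V B) p} {R : ℕ}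
         (I : BallIso R A ρ B τ) where
  private module I = BallIso I

  to-tuple : ∀ {S t} → T (interp A S t) → VecAll.All (Ball A R ρ) t → T (interp B S (Vec.map I.to t))
  to-tuple q bs = subst T (I.to-interp _ _ bs) q

  -- The bound `i + d ≤ R` keeps the path, and every entry of the tuples witnessing its steps, in
  -- the ball where `I` is an isomorphism: a tuple through a vertex of depth `i` has depth at most
  -- `suc i`. Consecutive vertices stay distinct because `from` undoes `to` there.
  to-distance : ∀ {i d u w} → Ball A i ρ u → i + d ≤ R → Distance≤ A d u w →
                Distance≤ B d (I.to u) (I.to w)
  to-distance b le here = here
  to-distance {i} {suc d} {u} b le (step {v = v} a@(u≢v , S , t , q , u∈ , v∈) δ) =
    step (to-≢ , S , Vec.map I.to t , to-tuple q (VecAll.map (Ball-mono A 1+i≤R) (tuple-ball A q u∈ b))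
         , VecMem.∈-map⁺ I.to u∈ , VecMem.∈-map⁺ I.to v∈)
      (to-distance b′ le′ δ)
    where
    b′ = Ball-extend A (ℕ.≤-reflexive (ℕ.+-comm i 1)) b (step a here)
    le′ : suc i + d ≤ R
    le′ = ℕ.≤-trans (ℕ.≤-reflexive (sym (ℕ.+-suc i d))) le
    1+i≤R = ℕ.m+n≤o⇒m≤o (suc i) le′
    to-≢ : I.to u ≢ I.to v
    to-≢ eq = u≢v (trans (sym (I.from-to (Ball-mono A (ℕ.m+n≤o⇒m≤o i le) b)))
      (trans (cong I.from eq) (I.from-to (Ball-mono A 1+i≤R b′))))

  ball-cons : ∀ {r a v} → suc r ≤ R → Ball A 1 ρ a → Ball A r (a ∷ ρ) v →
              Ball B r (I.to a ∷ τ) (I.to v)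
  ball-cons le b (var zero    , δ) = var zero , to-distance b le δ
  ball-cons le b (var (suc i) , δ) = var (suc i) ,
    subst (λ u → Distance≤ B _ u _) (I.to-term (var i)) (to-distance {0} (var i , here) (ℕ.<⇒≤ le) δ)
  ball-cons le b (con j       , δ) = con j ,
    subst (λ u → Distance≤ B _ u _) (I.to-term (con j)) (to-distance {0} (con j , here) (ℕ.<⇒≤ le) δ)

-- A guarded witness is within distance 1 of a named element, so the smaller ball around the
-- extended tuple lies in the old one. Each quantifier costs one unit of radius.
BallIso-cons : ∀ {A B : Structure σ c} {ρ : Vec (V A) p} {τ : Vec (V B) p} {r} →
               (I : BallIso (suc r) A ρ B τ) → ∀ {a} → Ball A 1 ρ a →
               BallIso r A (a ∷ ρ) B (BallIso.to I a ∷ τ)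
BallIso-cons {A = A} {B} {ρ} {τ} {r} I {a} b = record
  { to        = I.to ; from = I.from
  ; to-ball   = ball-cons I ℕ.≤-refl b
  ; from-ball = λ b″ → subst (λ x → Ball A r (x ∷ ρ) _) from-to-a
                  (ball-cons (BallIso-sym I) ℕ.≤-refl b′ b″)
  ; from-to   = λ b″ → I.from-to (Ball-cons A b ℕ.≤-refl b″)
  ; to-from   = λ b″ → I.to-from (Ball-cons B b′ ℕ.≤-refl b″)
  ; to-interp = λ S t bs → I.to-interp S t (VecAll.map (Ball-cons A b ℕ.≤-refl) bs)
  ; to-term   = λ { (var zero) → refl ; (var (suc i)) → I.to-term (var i) ; (con j) → I.to-term (con j) }
  }
  where
  module I = BallIso I
  from-to-a : I.from (I.to a) ≡ a
  from-to-a = I.from-to (Ball-mono A (s≤s z≤n) b)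
  b′ : Ball B 1 τ (I.to a)
  b′ = let (t , δ) = b in t , subst (λ x → Distance≤ B 1 x (I.to a)) (I.to-term t)
         (to-distance I {0} (t , here) (s≤s z≤n) δ)

⨆ : ∀ m → (Fin m → ℕ) → ℕ
⨆ zero    f = 0
⨆ (suc m) f = f zero ⊔ ⨆ m (f ∘ suc)

≤⨆ : ∀ {m} (f : Fin m → ℕ) i → f i ≤ ⨆ m f
≤⨆ f zero    = ℕ.m≤m⊔n _ _
≤⨆ f (suc i) = ℕ.≤-trans (≤⨆ (f ∘ suc) i) (ℕ.m≤n⊔m _ _)

rank : Guarded σ c n → ℕ
rank (eqᵍ s t)   = 0
rank (relᵍ S ts) = 0
rank (notᵍ φ)    = rank φ
rank (andᵍ φ ψ)  = rank φ ⊔ rank ψ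
rank (orᵍ m φ)   = ⨆ m (λ i → rank (φ i))
rank (exᵍ S t φ) = suc (rank φ)

⊩-invariant : ∀ {A B : Structure σ c} {ρ : Vec (V A) p} {τ : Vec (V B) p} {r} (φ : Guarded σ c p) →
              rank φ ≤ r → BallIso r A ρ B τ → A ⊩ φ [ ρ ] → B ⊩ φ [ τ ]
⊩-invariant (eqᵍ s t) _ I q =
  trans (sym (BallIso.to-term I s)) (trans (cong (BallIso.to I) q) (BallIso.to-term I t))
⊩-invariant {B = B} {r = r} (relᵍ S ts) _ I q = subst (T ∘ interp B S)
  (trans (sym (Vec.map-∘ _ _ ts)) (Vec.map-cong (BallIso.to-term I) ts))
  (to-tuple I q (VecAll.map⁺ (VecAll.universal (λ t → t , here) ts)))
-- Negation reverses the implication, so the inverse isomorphism is used.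
⊩-invariant (notᵍ φ) le I ¬q q = ¬q (⊩-invariant φ le (BallIso-sym I) q)
⊩-invariant (andᵍ φ ψ) le I (q , q′) =
  ⊩-invariant φ (ℕ.m⊔n≤o⇒m≤o _ _ le) I q , ⊩-invariant ψ (ℕ.m⊔n≤o⇒n≤o (rank φ) _ le) I q′
⊩-invariant (orᵍ m φ) le I (i , q) =
  i , ⊩-invariant (φ i) (ℕ.≤-trans (≤⨆ (rank ∘ φ) i) le) I q
⊩-invariant {A = A} {B} {ρ} {τ} (exᵍ S t φ) (s≤s le) I (a , l@(x , q , (i , i≡) , (j , j≡)) , sat) =
  BallIso.to I a , (Vec.map (BallIso.to I) x
    -- The tuple of the guard contains the value of `t`, hence lies in the ball of radius 1.
    , to-tuple I q (VecAll.map (Ball-mono A (s≤s z≤n))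
        (tuple-ball A {d = 0} q (VecMem.∈-lookup i x) (subst (Ball A 0 ρ) (sym i≡) (t , here))))
    , (i , trans (Vec.lookup-map i _ x) (trans (cong (BallIso.to I) i≡) (BallIso.to-term I t)))
    , (j , trans (Vec.lookup-map j _ x) (cong (BallIso.to I) j≡)))
  , ⊩-invariant φ le (BallIso-cons I (t , linked-distance A l)) sat

compile-local : (φ : Guarded σ c n) → ConstantLocal (compile φ)
compile-local φ = rank φ , λ A ρ B τ I →
  ⇔.trans (⊨-compile A φ) (⇔.trans
    (mk⇔ (⊩-invariant φ ℕ.≤-refl I) (⊩-invariant φ ℕ.≤-refl (BallIso-sym I)))
    (⇔.sym (⊨-compile B φ)))


-- Local formulas are guarded

instantiate : Term c n → Fin (suc n) → Term c n
instantiate t zero    = t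
instantiate t (suc i) = var i

skipSecond : Fin (suc n) → Term c (suc (suc n))
skipSecond zero    = var zero
skipSecond (suc i) = var (suc (suc i))

-- A bounded quantifier unfolded along a path: the witness is `t` itself, or the path begins with a
-- step along some symbol. After a step `skipSecond` makes `φ` ignore the intermediate vertex.
withinᵍ : ℕ → Term c n → Guarded σ c (suc n) → Guarded σ c n
withinᵍ         zero    t φ = substᵍ (instantiate t) φ
withinᵍ {σ = σ} (suc r) t φ = orᵍ (suc (symbols σ)) λ where
  zero    → substᵍ (instantiate t) φ
  (suc S) → exᵍ S t (withinᵍ r (var zero) (substᵍ skipSecond φ))

-- `centre` tracks the original free variables below the binders. Quantifiers are bounded around
-- these only, never around bound variables, so all of them range over one and the same ball.
relativise : ℕ → (Fin p → Fin n) → Formula σ 0 n → Guarded σ 0 n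
relativise         r centre (s ≐ t)    = eqᵍ s t
relativise         r centre (rel S ts) = relᵍ S ts
relativise         r centre (¬′ φ)     = notᵍ (relativise r centre φ)
relativise         r centre (φ ∧′ ψ)   = andᵍ (relativise r centre φ) (relativise r centre ψ)
relativise {p = p} r centre (∃′ φ)     =
  orᵍ p λ i → withinᵍ r (var (centre i)) (relativise r (suc ∘ centre) φ)

module _ (A : Structure σ c) where

  ⊩-instantiate : ∀ (t : Term c n) (φ : Guarded σ c (suc n)) {ρ} →
                  (A ⊩ substᵍ (instantiate t) φ [ ρ ]) ⇔ (A ⊩ φ [ eval A ρ t ∷ ρ ])
  ⊩-instantiate t φ = ⊩-subst A (λ { zero → refl ; (suc i) → refl }) φ

  ⊩-within : ∀ r (t : Term c n) (φ : Guarded σ c (suc n)) {ρ} →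
             (A ⊩ withinᵍ r t φ [ ρ ]) ⇔ (∃ λ a → Distance≤ A r (eval A ρ t) a × A ⊩ φ [ a ∷ ρ ])
  ⊩-within zero t φ {ρ} = mk⇔
    (λ sat → _ , here , to (⊩-instantiate t φ) sat)
    (λ { (_ , here , sat) → from (⊩-instantiate t φ) sat })
  ⊩-within (suc r) t φ {ρ} = mk⇔ ⇒ ⇐
    where
    skip : ∀ {a b} → (A ⊩ substᵍ skipSecond φ [ a ∷ b ∷ ρ ]) ⇔ (A ⊩ φ [ a ∷ ρ ])
    skip = ⊩-subst A (λ { zero → refl ; (suc i) → refl }) φ
    ⇒ : A ⊩ withinᵍ (suc r) t φ [ ρ ] → ∃ λ a → Distance≤ A (suc r) (eval A ρ t) a × A ⊩ φ [ a ∷ ρ ]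
    ⇒ (zero , sat) = _ , here , to (⊩-instantiate t φ) sat
    ⇒ (suc S , b , link , sat) =
      let (a , δ , sat′) = to (⊩-within r (var zero) (substᵍ skipSecond φ)) sat
      in a , Distance≤-trans A (linked-distance A link) δ , to skip sat′
    ⇐ : (∃ λ a → Distance≤ A (suc r) (eval A ρ t) a × A ⊩ φ [ a ∷ ρ ]) → A ⊩ withinᵍ (suc r) t φ [ ρ ]
    ⇐ (a , here , sat) = zero , from (⊩-instantiate t φ) sat
    ⇐ (a , step (_ , S , x , q , u∈ , v∈) δ , sat) = suc S , _ ,
      (x , q , (VecAny.index u∈ , sym (VecAny.lookup-index u∈)) , (VecAny.index v∈ , sym (VecAny.lookup-index v∈))) ,
      from (⊩-within r (var zero) (substᵍ skipSecond φ)) (a , δ , from skip sat)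

  -- `withinᵍ` expresses the distance bound by a guarded formula, and truth of guarded formulas is
  -- decidable.
  Distance≤? : ∀ r u v → Dec (Distance≤ A r u v)
  Distance≤? r u v = map′
    (λ sat → let (_ , δ , eq) = to within sat in subst (Distance≤ A r u) eq δ)
    (λ δ → from within (v , δ , refl))
    (A ⊩? withinᵍ r (var zero) (eqᵍ (var zero) (var (suc (suc zero)))) [ u ∷ v ∷ [] ])
    where
    within = ⊩-within r (var zero) (eqᵍ (var zero) (var (suc (suc zero)))) {u ∷ v ∷ []}

-- Substructures induced by balls

lookup-injective : ∀ {X : Set} {xs : List X} → AllPairs _≢_ xs → ∀ i j →
                   List.lookup xs i ≡ List.lookup xs j → i ≡ j
lookup-injective (_ ∷ _)   zero    zero    _  = refl
lookup-injective (x≢ ∷ _)  zero    (suc j) eq = contradiction eq (All.lookup x≢ (ListMem.∈-lookup j))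
lookup-injective (x≢ ∷ _)  (suc i) zero    eq = contradiction (sym eq) (All.lookup x≢ (ListMem.∈-lookup i))
lookup-injective (_ ∷ xs!) (suc i) (suc j) eq = cong suc (lookup-injective xs! i j eq)

-- A local formula does not distinguish `B` from the substructure induced by the ball, and there an
-- unbounded quantifier ranges over exactly the ball. At least one centre is present because the
-- substructure must be nonempty.
module InducedBall {σ p} (r : ℕ) (B : Structure σ 0) (ρ : Vec (V B) (suc p)) where

  Ball? : ∀ v → Dec (Ball B r ρ v)
  Ball? v = map′ (λ (i , δ) → var i , δ) (λ { (var i , δ) → i , δ ; (con () , _) })
    (Fin.any? λ i → Distance≤? B r (lookup ρ i) v)

  ball : List (V B)
  ball = filter Ball? (allFin (size B))

  embed : Fin (length ball) → V B
  embed = List.lookup ball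

  embed-injective : ∀ {i j} → embed i ≡ embed j → i ≡ j
  embed-injective = lookup-injective (Unique.filter⁺ Ball? (Unique.allFin⁺ (size B))) _ _

  embed-ball : ∀ i → Ball B r ρ (embed i)
  embed-ball i = proj₂ (ListMem.∈-filter⁻ Ball? {xs = allFin (size B)} (ListMem.∈-lookup i))

  member : ∀ {v} → Ball B r ρ v → v ∈ ball
  member {v} b = ListMem.∈-filter⁺ Ball? (ListMem.∈-allFin v) b

  centreIndex : Fin (length ball)
  centreIndex = Any.index (member (var zero , here))

  restrict′ : ∀ v → Dec (Ball B r ρ v) → Fin (length ball)
  restrict′ v (yes b) = Any.index (member b)
  -- Default value outside the ball, since `BallIso` asks for total maps.
  restrict′ v (no _)  = centreIndex

  restrict : V B → Fin (length ball)
  restrict v = restrict′ v (Ball? v)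

  embed-restrict : ∀ {v} → Ball B r ρ v → embed (restrict v) ≡ v
  embed-restrict {v} b with Ball? v
  ... | yes b′ = sym (Any.lookup-index (member b′))
  ... | no ¬b  = contradiction b ¬b

  restrict-embed : ∀ i → restrict (embed i) ≡ i
  restrict-embed i = embed-injective (embed-restrict (embed-ball i))

  induced : Structure σ 0
  induced .size       = length ball
  induced .size≢0     = Fin.nonZeroIndex centreIndex
  induced .interp S t = interp B S (Vec.map embed t)
  induced .constant ()

  embed-restrict-all : ∀ {t : Vec (V B) l} → VecAll.All (Ball B r ρ) t →
                       Vec.map embed (Vec.map restrict t) ≡ t
  embed-restrict-all []       = refl
  embed-restrict-all (b ∷ bs) = cong₂ _∷_ (embed-restrict b) (embed-restrict-all bs)

  -- Paths of length at most `r` from a centre stay in the ball, so they survive in the induced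
  -- substructure, which therefore has the same ball.
  induced-distance : ∀ {i d u v} → Ball B i ρ u → i + d ≤ r → Distance≤ B d u v →
                     Distance≤ induced d (restrict u) (restrict v)
  induced-distance b le here = here
  induced-distance {i} {suc d} {u} b le (step {v = v} a@(u≢v , S , t , q , u∈ , v∈) δ) =
    step (restrict-≢ , S , Vec.map restrict t
         , subst (T ∘ interp B S) (sym (embed-restrict-all inside)) q
         , VecMem.∈-map⁺ restrict u∈ , VecMem.∈-map⁺ restrict v∈)
      (induced-distance b′ le′ δ)
    where
    b′ = Ball-extend B (ℕ.≤-reflexive (ℕ.+-comm i 1)) b (step a here)
    le′ : suc i + d ≤ r
    le′ = ℕ.≤-trans (ℕ.≤-reflexive (sym (ℕ.+-suc i d))) le
    1+i≤r = ℕ.m+n≤o⇒m≤o (suc i) le′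
    inside : VecAll.All (Ball B r ρ) t
    inside = VecAll.map (Ball-mono B 1+i≤r) (tuple-ball B q u∈ b)
    restrict-≢ : restrict u ≢ restrict v
    restrict-≢ eq = u≢v (trans (sym (embed-restrict (Ball-mono B (ℕ.m+n≤o⇒m≤o i le) b)))
      (trans (cong embed eq) (embed-restrict (Ball-mono B 1+i≤r b′))))

  induced-iso : BallIso r B ρ induced (Vec.map restrict ρ)
  induced-iso = record
    { to        = restrict ; from = embed
    ; to-ball   = λ { (var i , δ) → var i , subst (λ x → Distance≤ induced r x _)
                        (sym (Vec.lookup-map i restrict ρ))
                        (induced-distance {0} (var i , here) ℕ.≤-refl δ)
                    ; (con () , _) }
    ; from-ball = λ {w} _ → embed-ball w
    ; from-to   = embed-restrict ; to-from = λ {w} _ → restrict-embed w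
    ; to-interp = λ S t bs → sym (cong (interp B S) (embed-restrict-all bs))
    ; to-term   = λ { (var i) → sym (Vec.lookup-map i restrict ρ) ; (con ()) }
    }

  ⊩-relativise : ∀ (φ : Formula σ 0 n) (centre : Fin (suc p) → Fin n) (τ : Vec (V induced) n) →
                 (∀ i → embed (lookup τ (centre i)) ≡ lookup ρ i) →
                 (induced ⊨ φ [ τ ]) ⇔ (B ⊩ relativise r centre φ [ Vec.map embed τ ])
  ⊩-relativise (s ≐ t) centre τ h = mk⇔
    (λ eq → trans (eval-embed s) (trans (cong embed eq) (sym (eval-embed t))))
    (λ eq → embed-injective (trans (sym (eval-embed s)) (trans eq (eval-embed t))))
    where
    eval-embed : ∀ t → eval B (Vec.map embed τ) t ≡ embed (eval induced τ t)
    eval-embed (var i) = Vec.lookup-map i embed τ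
    eval-embed (con ())
  ⊩-relativise (rel S ts) centre τ h = ≡-⇔ (cong (T ∘ interp B S)
    (trans (sym (Vec.map-∘ _ _ ts)) (Vec.map-cong eval-embed ts)))
    where
    eval-embed : ∀ t → embed (eval induced τ t) ≡ eval B (Vec.map embed τ) t
    eval-embed (var i) = sym (Vec.lookup-map i embed τ)
    eval-embed (con ())
  ⊩-relativise (¬′ φ)   centre τ h = ¬-⇔ (⊩-relativise φ centre τ h)
  ⊩-relativise (φ ∧′ ψ) centre τ h = ×-⇔ (⊩-relativise φ centre τ h) (⊩-relativise ψ centre τ h)
  ⊩-relativise (∃′ φ)   centre τ h = mk⇔ ⇒ ⇐
    where
    centred : ∀ i → eval B (Vec.map embed τ) (var (centre i)) ≡ lookup ρ i
    centred i = trans (Vec.lookup-map (centre i) embed τ) (h i)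
    ⇒ : induced ⊨ ∃′ φ [ τ ] → B ⊩ relativise r centre (∃′ φ) [ Vec.map embed τ ]
    ⇒ (w , sat) with embed-ball w
    ... | var i , δ = i , from (⊩-within B r (var (centre i)) (relativise r (suc ∘ centre) φ))
      (embed w , subst (λ x → Distance≤ B r x (embed w)) (sym (centred i)) δ
      , to (⊩-relativise φ (suc ∘ centre) (w ∷ τ) h) sat)
    ... | con () , _
    ⇐ : B ⊩ relativise r centre (∃′ φ) [ Vec.map embed τ ] → induced ⊨ ∃′ φ [ τ ]
    ⇐ (i , sat) with to (⊩-within B r (var (centre i)) (relativise r (suc ∘ centre) φ)) sat
    ... | a , δ , sat′ = restrict a , from (⊩-relativise φ (suc ∘ centre) (restrict a ∷ τ) h)
      (subst (λ x → B ⊩ relativise r (suc ∘ centre) φ [ x ∷ Vec.map embed τ ])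
        (sym (embed-restrict (var i , subst (λ x → Distance≤ B r x a) (centred i) δ))) sat′)

-- Without free variables and constants the neighbourhood is empty, so a local sentence has the same
-- truth value in all structures. It can be read off from this one.
trivialStructure : Structure σ 0
trivialStructure .size        = 1
trivialStructure .interp S t  = false
trivialStructure .constant ()

no-ball : ∀ {B : Structure σ 0} {r} {v} → ¬ Ball B r [] v
no-ball (var () , _)
no-ball (con () , _)

trivial-iso : ∀ {B : Structure σ 0} {r} → BallIso r B [] trivialStructure []
trivial-iso {σ} {B} = record
  { to        = λ _ → zero ; from = λ _ → someVertex B
  ; to-ball   = λ b → contradiction b (no-ball {B = B})
  ; from-ball = λ b → contradiction b (no-ball {B = trivialStructure})
  ; from-to   = λ b → contradiction b (no-ball {B = B})
  ; to-from   = λ b → contradiction b (no-ball {B = trivialStructure})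
  -- Arities are positive, so no tuple has all its entries in an empty ball.
  ; to-interp = λ S t bs → contradiction bs (nonempty (arity-nonZero σ S) t)
  ; to-term   = λ { (var ()) ; (con ()) }
  }
  where
  nonempty : ∀ {l r} → NonZero l → (t : Vec (V B) l) → ¬ VecAll.All (Ball B r []) t
  nonempty _ (x ∷ t) (b ∷ _) = no-ball {B = B} b

local⇒guarded : (φ : Formula σ 0 p) → Local φ →
                ∃ λ ψ → ∀ (B : Structure σ 0) ρ → (B ⊨ φ [ ρ ]) ⇔ (B ⊩ ψ [ ρ ])
local⇒guarded {p = zero} φ (r , local) with trivialStructure ⊨? φ [ [] ]
... | yes q = notᵍ (orᵍ 0 λ ()) , λ { B [] →
  mk⇔ (λ _ ()) (λ _ → from (local B [] trivialStructure [] trivial-iso) q) }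
... | no ¬q = orᵍ 0 (λ ()) , λ { B [] →
  mk⇔ (λ q → contradiction (to (local B [] trivialStructure [] trivial-iso) q) ¬q) (λ ()) }
local⇒guarded {p = suc p} φ (r , local) = relativise r id φ , λ B ρ →
  let open InducedBall r B ρ
      inside : ∀ i → embed (restrict (lookup ρ i)) ≡ lookup ρ i
      inside i = embed-restrict (var i , here)
  in ⇔.trans (local B ρ induced _ induced-iso) (⇔.trans
       (⊩-relativise φ id (Vec.map restrict ρ) λ i → trans (cong embed (Vec.lookup-map i restrict ρ)) (inside i))
       (≡-⇔ (cong (λ τ → B ⊩ relativise r id φ [ τ ])
         (embed-restrict-all (VecAll.lookup⁻ λ i → var i , here)))))

-- The gadget construction

T-does : {P : Set} (d : Dec P) → T (does d) ⇔ P
T-does (yes p) = mk⇔ (λ _ → p) (λ _ → tt)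
T-does (no ¬p) = mk⇔ (λ ()) ¬p

module Product {σ : Signature} {k : ℕ} .{{_ : NonZero k}} (A : BaseStructure σ k) (G : Gadget σ k) where

  open GadgetConstruction A G

  X : Structure σ 0
  X = product

  IsEdge : Vec (V A) k → Set
  IsEdge e = T (interp A zero e)

  NonRoot : V H → Set
  NonRoot v = ∀ l → root G l ≢ v

  base : V A → V X
  base = baseClass

  copy′ : (e : Vec (V A) k) → Dec (IsEdge e) → V H → V X
  copy′ e (yes p) v = copyClass (e , p) v
  copy′ e (no _)  v = base (someVertex A)

  -- Junk value when e is not an edge.
  copy : Vec (V A) k → V H → V X
  copy e = copy′ e (T? _)

  copy-edge : ∀ {e v} (p : IsEdge e) → copy e v ≡ copyClass (e , p) v
  copy-edge {e} {v} p with T? (interp A zero e)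
  ... | yes q = cong (λ p → copyClass (e , p) v) (T-irrelevant q p)
  ... | no ¬p = contradiction p ¬p

  normal-nonRoot : ∀ {e v} → NonRoot v → normal (inj₂ (e , v)) ≡ inj₂ (e , v)
  normal-nonRoot {e} {v} nr with Fin.any? (λ l → root G l Fin.≟ v)
  ... | yes (l , eq) = contradiction eq (nr l)
  ... | no _         = refl

  normal-class : ∀ {x y} → [ x ]∼ ≡ [ y ]∼ → normal x ≡ normal y
  normal-class eq = normal-≡ (to []∼-kernel eq)

  base-injective : ∀ {a b} → base a ≡ base b → a ≡ b
  base-injective eq with refl ← normal-class eq = refl

  copy-root : ∀ {e} → IsEdge e → ∀ l → copy e (root G l) ≡ base (lookup e l)
  copy-root {e} p l = trans (copy-edge p) (sym (from []∼-kernel (EqClosure.return (glue (e , p) l))))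

  copy-base : ∀ {e v a} → IsEdge e → copy e v ≡ base a → ∃ λ l → root G l ≡ v × lookup e l ≡ a
  copy-base {e} {v} p eq with Fin.any? (λ l → root G l Fin.≟ v) | normal-class (trans (sym (copy-edge {e} {v} p)) eq)
  ... | yes (l , r) | refl = l , r , refl
  ... | no _        | ()

  -- It suffices that `v` is not a root: the normal form of a root is a base vertex, so `v′` cannot
  -- be a root either. For two roots the claim fails, since edges may share vertices.
  copy-injective : ∀ {e e′ v v′} → IsEdge e → IsEdge e′ → NonRoot v → copy e v ≡ copy e′ v′ → e ≡ e′ × v ≡ v′
  copy-injective {e} {e′} {v} {v′} p p′ nr eq
    with Fin.any? (λ l → root G l Fin.≟ v′)
       | trans (sym (normal-nonRoot {e , p} nr)) (normal-class (trans (sym (copy-edge p)) (trans eq (copy-edge p′))))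
  ... | yes _ | ()
  ... | no _  | refl = refl , refl

  isRoot? : ∀ v → Dec (∃ λ l → root G l ≡ v)
  isRoot? v = Fin.any? λ l → root G l Fin.≟ v

  -- The normal forms of vertices, with roots counted as base vertices. By `base-injective`,
  -- `copy-base` and `copy-injective` each vertex has only one.
  data PointView : V X → Set where
    isBase : ∀ a → PointView (base a)
    isCopy : ∀ {e v} → IsEdge e → NonRoot v → PointView (copy e v)

  pointView : ∀ x → PointView x
  pointView x = subst PointView ([]∼-surjective x) (view (representative x))
    where
    view : ∀ y → PointView [ y ]∼
    view (inj₁ a) = isBase a
    view (inj₂ ((e , p) , v)) with isRoot? v
    ... | yes (l , refl) = subst PointView (trans (sym (copy-root p l)) (copy-edge p)) (isBase (lookup e l))
    ... | no ¬r          = subst PointView (copy-edge p) (isCopy p (λ l r → ¬r (l , r)))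

  RelatedX : ∀ S → Vec (V X) (arity σ S) → Set
  RelatedX S x =
      (∃ λ t → T (interp A (suc S) t) × Vec.map base t ≡ x)
    ⊎ (∃ λ e → IsEdge e × ∃ λ u → T (interp H S u) × Vec.map (copy e) u ≡ x)

  ∈-relationTuples : ∀ {σ c} (A : Structure σ c) S {t} → (t ∈ relationTuples A S) ⇔ T (interp A S t)
  ∈-relationTuples A S = mk⇔
    (proj₂ ∘ ListMem.∈-filter⁻ (λ t → T? (interp A S t)) {xs = tuples (size A) _})
    (ListMem.∈-filter⁺ (λ t → T? (interp A S t)) (∈-tuples _))

  interpX : ∀ S {x} → T (interp X S x) ⇔ RelatedX S x
  interpX S {x} = ⇔.trans (T-does (DecMembership._∈?_ (Vec.≡-dec Fin._≟_) x (productTuples S))) (mk⇔ ⇒ ⇐)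
    where
    ⇒ : x ∈ productTuples S → RelatedX S x
    ⇒ x∈ with ListMem.∈-++⁻ (List.map (Vec.map baseClass) (relationTuples A (suc S))) x∈
    ... | inj₁ x∈ˡ = let (t , t∈ , eq) = ListMem.∈-map⁻ _ x∈ˡ
                     in inj₁ (t , to (∈-relationTuples A (suc S)) t∈ , sym eq)
    ... | inj₂ x∈ʳ = let ((e , p) , u , _ , u∈ , eq) =
                           ListMem.∈-cartesianProductWith⁻ _ edges (relationTuples H S) x∈ʳ
                     in inj₂ (e , p , u , to (∈-relationTuples H S) u∈
                             , trans (Vec.map-cong (λ v → copy-edge p) u) (sym eq))
    ⇐ : RelatedX S x → x ∈ productTuples S
    ⇐ (inj₁ (t , q , refl)) = ListMem.∈-++⁺ˡ (ListMem.∈-map⁺ _ (from (∈-relationTuples A (suc S)) q))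
    ⇐ (inj₂ (e , p , u , q , refl)) = ListMem.∈-++⁺ʳ (List.map (Vec.map baseClass) (relationTuples A (suc S)))
      (subst (_∈ cartesianProductWith (λ e → Vec.map (copyClass e)) edges (relationTuples H S)) (Vec.map-cong (λ v → sym (copy-edge p)) u)
        (ListMem.∈-cartesianProductWith⁺ _ (∈-edges (e , p)) (from (∈-relationTuples H S) q)))

  linkedX : ∀ S {x y} → Linked X S x y ⇔
    ((∃ λ a → ∃ λ b → base a ≡ x × Linked A (suc S) a b × base b ≡ y)
     ⊎ (∃ λ e → IsEdge e × ∃ λ u → ∃ λ v → copy e u ≡ x × Linked H S u v × copy e v ≡ y))
  linkedX S {x} {y} = mk⇔ ⇒ ⇐
    where
    ⇒ : Linked X S x y → _
    ⇒ (t , q , (i , i≡) , (j , j≡)) with to (interpX S) q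
    ... | inj₁ (t , q , refl) = inj₁
      (lookup t i , lookup t j , trans (sym (Vec.lookup-map i base t)) i≡
      , (t , q , (i , refl) , (j , refl)) , trans (sym (Vec.lookup-map j base t)) j≡)
    ... | inj₂ (e , p , u , q , refl) = inj₂
      (e , p , lookup u i , lookup u j , trans (sym (Vec.lookup-map i (copy e) u)) i≡
      , (u , q , (i , refl) , (j , refl)) , trans (sym (Vec.lookup-map j (copy e) u)) j≡)
    ⇐ : _ → Linked X S x y
    ⇐ (inj₁ (_ , _ , refl , (t , q , (i , refl) , (j , refl)) , refl)) =
      _ , from (interpX S) (inj₁ (t , q , refl)) , (i , Vec.lookup-map i base t) , (j , Vec.lookup-map j base t)
    ⇐ (inj₂ (e , p , _ , _ , refl , (u , q , (i , refl) , (j , refl)) , refl)) =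
      _ , from (interpX S) (inj₂ (e , p , u , q , refl)) , (i , Vec.lookup-map i (copy e) u) , (j , Vec.lookup-map j (copy e) u)

-- Derived guarded formulas

⊤ᵍ : Guarded σ c n
⊤ᵍ = notᵍ (orᵍ 0 λ ())

allᵍ : ∀ m → (Fin m → Guarded σ c n) → Guarded σ c n
allᵍ m φ = notᵍ (orᵍ m λ i → notᵍ (φ i))

linkedᵍ : Fin (symbols σ) → Term c n → Term c n → Guarded σ c n
linkedᵍ S t u = exᵍ S t (eqᵍ (var zero) (weakenTerm u))

-- Introduces a whole tuple at once, every entry guarded by the same `t`. An `R`-edge through a
-- named vertex can be quantified in this way, because all its entries are linked to that vertex.
exBlockᵍ : ∀ l → Fin (symbols σ) → Term c n → Guarded σ c (l + n) → Guarded σ c n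
exBlockᵍ zero    S t φ = φ
exBlockᵍ (suc l) S t φ = exBlockᵍ l S t (exᵍ S (shiftTerm l t) φ)

module _ (A : Structure σ c) where

  ⊩-⊤ : ∀ {ρ : Vec (V A) n} → A ⊩ ⊤ᵍ [ ρ ]
  ⊩-⊤ ()

  ⊩-all : ∀ m (φ : Fin m → Guarded σ c n) {ρ} → (A ⊩ allᵍ m φ [ ρ ]) ⇔ (∀ i → A ⊩ φ i [ ρ ])
  ⊩-all m φ {ρ} = mk⇔
    (λ none i → decidable-stable (A ⊩? φ i [ ρ ]) λ ¬q → none (i , ¬q))
    (λ { q (i , ¬q) → ¬q (q i) })

  ⊩-linked : ∀ S (t u : Term c n) {ρ} →
             (A ⊩ linkedᵍ S t u [ ρ ]) ⇔ Linked A S (eval A ρ t) (eval A ρ u)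
  ⊩-linked S t u {ρ} = mk⇔
    (λ (a , link , eq) → subst (Linked A S _) (trans eq (eval-weaken A u)) link)
    (λ link → _ , link , sym (eval-weaken A u))

  ⊩-exBlock : ∀ l S t (φ : Guarded σ c (l + n)) {ρ} → (A ⊩ exBlockᵍ l S t φ [ ρ ]) ⇔
              (∃ λ xs → (∀ i → Linked A S (eval A ρ t) (lookup xs i)) × A ⊩ φ [ xs Vec.++ ρ ])
  ⊩-exBlock zero    S t φ = mk⇔ (λ sat → [] , (λ ()) , sat) (λ { ([] , _ , sat) → sat })
  ⊩-exBlock (suc l) S t φ {ρ} = ⇔.trans (⊩-exBlock l S t _) (mk⇔
    (λ (xs , links , x , link , sat) →
      x ∷ xs , (λ { zero → subst (λ u → Linked A S u x) (eval-shift A xs t) link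
                  ; (suc i) → links i }) , sat)
    (λ { (x ∷ xs , links , sat) →
      xs , links ∘ suc , x , subst (λ u → Linked A S u x) (sym (eval-shift A xs t)) (links zero) , sat }))

-- Feferman–Vaught decomposition of guarded formulas over A * G

-- An element of A * G is named either by a variable for a base vertex, or by a
-- slot j and a variable for a vertex of the gadget copy on the j-th edge.  The
-- edges of different slots are distinct, so each slot has a gadget formula of
-- its own; only the variables belonging to the slot matter in it.
Kind : ℕ → ℕ → ℕ → Set
Kind N m M = Fin N ⊎ (Fin m × Fin M)

mapKind : ∀ {N N′ m m′ M M′} → (Fin N → Fin N′) → (Fin m → Fin m′) → (Fin M → Fin M′) →
          Kind N m M → Kind N′ m′ M′
mapKind f g h (inj₁ a)       = inj₁ (f a)
mapKind f g h (inj₂ (j , x)) = inj₂ (g j , h x)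

infixr 5 _◂_

_◂_ : ∀ {X : Set} {m} → X → (Fin m → X) → Fin (suc m) → X
(x ◂ f) zero    = x
(x ◂ f) (suc i) = f i

varIndex : Term 0 n → Fin n
varIndex (var i) = i

headOf : ∀ {X : Set} {l} → NonZero l → Vec X l → X
headOf _ (x ∷ _) = x

module Decomposition (σ : Signature) (k : ℕ) .{{_ : NonZero k}} where

  private variable
    N m′ M : ℕ

  -- The default gadget vertex, assigned to slot variables whose value does not matter.
  firstRoot : Fin k
  firstRoot = Fin.fromℕ< (ℕ.>-nonZero⁻¹ k)

  Edges : ℕ → ℕ → Set
  Edges N m = Fin m → Vec (Fin N) k

  -- The conjunction of a base formula, a gadget formula for every slot, and a gadget sentence.
  Rect : ℕ → ℕ → ℕ → Set
  Rect N m M = Guarded (σ ∪R k) 0 N × (Fin m → Guarded σ k M) × Guarded σ k 0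

  -- Disjunctions of rectangles.
  Rects : ℕ → ℕ → ℕ → Set
  Rects N m M = List (Rect N m M)

  at : {i j : Fin m} → Dec (i ≡ j) → {X : Set} → X → X → X
  at (yes _) x y = x
  at (no _)  x y = y

  trueʳ : Rect N m M
  trueʳ = ⊤ᵍ , (λ _ → ⊤ᵍ) , ⊤ᵍ

  baseʳ : Guarded (σ ∪R k) 0 N → Rect N m M
  baseʳ α = α , (λ _ → ⊤ᵍ) , ⊤ᵍ

  slotʳ : Fin m → Guarded σ k M → Rect N m M
  slotʳ j β = ⊤ᵍ , (λ j′ → at (j Fin.≟ j′) β ⊤ᵍ) , ⊤ᵍ

  sentenceʳ : Guarded σ k 0 → Rect N m M
  sentenceʳ γ = ⊤ᵍ , (λ _ → ⊤ᵍ) , γ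

  andʳ : Rect N m M → Rect N m M → Rect N m M
  andʳ (α , β , γ) (α′ , β′ , γ′) = andᵍ α α′ , (λ j → andᵍ (β j) (β′ j)) , andᵍ γ γ′

  andR : Rects N m M → Rects N m M → Rects N m M
  andR = cartesianProductWith andʳ

  orR : ∀ l → (Fin l → Rects N m M) → Rects N m M
  orR zero    L = []
  orR (suc l) L = L zero ++ orR l (L ∘ suc)

  notʳ : Rect N m M → Rects N m M
  notʳ {m = m} (α , β , γ) =
    baseʳ (notᵍ α) ∷ sentenceʳ (notᵍ γ) ∷ orR m λ j → slotʳ j (notᵍ (β j)) ∷ []

  notR : Rects N m M → Rects N m M
  notR []      = trueʳ ∷ []
  notR (r ∷ L) = andR (notʳ r) (notR L)

  -- Existential quantifiers distribute over the disjunction of rectangles. Inside a rectangle only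
  -- the component that sees the new element needs the quantifier.
  exBaseʳ : Fin (symbols (σ ∪R k)) → Fin N → Rect (suc N) m M → Rect N m M
  exBaseʳ S a (α , β , γ) = exᵍ S (var a) α , β , γ

  forget : Fin (suc M) → Term k M
  forget zero    = con firstRoot
  forget (suc i) = var i

  -- All slots share the number of variables, so the other slots receive the new variable as well.
  -- In them it is set to the first root.
  exSlotʳ : Fin m → Fin (symbols σ) → Term k M → Rect N m (suc M) → Rect N m M
  exSlotʳ j S t (α , β , γ) = α , (λ j′ → at (j Fin.≟ j′) (exᵍ S t (β j′)) (substᵍ forget (β j′))) , γ

  newEdge : ∀ N → Vec (Fin (k + N)) k
  newEdge N = tabulate (_↑ˡ N)

  edgeᵍ : ∀ N → Guarded (σ ∪R k) 0 (k + N)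
  edgeᵍ N = relᵍ zero (Vec.map var (newEdge N))

  freshᵍ : Edges N m → Guarded (σ ∪R k) 0 (k + N)
  freshᵍ {N} {m} ev = allᵍ m λ j → notᵍ (allᵍ k λ l → eqᵍ (var (l ↑ˡ N)) (var (k ↑ʳ lookup (ev j) l)))

  -- The guards of the block merely put each entry in some `R`-tuple together with `a`. That the
  -- entries form one edge, a new one, and one through `a`, has to be added.
  newEdgeᵍ : Edges N m → Fin N → Guarded (σ ∪R k) 0 (k + N) → Guarded (σ ∪R k) 0 (k + N)
  newEdgeᵍ {N} ev a α =
    andᵍ (edgeᵍ N) (andᵍ (freshᵍ ev) (andᵍ (orᵍ k λ l → eqᵍ (var (l ↑ˡ N)) (var (k ↑ʳ a))) α))

  -- No vertex of the new copy is named outside the quantifier, so its slot formula turns into a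
  -- condition on `G` alone and joins the gadget sentence.
  exEdgeʳ : Edges N m → Fin N → Rect (k + N) (suc m) M → Rect N m M
  exEdgeʳ ev a (α , β , γ) =
    exBlockᵍ k zero (var a) (newEdgeᵍ ev a α) , β ∘ suc , andᵍ γ (substᵍ (λ _ → con firstRoot) (β zero))

  liftBase : Kind N m M → Kind (suc N) m M
  liftBase = mapKind suc id id

  liftSlot : Kind N m M → Kind N m (suc M)
  liftSlot = mapKind id id suc

  liftEdge : Kind N m M → Kind (k + N) (suc m) M
  liftEdge = mapKind (k ↑ʳ_) suc id

  addEdge : Edges N m → Edges (k + N) (suc m)
  addEdge ev = newEdge _ ◂ (Vec.map (k ↑ʳ_) ∘ ev)

  -- Polymorphic in the context, because below a quantifier the same subformula is translated
  -- several times, with its new element named as a base vertex, in a copy with a slot, or in a new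
  -- copy.
  Translation : ℕ → Set
  Translation n = ∀ {N m M} → Edges N m → Vec (Kind N m M) n → Rects N m M

  -- A nonroot vertex lies in a single copy, which already has a slot. Only base vertices can lead
  -- into a new one.
  newSlotR : Edges N m → Kind N m M → Rects (k + N) (suc m) M → Rects N m M
  newSlotR ev (inj₁ a) L = List.map (exEdgeʳ ev a) L
  newSlotR ev (inj₂ _) L = []

  Body : ℕ → Set
  Body n = ∀ {N m M} → Edges N m → Vec (Kind N m M) n → Fin m → Rects N m M

  someSlotR : Body n → Fin n → Translation n
  someSlotR body i {m = m} ev τ =
    orR m (body ev τ) ++ newSlotR ev (lookup τ i) (body (addEdge ev) (Vec.map liftEdge τ) zero)

  -- Continue with a term for the vertex, in the copy at slot j, of the element named by κ.
  locate : Edges N m → Fin m → Kind N m M → (Term k M → Rects N m M) → Rects N m M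
  locate ev j (inj₁ a)        K = orR k λ l →
    andR (baseʳ (eqᵍ (var (lookup (ev j) l)) (var a)) ∷ []) (K (con l))
  locate ev j (inj₂ (j′ , x)) K = at (j Fin.≟ j′) (K (var x)) []

  locateAll : ∀ {l} → Edges N m → Fin m → Vec (Kind N m M) l → (Vec (Term k M) l → Rects N m M) → Rects N m M
  locateAll ev j []       K = K []
  locateAll ev j (κ ∷ κs) K = locate ev j κ λ t → locateAll ev j κs (K ∘ (t ∷_))

  allBase : ∀ {l} → Vec (Kind N m M) l → (Vec (Fin N) l → Rects N m M) → Rects N m M
  allBase []            K = K []
  allBase (inj₁ a ∷ κs) K = allBase κs (K ∘ (a ∷_))
  allBase (inj₂ _ ∷ κs) K = []

  equalR : Kind N m M → Kind N m M → Rects N m M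
  equalR (inj₁ a)       (inj₁ b)        = baseʳ (eqᵍ (var a) (var b)) ∷ []
  equalR (inj₁ a)       (inj₂ _)        = []
  equalR (inj₂ _)       (inj₁ b)        = []
  equalR (inj₂ (j , x)) (inj₂ (j′ , y)) = at (j Fin.≟ j′) (slotʳ j (eqᵍ (var x) (var y)) ∷ []) []

  relBody : (S : Fin (symbols σ)) → Vec (Term 0 n) (arity σ S) → Body n
  relBody S ts ev τ j = locateAll ev j (Vec.map (lookup τ ∘ varIndex) ts) λ us → slotʳ j (relᵍ S us) ∷ []

  nonRootᵍ : Guarded σ k (suc M)
  nonRootᵍ = notᵍ (orᵍ k λ l → eqᵍ (con l) (var zero))

  -- Slot variables stand for nonroot vertices only. A witness that is a root is passed on under the
  -- name of the base vertex to which it is glued.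
  exInSlotR : Fin (symbols σ) → Translation (suc n) → Edges N m → Vec (Kind N m M) n → Fin m → Term k M → Rects N m M
  exInSlotR S K ev τ j t =
    List.map (exSlotʳ j S t)
      (andR (slotʳ j nonRootᵍ ∷ []) (K ev (inj₂ (j , zero) ∷ Vec.map liftSlot τ)))
    ++ orR k λ l → andR (slotʳ j (linkedᵍ S t (con l)) ∷ []) (K ev (inj₁ (lookup (ev j) l) ∷ τ))

  exBody : Fin (symbols σ) → Fin n → Translation (suc n) → Body n
  exBody S i K ev τ j = locate ev j (lookup τ i) (exInSlotR S K ev τ j)

  exBaseR : Fin (symbols σ) → Kind N m M → Translation (suc n) → Edges N m → Vec (Kind N m M) n → Rects N m M
  exBaseR S (inj₁ a) K ev τ =
    List.map (exBaseʳ (suc S) a) (K (Vec.map suc ∘ ev) (inj₁ zero ∷ Vec.map liftBase τ))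
  exBaseR S (inj₂ _) K ev τ = []

  decompose : Guarded σ 0 n → Translation n
  decompose (eqᵍ s t)   ev τ = equalR (lookup τ (varIndex s)) (lookup τ (varIndex t))
  decompose (relᵍ S ts) ev τ =
    allBase (Vec.map (lookup τ ∘ varIndex) ts) (λ as → baseʳ (relᵍ (suc S) (Vec.map var as)) ∷ [])
    -- The first entry serves as the guard for reaching a new copy; it exists because arities are
    -- positive.
    ++ someSlotR (relBody S ts) (varIndex (headOf (arity-nonZero σ S) ts)) ev τ
  decompose (notᵍ φ)    ev τ = notR (decompose φ ev τ)
  decompose (andᵍ φ ψ)  ev τ = andR (decompose φ ev τ) (decompose ψ ev τ)
  decompose (orᵍ m φ)   ev τ = orR m λ i → decompose (φ i) ev τ
  decompose (exᵍ S t φ) ev τ =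
    exBaseR S (lookup τ (varIndex t)) (decompose φ) ev τ
    ++ someSlotR (exBody S (varIndex t) (decompose φ)) (varIndex t) ev τ

  -- Correctness of the decomposition

  module Correctness (A : BaseStructure σ k) (G : Gadget σ k) where

    open Product A G hiding (X)
    X : Structure σ 0
    X = A ⊛ G
    H : Structure σ k
    H = structure G

    Slots : ℕ → ℕ → Set
    Slots m M = Fin m → Vec (V H) M

    infix 4 ⟦_⟧ʳ ⟦_⟧

    ⟦_⟧ʳ : Rect N m M → Vec (V A) N → Slots m M → Set
    ⟦ α , β , γ ⟧ʳ ρ w = A ⊩ α [ ρ ] × (∀ j → H ⊩ β j [ w j ]) × H ⊩ γ [ [] ]

    ⟦_⟧ : Rects N m M → Vec (V A) N → Slots m M → Set
    ⟦ L ⟧ ρ w = Any (λ r → ⟦ r ⟧ʳ ρ w) L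

    ⟦_⟧ʳ? : ∀ (r : Rect N m M) ρ w → Dec (⟦ r ⟧ʳ ρ w)
    ⟦ α , β , γ ⟧ʳ? ρ w = A ⊩? α [ ρ ] ×-dec Fin.all? (λ j → H ⊩? β j [ w j ]) ×-dec H ⊩? γ [ [] ]

    ⟦_⟧? : ∀ (L : Rects N m M) ρ w → Dec (⟦ L ⟧ ρ w)
    ⟦ L ⟧? ρ w = Any.any? (λ r → ⟦ r ⟧ʳ? ρ w) L

    module _ {N m M} {ρ : Vec (V A) N} {w : Slots m M} where

      single : ∀ {r : Rect N m M} {P : Set} → ⟦ r ⟧ʳ ρ w ⇔ P → ⟦ r ∷ [] ⟧ ρ w ⇔ P
      single e = mk⇔ (λ { (here q) → to e q }) (here ∘ from e)

      ⟦base⟧ : ∀ α → ⟦ baseʳ α ⟧ʳ ρ w ⇔ (A ⊩ α [ ρ ])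
      ⟦base⟧ α = mk⇔ proj₁ (λ q → q , (λ _ → ⊩-⊤ H) , ⊩-⊤ H)

      ⟦sentence⟧ : ∀ γ → ⟦ sentenceʳ γ ⟧ʳ ρ w ⇔ (H ⊩ γ [ [] ])
      ⟦sentence⟧ γ = mk⇔ (proj₂ ∘ proj₂) (λ q → ⊩-⊤ A , (λ _ → ⊩-⊤ H) , q)

      ⟦slot⟧ : ∀ j β → ⟦ slotʳ j β ⟧ʳ ρ w ⇔ (H ⊩ β [ w j ])
      ⟦slot⟧ j β = mk⇔ (λ (_ , q , _) → ⇒ (j Fin.≟ j) (q j)) (λ q → ⊩-⊤ A , (λ j′ → ⇐ (j Fin.≟ j′) q) , ⊩-⊤ H)
        where
        ⇒ : (d : Dec (j ≡ j)) → H ⊩ at d β ⊤ᵍ [ w j ] → H ⊩ β [ w j ]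
        ⇒ (yes _)  q = q
        ⇒ (no j≢j) q = contradiction refl j≢j
        ⇐ : ∀ {j′} (d : Dec (j ≡ j′)) → H ⊩ β [ w j ] → H ⊩ at d β ⊤ᵍ [ w j′ ]
        ⇐ (yes refl) q = q
        ⇐ (no _)     q = ⊩-⊤ H

      ⟦and⟧ʳ : ∀ r r′ → ⟦ andʳ r r′ ⟧ʳ ρ w ⇔ (⟦ r ⟧ʳ ρ w × ⟦ r′ ⟧ʳ ρ w)
      ⟦and⟧ʳ r r′ = mk⇔
        (λ ((a , a′) , b , (c , c′)) → (a , proj₁ ∘ b , c) , (a′ , proj₂ ∘ b , c′))
        (λ ((a , b , c) , (a′ , b′ , c′)) → (a , a′) , (λ j → b j , b′ j) , (c , c′))

      ⟦and⟧ : ∀ L L′ → ⟦ andR L L′ ⟧ ρ w ⇔ (⟦ L ⟧ ρ w × ⟦ L′ ⟧ ρ w)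
      ⟦and⟧ L L′ = mk⇔
        (Any.cartesianProductWith⁻ andʳ (λ {r} {r′} → to (⟦and⟧ʳ r r′)) L L′)
        (λ (q , q′) → Any.cartesianProductWith⁺ andʳ (λ {r} {r′} a b → from (⟦and⟧ʳ r r′) (a , b)) q q′)

      ⟦++⟧ : ∀ L {L′ : Rects N m M} → ⟦ L ++ L′ ⟧ ρ w ⇔ (⟦ L ⟧ ρ w ⊎ ⟦ L′ ⟧ ρ w)
      ⟦++⟧ L = mk⇔ (Any.++⁻ L) [ Any.++⁺ˡ , Any.++⁺ʳ L ]′

      ⟦or⟧ : ∀ l L → ⟦ orR l L ⟧ ρ w ⇔ (∃ λ i → ⟦ L i ⟧ ρ w)
      ⟦or⟧ zero    L = mk⇔ (λ ()) (λ ())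
      ⟦or⟧ (suc l) L = ⇔.trans (⟦++⟧ (L zero)) (mk⇔
        [ (zero ,_) , (λ q → let (i , q′) = to (⟦or⟧ l (L ∘ suc)) q in suc i , q′) ]′
        (λ { (zero , q) → inj₁ q ; (suc i , q) → inj₂ (from (⟦or⟧ l (L ∘ suc)) (i , q)) }))

      ⟦not⟧ʳ : ∀ r → ⟦ notʳ r ⟧ ρ w ⇔ (¬ ⟦ r ⟧ʳ ρ w)
      ⟦not⟧ʳ r@(α , β , γ) = mk⇔ ⇒ ⇐
        where
        slots = ⟦or⟧ m (λ j → slotʳ j (notᵍ (β j)) ∷ [])
        ⇒ : ⟦ notʳ r ⟧ ρ w → ¬ ⟦ r ⟧ʳ ρ w
        ⇒ (here q)          (a , b , c) = to (⟦base⟧ (notᵍ α)) q a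
        ⇒ (there (here q))  (a , b , c) = to (⟦sentence⟧ (notᵍ γ)) q c
        ⇒ (there (there q)) (a , b , c) = let (j , q′) = to slots q in to (single (⟦slot⟧ j (notᵍ (β j)))) q′ (b j)
        ⇐ : ¬ ⟦ r ⟧ʳ ρ w → ⟦ notʳ r ⟧ ρ w
        ⇐ none with A ⊩? α [ ρ ] | H ⊩? γ [ [] ] | Fin.all? (λ j → H ⊩? β j [ w j ])
        ... | no ¬a | _     | _     = here (from (⟦base⟧ (notᵍ α)) ¬a)
        ... | yes _ | no ¬c | _     = there (here (from (⟦sentence⟧ (notᵍ γ)) ¬c))
        ... | yes a | yes c | yes b = contradiction (a , b , c) none
        ... | yes a | yes c | no ¬b =
          let (j , ¬q) = Fin.¬∀⟶∃¬ m _ (λ j → H ⊩? β j [ w j ]) ¬b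
          in there (there (from slots (j , from (single (⟦slot⟧ j (notᵍ (β j)))) ¬q)))

      ⟦not⟧ : ∀ L → ⟦ notR L ⟧ ρ w ⇔ (¬ ⟦ L ⟧ ρ w)
      ⟦not⟧ []      = mk⇔ (λ _ ()) (λ _ → here (⊩-⊤ A , (λ _ → ⊩-⊤ H) , ⊩-⊤ H))
      ⟦not⟧ (r ∷ L) = ⇔.trans (⟦and⟧ (notʳ r) (notR L)) (⇔.trans (×-⇔ (⟦not⟧ʳ r) (⟦not⟧ L))
        (mk⇔ (λ { (¬q , _) (here q) → ¬q q ; (_ , ¬q) (there q) → ¬q q }) (λ ¬q → ¬q ∘ here , ¬q ∘ there)))

      -- Lifts a quantifier step from rectangles to their disjunctions: `Y` is the type of
      -- witnesses, `C` the guard, and `ρ′`, `w′` extend the assignment by the witness.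
      ⟦map⟧ : ∀ {N′ m′ M′} {Y : Set} {C : Y → Set} {ρ′ : Y → Vec (V A) N′} {w′ : Y → Slots m′ M′}
              (f : Rect N′ m′ M′ → Rect N m M) →
              (∀ r → ⟦ f r ⟧ʳ ρ w ⇔ (∃ λ y → C y × ⟦ r ⟧ʳ (ρ′ y) (w′ y))) →
              ∀ L → ⟦ List.map f L ⟧ ρ w ⇔ (∃ λ y → C y × ⟦ L ⟧ (ρ′ y) (w′ y))
      ⟦map⟧ f h []      = mk⇔ (λ ()) (λ { (_ , _ , ()) })
      ⟦map⟧ f h (r ∷ L) = mk⇔
        (λ { (here q)  → let (y , c , q′) = to (h r) q in y , c , here q′
           ; (there q) → let (y , c , q′) = to (⟦map⟧ f h L) q in y , c , there q′ })
        (λ { (y , c , here q)  → here (from (h r) (y , c , q))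
           ; (y , c , there q) → there (from (⟦map⟧ f h L) (y , c , q)) })

    edge : Vec (V A) N → Vec (Fin N) k → Vec (V A) k
    edge ρ = Vec.map (lookup ρ)

    point : Vec (V A) N → Slots m M → Edges N m → Kind N m M → V X
    point ρ w ev (inj₁ a)       = base (lookup ρ a)
    point ρ w ev (inj₂ (j , x)) = copy (edge ρ (ev j)) (lookup (w j) x)

    -- Roots must be named as base vertices. Together with distinct slot edges this makes a base
    -- name and a slot name, or names in two slots, denote different vertices.
    Proper : Slots m M → Kind N m M → Set
    Proper w (inj₁ a)       = ⊤
    Proper w (inj₂ (j , x)) = NonRoot (lookup (w j) x)

    proper-map : ∀ {N m M N′ m′ M′} {w : Slots m M} {w′ : Slots m′ M′}
                 (f : Fin N → Fin N′) (g : Fin m → Fin m′) (h : Fin M → Fin M′) →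
                 (∀ j x → lookup (w′ (g j)) (h x) ≡ lookup (w j) x) →
                 ∀ κ → Proper w κ → Proper w′ (mapKind f g h κ)
    proper-map f g h hw (inj₁ a)       _ = tt
    proper-map f g h hw (inj₂ (j , x)) p = subst NonRoot (sym (hw j x)) p

    record Valid (ρ : Vec (V A) N) (ev : Edges N m) : Set where
      field
        isEdge   : ∀ j → IsEdge (edge ρ (ev j))
        distinct : ∀ {i j} → edge ρ (ev i) ≡ edge ρ (ev j) → i ≡ j
    open Valid

    record Names (ev : Edges N m) (ρ : Vec (V A) N) (w : Slots m M)
                 (τ : Vec (Kind N m M) n) (q : Vec (V X) n) : Set where
      field
        valid  : Valid ρ ev
        proper : VecAll.All (Proper w) τ
        names  : Vec.map (point ρ w ev) τ ≡ q

      name : ∀ i → point ρ w ev (lookup τ i) ≡ lookup q i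
      name i = trans (sym (Vec.lookup-map i _ τ)) (cong (λ q → lookup q i) names)
    open Names

    module _ {N m M N′ m′ M′} {ρ : Vec (V A) N} {ρ′ : Vec (V A) N′} {w : Slots m M} {w′ : Slots m′ M′}
             {ev : Edges N m} {ev′ : Edges N′ m′} (f : Fin N → Fin N′) (g : Fin m → Fin m′) (h : Fin M → Fin M′)
             (hρ : ∀ a → lookup ρ′ (f a) ≡ lookup ρ a)
             (hev : ∀ j → edge ρ′ (ev′ (g j)) ≡ edge ρ (ev j))
             (hw : ∀ j x → lookup (w′ (g j)) (h x) ≡ lookup (w j) x) where

      point-map : ∀ κ → point ρ′ w′ ev′ (mapKind f g h κ) ≡ point ρ w ev κ
      point-map (inj₁ a)       = cong base (hρ a)
      point-map (inj₂ (j , x)) = cong₂ copy (hev j) (hw j x)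

      Names-map : ∀ {τ : Vec _ n} {q} → Valid ρ′ ev′ → Names ev ρ w τ q →
                  Names ev′ ρ′ w′ (Vec.map (mapKind f g h) τ) q
      Names-map {τ = τ} v′ η = record
        { valid  = v′
        ; proper = VecAll.map⁺ (VecAll.map (λ {κ} → proper-map f g h hw κ) (proper η))
        ; names  = trans (sym (Vec.map-∘ _ _ τ)) (trans (Vec.map-cong point-map τ) (names η))
        }

    Names-cons : ∀ {ρ : Vec (V A) N} {w : Slots m M} {ev} {τ : Vec _ n} {q} κ →
                 Proper w κ → Names ev ρ w τ q → Names ev ρ w (κ ∷ τ) (point ρ w ev κ ∷ q)
    Names-cons κ p η = record { valid = valid η ; proper = p ∷ proper η ; names = cong (_ ∷_) (names η) }

    lookup-ext : ∀ {Y : Set} {l} (xs ys : Vec Y l) → (∀ i → lookup xs i ≡ lookup ys i) → xs ≡ ys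
    lookup-ext xs ys h =
      trans (sym (Vec.tabulate∘lookup xs)) (trans (Vec.tabulate-cong h) (Vec.tabulate∘lookup ys))

    edge-new : ∀ e {ρ : Vec (V A) N} → edge (e Vec.++ ρ) (newEdge N) ≡ e
    edge-new e {ρ} = trans (sym (Vec.tabulate-∘ _ _))
      (trans (Vec.tabulate-cong (Vec.lookup-++ˡ e ρ)) (Vec.tabulate∘lookup e))

    edge-old : ∀ e {ρ : Vec (V A) N} is → edge (e Vec.++ ρ) (Vec.map (k ↑ʳ_) is) ≡ edge ρ is
    edge-old e {ρ} is = trans (sym (Vec.map-∘ _ _ is)) (Vec.map-cong (Vec.lookup-++ʳ e ρ) is)

    edge-liftBase : ∀ {a} {ρ : Vec (V A) N} is → edge (a ∷ ρ) (Vec.map suc is) ≡ edge ρ is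
    edge-liftBase is = sym (Vec.map-∘ _ _ is)

    Fresh : Vec (V A) k → Vec (V A) N → Edges N m → Set
    Fresh e ρ ev = ∀ j → e ≢ edge ρ (ev j)

    module _ {N} {ρ : Vec (V A) N} where

      ⊩-edge : ∀ e → (A ⊩ edgeᵍ N [ e Vec.++ ρ ]) ⇔ IsEdge e
      ⊩-edge e = ≡-⇔ (cong IsEdge (trans (sym (Vec.map-∘ _ _ (newEdge N))) (edge-new e)))

      ⊩-fresh : ∀ (ev : Edges N m) e → (A ⊩ freshᵍ ev [ e Vec.++ ρ ]) ⇔ Fresh e ρ ev
      ⊩-fresh {m} ev e = ⇔.trans (⊩-all A m (λ j → notᵍ (allᵍ k (agree j))) {e Vec.++ ρ}) (mk⇔
        (λ h j eq → h j (from (⊩-all A k (agree j) {e Vec.++ ρ}) (from (equal⇔ j) eq)))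
        (λ h j sat → h j (to (equal⇔ j) (to (⊩-all A k (agree j) {e Vec.++ ρ}) sat))))
        where
        agree : Fin m → Fin k → Guarded (σ ∪R k) 0 (k ℕ.+ N)
        agree j l = eqᵍ (var (l ↑ˡ N)) (var (k ↑ʳ lookup (ev j) l))
        lookup-new : ∀ l → lookup (e Vec.++ ρ) (l ↑ˡ N) ≡ lookup e l
        lookup-new = Vec.lookup-++ˡ e ρ
        lookup-old : ∀ i → lookup (e Vec.++ ρ) (k ↑ʳ i) ≡ lookup ρ i
        lookup-old = Vec.lookup-++ʳ e ρ
        equal⇔ : ∀ j → (∀ l → lookup (e Vec.++ ρ) (l ↑ˡ N) ≡ lookup (e Vec.++ ρ) (k ↑ʳ lookup (ev j) l)) ⇔
                       (e ≡ edge ρ (ev j))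
        equal⇔ j = mk⇔
          (λ h → lookup-ext e _ λ l → trans (sym (lookup-new l)) (trans (h l)
            (trans (lookup-old _) (sym (Vec.lookup-map l (lookup ρ) (ev j))))))
          (λ h l → trans (lookup-new l) (trans (cong (λ x → lookup x l) h)
            (trans (Vec.lookup-map l (lookup ρ) (ev j)) (sym (lookup-old _)))))

    Valid-addEdge : ∀ {e} {ρ : Vec (V A) N} {ev : Edges N m} → Valid ρ ev → IsEdge e → Fresh e ρ ev →
                    Valid (e Vec.++ ρ) (addEdge ev)
    Valid-addEdge {e = e} {ρ} {ev} v p fresh = record { isEdge = edges′ ; distinct = distinct′ _ _ }
      where
      edges′ : ∀ j → IsEdge (edge (e Vec.++ ρ) (addEdge ev j))
      edges′ zero    = subst IsEdge (sym (edge-new e)) p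
      edges′ (suc j) = subst IsEdge (sym (edge-old e (ev j))) (isEdge v j)
      distinct′ : ∀ i j → edge (e Vec.++ ρ) (addEdge ev i) ≡ edge (e Vec.++ ρ) (addEdge ev j) → i ≡ j
      distinct′ zero    zero    _  = refl
      distinct′ zero    (suc j) eq = contradiction (trans (sym (edge-new e)) (trans eq (edge-old e (ev j)))) (fresh j)
      distinct′ (suc i) zero    eq = contradiction (trans (sym (edge-new e)) (trans (sym eq) (edge-old e (ev i)))) (fresh i)
      distinct′ (suc i) (suc j) eq = cong suc (distinct v (trans (sym (edge-old e (ev i))) (trans eq (edge-old e (ev j)))))

    Valid-liftBase : ∀ {a} {ρ : Vec (V A) N} {ev : Edges N m} → Valid ρ ev → Valid (a ∷ ρ) (Vec.map suc ∘ ev)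
    Valid-liftBase {ev = ev} v = record
      { isEdge   = λ j → subst IsEdge (sym (edge-liftBase (ev j))) (isEdge v j)
      ; distinct = λ {i} {j} eq → distinct v (trans (sym (edge-liftBase (ev i))) (trans eq (edge-liftBase (ev j)))) }

    extendSlots : Fin m → V H → Slots m M → Slots m (suc M)
    extendSlots j v w j′ = at (j Fin.≟ j′) v (constant H firstRoot) ∷ w j′

    at-refl : ∀ (j : Fin m) {Y : Set} {x y : Y} → at (j Fin.≟ j) x y ≡ x
    at-refl j with j Fin.≟ j
    ... | yes _  = refl
    ... | no j≢j = contradiction refl j≢j

    newSlots : Slots m M → Slots (suc m) M
    newSlots w = Vec.replicate _ (constant H firstRoot) ◂ w

    module _ {N m M} {ρ : Vec (V A) N} {w : Slots m M} where

      ⟦exSlot⟧ʳ : ∀ j S t r → ⟦ exSlotʳ j S t r ⟧ʳ ρ w ⇔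
                  (∃ λ v → Linked H S (eval H (w j) t) v × ⟦ r ⟧ʳ ρ (extendSlots j v w))
      ⟦exSlot⟧ʳ j S t (α , β , γ) = mk⇔ ⇒ ⇐
        where
        f : Fin m → Guarded σ k M
        f j′ = at (j Fin.≟ j′) (exᵍ S t (β j′)) (substᵍ forget (β j′))
        forgotten : ∀ j′ → (H ⊩ substᵍ forget (β j′) [ w j′ ]) ⇔ (H ⊩ β j′ [ constant H firstRoot ∷ w j′ ])
        forgotten j′ = ⊩-subst H (λ { zero → refl ; (suc i) → refl }) (β j′)
        other : ∀ {v} j′ (d : Dec (j ≡ j′)) → (∀ {_ : j ≡ j′} → H ⊩ β j [ v ∷ w j ]) →
                H ⊩ at d (exᵍ S t (β j′)) (substᵍ forget (β j′)) [ w j′ ] →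
                H ⊩ β j′ [ at d v (constant H firstRoot) ∷ w j′ ]
        other j′ (yes refl) b q = b {refl}
        other j′ (no _)     b q = to (forgotten j′) q
        back : ∀ {v} j′ (d : Dec (j ≡ j′)) → Linked H S (eval H (w j) t) v →
               H ⊩ β j′ [ at d v (constant H firstRoot) ∷ w j′ ] →
               H ⊩ at d (exᵍ S t (β j′)) (substᵍ forget (β j′)) [ w j′ ]
        back j′ (yes refl) link q = _ , link , q
        back j′ (no _)     link q = from (forgotten j′) q
        ⇒ : _ → _
        ⇒ (a , b , c) with subst (λ φ → H ⊩ φ [ w j ]) (at-refl j) (b j)
        ... | v , link , q = v , link , a , (λ j′ → other j′ (j Fin.≟ j′) q (b j′)) , c
        ⇐ : _ → _
        ⇐ (v , link , a , b , c) = a , (λ j′ → back j′ (j Fin.≟ j′) link (b j′)) , c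

      ⟦exBase⟧ʳ : ∀ S a r → ⟦ exBaseʳ S a r ⟧ʳ ρ w ⇔ (∃ λ b → Linked A S (lookup ρ a) b × ⟦ r ⟧ʳ (b ∷ ρ) w)
      ⟦exBase⟧ʳ S a r = mk⇔ (λ ((b , link , α) , rest) → b , link , α , rest)
                            (λ (b , link , α , rest) → (b , link , α) , rest)

      NewEdge : Edges N m → Fin N → Vec (V A) k → Set
      NewEdge ev a e = IsEdge e × Fresh e ρ ev × (∃ λ l → lookup e l ≡ lookup ρ a)

      ⊩-newEdge : ∀ ev a α e → (A ⊩ newEdgeᵍ ev a α [ e Vec.++ ρ ]) ⇔ (NewEdge ev a e × A ⊩ α [ e Vec.++ ρ ])
      ⊩-newEdge ev a α e = ⇔.trans
        (×-⇔ (⊩-edge e) (×-⇔ (⊩-fresh ev e) (×-⇔ touches⇔ ⇔.refl)))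
        (mk⇔ (λ (p , q , r , s) → (p , q , r) , s) (λ ((p , q , r) , s) → p , q , r , s))
        where
        touches⇔ = ∃-⇔ λ l → ≡-⇔ (cong₂ _≡_ (Vec.lookup-++ˡ e ρ l) (Vec.lookup-++ʳ e ρ a))

      ⟦exEdge⟧ʳ : ∀ ev a (r : Rect (k ℕ.+ N) (suc m) M) → ⟦ exEdgeʳ ev a r ⟧ʳ ρ w ⇔
                  (∃ λ e → NewEdge ev a e × ⟦ r ⟧ʳ (e Vec.++ ρ) (newSlots w))
      ⟦exEdge⟧ʳ ev a (α , β , γ) = mk⇔
        (λ (sat , b , c , b₀) →
          let (e , _ , sat′) = to block sat
              (new , a′) = to (⊩-newEdge ev a α e) sat′
          in e , new , a′ , (λ { zero → to sentence b₀ ; (suc j) → b j }) , c)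
        (λ (e , new@(p , _ , l , l≡) , a′ , b , c) →
          from block (e , (λ i → e , p , (l , l≡) , (i , refl)) , from (⊩-newEdge ev a α e) (new , a′))
          , b ∘ suc , c , from sentence (b zero))
        where
        block = ⊩-exBlock A k zero (var a) (newEdgeᵍ ev a α) {ρ}
        sentence : (H ⊩ substᵍ (λ _ → con firstRoot) (β zero) [ [] ]) ⇔
                   (H ⊩ β zero [ Vec.replicate _ (constant H firstRoot) ])
        sentence = ⊩-subst H (λ i → sym (Vec.lookup-replicate i _)) (β zero)

      module _ {ev : Edges N m} (v : Valid ρ ev) where

        -- A copy meets the base in its roots only, but several roots may be glued to the same base
        -- vertex when an edge repeats vertices; hence an existential over `u`. A nonroot name
        -- determines both the slot and the vertex.
        locate-correct : ∀ j κ → Proper w κ → ∀ {K : Term k M → Rects N m M} {P : V H → Set} →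
          (∀ t → ⟦ K t ⟧ ρ w ⇔ P (eval H (w j) t)) →
          ⟦ locate ev j κ K ⟧ ρ w ⇔ (∃ λ u → copy (edge ρ (ev j)) u ≡ point ρ w ev κ × P u)
        locate-correct j (inj₁ a) _ {K} {P} hK = ⇔.trans (⟦or⟧ k _) (⇔.trans
          (∃-⇔ λ l → ⇔.trans (⟦and⟧ _ (K (con l))) (×-⇔ (single {ρ = ρ} {w} (⟦base⟧ {ρ = ρ} {w} (eqᵍ (var (lookup (ev j) l)) (var a)))) (hK (con l))))
          (mk⇔
            (λ (l , eq , q) → root G l
              , trans (copy-root (isEdge v j) l) (cong base (trans (Vec.lookup-map l _ (ev j)) eq)) , q)
            (λ (u , eq , q) → let (l , r , l≡) = copy-base (isEdge v j) eq
              in l , trans (sym (Vec.lookup-map l _ (ev j))) l≡ , subst P (sym r) q)))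
        locate-correct j (inj₂ (j′ , x)) nr {K} {P} hK with j Fin.≟ j′
        ... | yes refl = ⇔.trans (hK (var x)) (mk⇔
          (λ q → _ , refl , q)
          (λ (u , eq , q) → subst P (sym (proj₂ (copy-injective (isEdge v j) (isEdge v j) nr (sym eq)))) q))
        ... | no j≢j′  = mk⇔ (λ ()) (λ (u , eq , q) → contradiction
          (distinct v (sym (proj₁ (copy-injective (isEdge v j′) (isEdge v j) nr (sym eq))))) j≢j′)

        locateAll-correct : ∀ {l} j (κs : Vec (Kind N m M) l) → VecAll.All (Proper w) κs →
          ∀ {K : Vec (Term k M) l → Rects N m M} {P : Vec (V H) l → Set} →
          (∀ ts → ⟦ K ts ⟧ ρ w ⇔ P (Vec.map (eval H (w j)) ts)) →
          ⟦ locateAll ev j κs K ⟧ ρ w ⇔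
          (∃ λ us → Vec.map (copy (edge ρ (ev j))) us ≡ Vec.map (point ρ w ev) κs × P us)
        locateAll-correct j [] [] hK = ⇔.trans (hK []) (mk⇔ (λ q → [] , refl , q) (λ { ([] , _ , q) → q }))
        locateAll-correct j (κ ∷ κs) (p ∷ ps) {P = P} hK = ⇔.trans
          (locate-correct j κ p {P = λ u → ∃ λ us → Vec.map _ us ≡ Vec.map (point ρ w ev) κs × P (u ∷ us)}
            (λ t → locateAll-correct j κs ps (λ ts → hK (t ∷ ts))))
          (mk⇔ (λ (u , eq , us , eqs , q) → u ∷ us , cong₂ _∷_ eq eqs , q)
               (λ { (u ∷ us , eq , q) → u , Vec.∷-injectiveˡ eq , us , Vec.∷-injectiveʳ eq , q }))

        allBase-correct : ∀ {l} (κs : Vec (Kind N m M) l) → VecAll.All (Proper w) κs →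
          ∀ {K : Vec (Fin N) l → Rects N m M} {P : Vec (V A) l → Set} →
          (∀ as → ⟦ K as ⟧ ρ w ⇔ P (Vec.map (lookup ρ) as)) →
          ⟦ allBase κs K ⟧ ρ w ⇔ (∃ λ t → Vec.map base t ≡ Vec.map (point ρ w ev) κs × P t)
        allBase-correct [] [] hK = ⇔.trans (hK []) (mk⇔ (λ q → [] , refl , q) (λ { ([] , _ , q) → q }))
        allBase-correct (inj₁ a ∷ κs) (_ ∷ ps) {P = P} hK = ⇔.trans
          (allBase-correct κs ps {P = λ t → P (lookup ρ a ∷ t)} (λ as → hK (a ∷ as)))
          (mk⇔ (λ (t , eq , q) → lookup ρ a ∷ t , cong (_ ∷_) eq , q)
               (λ { (b ∷ t , eq , q) → t , Vec.∷-injectiveʳ eq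
                                     , subst (λ a → P (a ∷ t)) (base-injective (Vec.∷-injectiveˡ eq)) q }))
        allBase-correct (inj₂ (j , x) ∷ κs) (nr ∷ _) hK = mk⇔ (λ ())
          (λ { (b ∷ t , eq , q) →
            let (l , r , _) = copy-base (isEdge v j) (sym (Vec.∷-injectiveˡ eq)) in contradiction r (nr l) })

        equal-correct : ∀ κ κ′ → Proper w κ → Proper w κ′ →
                        ⟦ equalR κ κ′ ⟧ ρ w ⇔ (point ρ w ev κ ≡ point ρ w ev κ′)
        equal-correct (inj₁ a) (inj₁ b) _ _ = ⇔.trans (single {ρ = ρ} {w} (⟦base⟧ {ρ = ρ} {w} (eqᵍ (var a) (var b)))) (mk⇔ (cong base) base-injective)
        equal-correct (inj₁ a) (inj₂ (j , x)) _ nr = mk⇔ (λ ())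
          (λ eq → let (l , r , _) = copy-base (isEdge v j) (sym eq) in contradiction r (nr l))
        equal-correct (inj₂ (j , x)) (inj₁ b) nr _ = mk⇔ (λ ())
          (λ eq → let (l , r , _) = copy-base (isEdge v j) eq in contradiction r (nr l))
        equal-correct (inj₂ (j , x)) (inj₂ (j′ , y)) nr _ with j Fin.≟ j′
        ... | yes refl = ⇔.trans (single {ρ = ρ} {w} (⟦slot⟧ {ρ = ρ} {w} j (eqᵍ (var x) (var y))))
          (mk⇔ (cong (copy _)) (λ eq → proj₂ (copy-injective (isEdge v j) (isEdge v j) nr eq)))
        ... | no j≢j′ = mk⇔ (λ ())
          (λ eq → contradiction (distinct v (proj₁ (copy-injective (isEdge v j) (isEdge v j′) nr eq))) j≢j′)

    _Decomposes_ : Translation n → (Vec (V X) n → Set) → Set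
    K Decomposes P = ∀ {N m M} {ev : Edges N m} {ρ} {w : Slots m M} {τ q} →
                     Names ev ρ w τ q → ⟦ K ev τ ⟧ ρ w ⇔ P q

    Names-addEdge : ∀ {ev : Edges N m} {ρ} {w : Slots m M} {τ} {q : Vec (V X) n} {e} →
                    Names ev ρ w τ q → IsEdge e → Fresh e ρ ev →
                    Names (addEdge ev) (e Vec.++ ρ) (newSlots w) (Vec.map liftEdge τ) q
    Names-addEdge {ev = ev} {ρ} {e = e} η p fresh = Names-map (k ↑ʳ_) suc id
      (Vec.lookup-++ʳ e ρ) (λ j → edge-old e (ev j)) (λ _ _ → refl) (Valid-addEdge (valid η) p fresh) η

    Names-addBase : ∀ {ev : Edges N m} {ρ} {w : Slots m M} {τ} {q : Vec (V X) n} {a} →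
                    Names ev ρ w τ q →
                    Names (Vec.map suc ∘ ev) (a ∷ ρ) w (inj₁ zero ∷ Vec.map liftBase τ) (base a ∷ q)
    Names-addBase {ev = ev} η = Names-cons (inj₁ zero) tt (Names-map suc id id
      (λ _ → refl) (λ j → edge-liftBase (ev j)) (λ _ _ → refl) (Valid-liftBase (valid η)) η)

    Names-addSlot : ∀ {ev : Edges N m} {ρ} {w : Slots m M} {τ} {q : Vec (V X) n} j {v} →
                    NonRoot v → Names ev ρ w τ q →
                    Names ev ρ (extendSlots j v w) (inj₂ (j , zero) ∷ Vec.map liftSlot τ)
                          (copy (edge ρ (ev j)) v ∷ q)
    Names-addSlot {ev = ev} {ρ} {w} {q = q} j {v} nr η =
      subst (λ u → Names ev ρ (extendSlots j v w) _ (copy (edge ρ (ev j)) u ∷ q)) (at-refl j)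
        (Names-cons (inj₂ (j , zero)) (subst NonRoot (sym (at-refl j)) nr)
          (Names-map id id suc (λ _ → refl) (λ _ → refl) (λ _ _ → refl) (valid η) η))

    module _ {N m M} {ev : Edges N m} {ρ : Vec (V A) N} {w : Slots m M} {τ : Vec (Kind N m M) n}
             {q : Vec (V X) n} (η : Names ev ρ w τ q) where

      -- Guardedness enters through `touch`: the copy on an edge with property `P` contains the
      -- element named at `i`. If that edge has no slot, the element must be a base vertex on it,
      -- which is the guard that `exEdgeʳ` needs.
      someSlot-correct : ∀ (body : Body n) i {P : Vec (V A) k → Set} →
        (∀ {N m M} {ev : Edges N m} {ρ} {w : Slots m M} {τ} → Names ev ρ w τ q →
          ∀ j → ⟦ body ev τ j ⟧ ρ w ⇔ P (edge ρ (ev j))) →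
        (∀ {e} → P e → ∃ λ u → copy e u ≡ lookup q i) →
        ⟦ someSlotR body i ev τ ⟧ ρ w ⇔ (∃ λ e → IsEdge e × P e)
      someSlot-correct body i {P} hbody touch = ⇔.trans (⟦++⟧ (orR m (body ev τ))) (mk⇔
        [ (λ s → let (j , s′) = to (⟦or⟧ m (body ev τ)) s in _ , isEdge (valid η) j , to (hbody η j) s′)
        , ⇒new (lookup τ i) ]′
        ⇐)
        where
        newBody = body (addEdge ev) (Vec.map liftEdge τ) zero
        newBody-correct : ∀ {e} → IsEdge e → Fresh e ρ ev → ⟦ newBody ⟧ (e Vec.++ ρ) (newSlots w) ⇔ P e
        newBody-correct {e} p fresh =
          ⇔.trans (hbody (Names-addEdge η p fresh) zero) (≡-⇔ (cong P (edge-new e)))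
        ⇒new : ∀ κ → ⟦ newSlotR ev κ newBody ⟧ ρ w → ∃ λ e → IsEdge e × P e
        ⇒new (inj₁ a) s with to (⟦map⟧ (exEdgeʳ ev a) (⟦exEdge⟧ʳ ev a) newBody) s
        ... | e , (p , fresh , _) , s′ = e , p , to (newBody-correct p fresh) s′
        ⇒new (inj₂ _) ()
        ⇐new : ∀ κ → point ρ w ev κ ≡ lookup q i → Proper w κ →
               ∀ {e} → IsEdge e → Fresh e ρ ev → P e → ⟦ newSlotR ev κ newBody ⟧ ρ w
        ⇐new (inj₁ a) eq _ {e} p fresh pe with touch pe
        ... | u , u≡ with copy-base p (trans u≡ (sym eq))
        ... | l , _ , l≡ = from (⟦map⟧ (exEdgeʳ ev a) (⟦exEdge⟧ʳ ev a) newBody)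
          (e , (p , fresh , l , l≡) , from (newBody-correct p fresh) pe)
        ⇐new (inj₂ (j , x)) eq nr p fresh pe with touch pe
        ... | u , u≡ = contradiction
          (sym (proj₁ (copy-injective (isEdge (valid η) j) p nr (trans eq (sym u≡))))) (fresh j)
        ⇐ : (∃ λ e → IsEdge e × P e) →
            ⟦ orR m (body ev τ) ⟧ ρ w ⊎ ⟦ newSlotR ev (lookup τ i) newBody ⟧ ρ w
        ⇐ (e , p , pe) with Fin.any? (λ j → Vec.≡-dec Fin._≟_ e (edge ρ (ev j)))
        ... | yes (j , refl) = inj₁ (from (⟦or⟧ m (body ev τ)) (j , from (hbody η j) pe))
        ... | no none = inj₂ (⇐new (lookup τ i) (name η i) (VecAll.lookup⁺ (proper η) i)
                                p (λ j eq → none (j , eq)) pe)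

    lookups : ∀ {ev : Edges N m} {ρ} {w : Slots m M} {τ} {q : Vec (V X) n} → Names ev ρ w τ q →
              ∀ {l} (ts : Vec (Term 0 n) l) →
              Vec.map (point ρ w ev) (Vec.map (lookup τ ∘ varIndex) ts) ≡ Vec.map (eval X q) ts
    lookups η ts = trans (sym (Vec.map-∘ _ _ ts)) (Vec.map-cong (λ { (var i) → name η i }) ts)

    proper-lookups : ∀ {ev : Edges N m} {ρ} {w : Slots m M} {τ} {q : Vec (V X) n} → Names ev ρ w τ q →
              ∀ {l} (ts : Vec (Term 0 n) l) → VecAll.All (Proper w) (Vec.map (lookup τ ∘ varIndex) ts)
    proper-lookups η ts = VecAll.map⁺ (VecAll.universal (λ t → VecAll.lookup⁺ (proper η) (varIndex t)) ts)

    eval-var : ∀ {q : Vec (V X) n} t → eval X q t ≡ lookup q (varIndex t)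
    eval-var (var i) = refl

    ⊩-nonRoot : ∀ {v} {w : Vec (V H) M} → (H ⊩ nonRootᵍ [ v ∷ w ]) ⇔ NonRoot v
    ⊩-nonRoot = mk⇔ (λ none l r → none (l , r)) (λ { nr (l , r) → nr l r })

    module _ {N m M} {ev : Edges N m} {ρ : Vec (V A) N} {w : Slots m M} {τ : Vec (Kind N m M) n}
             {q : Vec (V X) n} (η : Names ev ρ w τ q) where

      exInSlot-correct : ∀ S {K : Translation (suc n)} {P} → K Decomposes P → ∀ j t →
        ⟦ exInSlotR S K ev τ j t ⟧ ρ w ⇔
        (∃ λ v → Linked H S (eval H (w j) t) v × P (copy (edge ρ (ev j)) v ∷ q))
      exInSlot-correct S {K} {P} hK j t = ⇔.trans (⟦++⟧ (List.map (exSlotʳ j S t) inner)) (mk⇔ [ ⇒₁ , ⇒₂ ]′ ⇐)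
        where
        K₁ = K ev (inj₂ (j , zero) ∷ Vec.map liftSlot τ)
        K₂ : Fin k → Rects N m M
        K₂ l = K ev (inj₁ (lookup (ev j) l) ∷ τ)
        inner = andR (slotʳ j nonRootᵍ ∷ []) K₁
        R₂ : Fin k → Rects N m M
        R₂ l = andR (slotʳ j (linkedᵍ S t (con l)) ∷ []) (K₂ l)
        Goal = ∃ λ v → Linked H S (eval H (w j) t) v × P (copy (edge ρ (ev j)) v ∷ q)
        e = isEdge (valid η) j
        nonRoot⇔ : ∀ v → ⟦ slotʳ j nonRootᵍ ∷ [] ⟧ ρ (extendSlots j v w) ⇔ NonRoot v
        nonRoot⇔ v = ⇔.trans (single {ρ = ρ} {extendSlots j v w} (⟦slot⟧ {ρ = ρ} {extendSlots j v w} j nonRootᵍ))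
          (⇔.trans (⊩-nonRoot {w = w j}) (≡-⇔ (cong NonRoot (at-refl j))))
        map⇔ = ⟦map⟧ {ρ = ρ} {w} (exSlotʳ j S t) (⟦exSlot⟧ʳ j S t) inner
        link⇔ : ∀ l → ⟦ slotʳ j (linkedᵍ S t (con l)) ∷ [] ⟧ ρ w ⇔ Linked H S (eval H (w j) t) (root G l)
        link⇔ l = ⇔.trans (single {ρ = ρ} {w} (⟦slot⟧ {ρ = ρ} {w} j (linkedᵍ S t (con l)))) (⊩-linked H S t (con l))
        K₂⇔ : ∀ l → ⟦ K₂ l ⟧ ρ w ⇔ P (copy (edge ρ (ev j)) (root G l) ∷ q)
        K₂⇔ l = ⇔.trans (hK (Names-cons (inj₁ (lookup (ev j) l)) tt η))
          (≡-⇔ (cong (λ x → P (x ∷ q)) (sym (trans (copy-root e l) (cong base (Vec.lookup-map l (lookup ρ) (ev j)))))))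
        ⇒₁ : ⟦ List.map (exSlotʳ j S t) inner ⟧ ρ w → Goal
        ⇒₁ s with to map⇔ s
        ... | v , link , s′ with to (⟦and⟧ (slotʳ j nonRootᵍ ∷ []) K₁) s′
        ... | nr , s″ = v , link , to (hK (Names-addSlot j (to (nonRoot⇔ v) nr) η)) s″
        ⇒₂ : ⟦ orR k R₂ ⟧ ρ w → Goal
        ⇒₂ s with to (⟦or⟧ k R₂) s
        ... | l , s′ with to (⟦and⟧ (slotʳ j (linkedᵍ S t (con l)) ∷ []) (K₂ l)) s′
        ... | link , s″ = root G l , to (link⇔ l) link , to (K₂⇔ l) s″
        ⇐ : Goal → ⟦ List.map (exSlotʳ j S t) inner ⟧ ρ w ⊎ ⟦ orR k R₂ ⟧ ρ w
        ⇐ (v , link , pv) with isRoot? v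
        ... | yes (l , refl) = inj₂ (from (⟦or⟧ k R₂) (l ,
                from (⟦and⟧ (slotʳ j (linkedᵍ S t (con l)) ∷ []) (K₂ l)) (from (link⇔ l) link , from (K₂⇔ l) pv)))
        ... | no ¬r = inj₁ (from map⇔ (v , link ,
                from (⟦and⟧ (slotʳ j nonRootᵍ ∷ []) K₁) (from (nonRoot⇔ v) nr , from (hK (Names-addSlot j nr η)) pv)))
          where
          nr : NonRoot v
          nr l r = ¬r (l , r)

      exBase-correct : ∀ S κ {K : Translation (suc n)} {P} → K Decomposes P → Proper w κ →
        ⟦ exBaseR S κ K ev τ ⟧ ρ w ⇔
        (∃ λ a → ∃ λ b → base a ≡ point ρ w ev κ × Linked A (suc S) a b × P (base b ∷ q))
      exBase-correct S (inj₁ a) {K} {P} hK _ =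
        ⇔.trans (⟦map⟧ {ρ = ρ} {w} (exBaseʳ (suc S) a) (⟦exBase⟧ʳ (suc S) a) (K _ _)) (mk⇔
          (λ (b , link , s) → lookup ρ a , b , refl , link , to (hK (Names-addBase η)) s)
          (λ (a′ , b , eq , link , pb) →
            b , subst (λ a → Linked A (suc S) a b) (base-injective eq) link , from (hK (Names-addBase η)) pb))
      exBase-correct S (inj₂ (j , x)) hK nr = mk⇔ (λ ())
        (λ (a , b , eq , _) → let (l , r , _) = copy-base (isEdge (valid η) j) (sym eq) in contradiction r (nr l))

    decompose-correct : (φ : Guarded σ 0 n) → decompose φ Decomposes λ q → X ⊩ φ [ q ]
    decompose-correct (eqᵍ s t) {ev = ev} {ρ} {w} {τ} {q} η = ⇔.trans
      (equal-correct (valid η) _ _ (VecAll.lookup⁺ (proper η) (varIndex s)) (VecAll.lookup⁺ (proper η) (varIndex t)))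
      (≡-⇔ (cong₂ _≡_ (trans (name η _) (sym (eval-var s))) (trans (name η _) (sym (eval-var t)))))
    decompose-correct (relᵍ S ts) {ev = ev} {ρ} {w} {τ} {q} η = ⇔.trans (⟦++⟧ (allBase (Vec.map (lookup τ ∘ varIndex) ts) baseRel)) (⇔.trans
      (⊎-⇔
        (allBase-correct (valid η) _ (proper-lookups η ts) {baseRel} {λ t → T (interp A (suc S) t)} λ as →
          ⇔.trans (single {ρ = ρ} {w} (⟦base⟧ {ρ = ρ} {w} (relᵍ (suc S) (Vec.map var as))))
            (≡-⇔ (cong (T ∘ interp A (suc S)) (sym (Vec.map-∘ _ var as)))))
        (someSlot-correct η (relBody S ts) (varIndex (headOf (arity-nonZero σ S) ts)) {P}
          (λ {_} {_} {_} {ev} {ρ} {w} η j → ⇔.trans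
            (locateAll-correct (valid η) j _ (proper-lookups η ts) {P = λ us → T (interp H S us)} λ us →
              single {ρ = ρ} {w} (⟦slot⟧ {ρ = ρ} {w} j (relᵍ S us)))
            (∃-⇔ λ us → ×-⇔ (≡-⇔ (cong (Vec.map (copy _) us ≡_) (lookups η ts))) ⇔.refl))
          λ (us , eq , _) → touch (arity-nonZero σ S) ts us eq))
      (⇔.trans
        (mk⇔ [ (λ (t , eq , p) → inj₁ (t , p , trans eq (lookups η ts)))
             , (λ (e , p , us , eq , r) → inj₂ (e , p , us , r , eq)) ]′
             [ (λ (t , p , eq) → inj₁ (t , trans eq (sym (lookups η ts)) , p))
             , (λ (e , p , us , r , eq) → inj₂ (e , p , us , eq , r)) ]′)
        (⇔.sym (interpX S))))
      where
      baseRel : Vec (Fin _) (arity σ S) → Rects _ _ _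
      baseRel as = baseʳ (relᵍ (suc S) (Vec.map var as)) ∷ []
      P : Vec (V A) k → Set
      P e = ∃ λ us → Vec.map (copy e) us ≡ Vec.map (eval X q) ts × T (interp H S us)
      touch : ∀ {l} (l≢0 : NonZero l) (ts : Vec (Term 0 _) l) us {e} →
              Vec.map (copy e) us ≡ Vec.map (eval X q) ts → ∃ λ u → copy e u ≡ lookup q (varIndex (headOf l≢0 ts))
      touch _ (t ∷ ts) (u ∷ us) eq = u , trans (Vec.∷-injectiveˡ eq) (eval-var t)
    decompose-correct (notᵍ φ)   η = ⇔.trans (⟦not⟧ (decompose φ _ _)) (¬-⇔ (decompose-correct φ η))
    decompose-correct (andᵍ φ ψ) η = ⇔.trans (⟦and⟧ (decompose φ _ _) (decompose ψ _ _))
      (×-⇔ (decompose-correct φ η) (decompose-correct ψ η))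
    decompose-correct (orᵍ m φ)  η = ⇔.trans (⟦or⟧ m _) (∃-⇔ λ i → decompose-correct (φ i) η)
    decompose-correct (exᵍ S t φ) {ev = ev} {ρ} {w} {τ} {q} η =
      ⇔.trans (⟦++⟧ (exBaseR S (lookup τ i) (decompose φ) ev τ)) (⇔.trans
        (⊎-⇔ (exBase-correct η S (lookup τ i) {decompose φ} (decompose-correct φ) (VecAll.lookup⁺ (proper η) i))
             (someSlot-correct η (exBody S i (decompose φ)) i {P}
               (λ η′ j → ⇔.trans
                 (locate-correct (valid η′) j _ (VecAll.lookup⁺ (proper η′) i)
                   (exInSlot-correct η′ S {decompose φ} (decompose-correct φ) j))
                 (∃-⇔ λ u → ×-⇔ (≡-⇔ (cong (copy _ u ≡_) (name η′ i))) ⇔.refl))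
               (λ (u , eq , _) → u , eq)))
        (mk⇔ ⇒ ⇐))
      where
      i = varIndex t
      P : Vec (V A) k → Set
      P e = ∃ λ u → copy e u ≡ lookup q i × ∃ λ v → Linked H S u v × X ⊩ φ [ copy e v ∷ q ]
      named : ∀ {x} → x ≡ lookup q i → x ≡ eval X q t
      named eq = trans eq (sym (eval-var t))
      ⇒ : _ → X ⊩ exᵍ S t φ [ q ]
      ⇒ (inj₁ (a , b , eq , link , s)) = base b , from (linkedX S) (inj₁ (a , b , named (trans eq (name η i)) , link , refl)) , s
      ⇒ (inj₂ (e , p , u , eq , v , link , s)) =
        copy e v , from (linkedX S) (inj₂ (e , p , u , v , named eq , link , refl)) , s
      ⇐ : X ⊩ exᵍ S t φ [ q ] → _
      ⇐ (y , link , s) with to (linkedX S) link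
      ... | inj₁ (a , b , eq , link , refl) = inj₁ (a , b , trans eq (trans (eval-var t) (sym (name η i))) , link , s)
      ... | inj₂ (e , p , u , v , eq , link , refl) = inj₂ (e , p , u , trans eq (eval-var t) , v , link , s)

-- Averages of rational-valued functions

-- Fractions are split into `nat c * recip d` once and for all. Later identities are then polynomial
-- identities in opaque atoms, which the ring solver proves, combined with `nat*recip`.
abstract

  nat : ℕ → ℚ
  nat n = + n ℚ./ 1

  recip : ∀ n .{{_ : NonZero n}} → ℚ
  recip n = + 1 ℚ./ n

  toℚᵘ-/ : ∀ i d → ℚ.toℚᵘ (i ℚ./ suc d) ℚᵘ.≃ ℚᵘ.mkℚᵘ i d
  toℚᵘ-/ i d = ℚ.toℚᵘ-fromℚᵘ (ℚᵘ.mkℚᵘ i d)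

  /-*-/ : ∀ c c′ d d′ .{{_ : NonZero d}} .{{_ : NonZero d′}} .{{_ : NonZero (d ℕ.* d′)}} →
          (+ c ℚ./ d) * (+ c′ ℚ./ d′) ≡ + (c ℕ.* c′) ℚ./ (d ℕ.* d′)
  /-*-/ c c′ (suc d) (suc d′) = ℚ.toℚᵘ-injective (ℚᵘ.≃-trans (ℚ.toℚᵘ-homo-* (+ c ℚ./ suc d) (+ c′ ℚ./ suc d′))
    (ℚᵘ.≃-trans (ℚᵘ.*-cong (toℚᵘ-/ (+ c) d) (toℚᵘ-/ (+ c′) d′))
    (ℚᵘ.≃-trans (ℚᵘ.*≡* (cong (ℤ._* + (suc d ℕ.* suc d′)) (sym (ℤ.pos-* c c′)))) (ℚᵘ.≃-sym (toℚᵘ-/ (+ (c ℕ.* c′)) _)))))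

  /≡nat*recip : ∀ c d .{{_ : NonZero d}} → + c ℚ./ d ≡ nat c * recip d
  /≡nat*recip c (suc d) = sym (trans (/-*-/ c 1 1 (suc d))
    (ℚ./-cong (cong +_ (ℕ.*-identityʳ c)) (ℕ.*-identityˡ (suc d))))

  nat*recip : ∀ n .{{_ : NonZero n}} → nat n * recip n ≡ 1ℚ
  nat*recip (suc n) = trans (sym (/≡nat*recip (suc n) (suc n)))
    (ℚ.toℚᵘ-injective (ℚᵘ.≃-trans (toℚᵘ-/ (+ suc n) n) (ℚᵘ.*≡* (ℤ.*-comm (+ suc n) (+ 1)))))

  nat-+ : ∀ m n → nat (m + n) ≡ nat m ℚ.+ nat n
  nat-+ m n = ℚ.toℚᵘ-injective (ℚᵘ.≃-trans (toℚᵘ-/ (+ (m + n)) 0) (ℚᵘ.≃-trans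
    (ℚᵘ.*≡* (cong (ℤ._* + 1) (trans (ℤ.pos-+ m n)
      (sym (cong₂ ℤ._+_ (ℤ.*-identityʳ (+ m)) (ℤ.*-identityʳ (+ n)))))))
    (ℚᵘ.≃-sym (ℚᵘ.≃-trans (ℚ.toℚᵘ-homo-+ (nat m) (nat n)) (ℚᵘ.+-cong (toℚᵘ-/ (+ m) 0) (toℚᵘ-/ (+ n) 0))))))

  recip-* : ∀ m n .{{_ : NonZero m}} .{{_ : NonZero n}} .{{_ : NonZero (m ℕ.* n)}} →
            recip (m ℕ.* n) ≡ recip m * recip n
  recip-* m n = sym (/-*-/ 1 1 m n)

  nat-0 : nat 0 ≡ 0ℚ
  nat-0 = refl

  nat-1 : nat 1 ≡ 1ℚ
  nat-1 = refl

  recip-1 : recip 1 ≡ 1ℚ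
  recip-1 = refl

  recip-nonNeg : ∀ n .{{_ : NonZero n}} → 0ℚ ℚ.≤ recip n
  recip-nonNeg n = ℚ.nonNegative⁻¹ (recip n) {{ℚ.normalize-nonNeg 1 n}}

  recip-pos : ∀ n .{{_ : NonZero n}} → 0ℚ ℚ.< recip n
  recip-pos n = ℚ.positive⁻¹ (recip n) {{ℚ.normalize-pos 1 n}}

  nat-nonNeg : ∀ n → 0ℚ ℚ.≤ nat n
  nat-nonNeg n = ℚ.nonNegative⁻¹ (nat n) {{ℚ.normalize-nonNeg n 1}}

nat-suc : ∀ n → nat (suc n) ≡ 1ℚ ℚ.+ nat n
nat-suc n = trans (nat-+ 1 n) (cong (ℚ._+ nat n) nat-1)

indicator : {P : Set} → Dec P → ℚ
indicator (yes _) = 1ℚ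
indicator (no _)  = 0ℚ

indicator-yes : {P : Set} (p? : Dec P) → P → indicator p? ≡ 1ℚ
indicator-yes (yes _) _ = refl
indicator-yes (no ¬p) p = contradiction p ¬p

indicator-no : {P : Set} (p? : Dec P) → ¬ P → indicator p? ≡ 0ℚ
indicator-no (yes p) ¬p = contradiction p ¬p
indicator-no (no _)  _  = refl

indicator-cong : {P Q : Set} (p? : Dec P) (q? : Dec Q) → P ⇔ Q → indicator p? ≡ indicator q?
indicator-cong (yes _) (yes _) e = refl
indicator-cong (no _)  (no _)  e = refl
indicator-cong (yes p) (no ¬q) e = contradiction (to e p) ¬q
indicator-cong (no ¬p) (yes q) e = contradiction (from e q) ¬p

indicator-× : {P Q R : Set} (p? : Dec P) (q? : Dec Q) (r? : Dec R) → R ⇔ (P × Q) →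
              indicator r? ≡ indicator p? * indicator q?
indicator-× (yes p) (yes q) r? e = indicator-yes r? (from e (p , q))
indicator-× (yes p) (no ¬q) r? e = indicator-no r? (¬q ∘ proj₂ ∘ to e)
indicator-× (no ¬p) q?      r? e = trans (indicator-no r? (¬p ∘ proj₁ ∘ to e)) (sym (ℚ.*-zeroˡ (indicator q?)))

indicator-⊎ : {P Q R : Set} (p? : Dec P) (q? : Dec Q) (r? : Dec R) → R ⇔ (P ⊎ Q) →
              indicator r? ≡ indicator p? ℚ.+ indicator q? ℚ.+ ℚ.- (indicator p? * indicator q?)
indicator-⊎ (yes p) (yes q) r? e = indicator-yes r? (from e (inj₁ p))
indicator-⊎ (yes p) (no ¬q) r? e = indicator-yes r? (from e (inj₁ p))
indicator-⊎ (no ¬p) (yes q) r? e = indicator-yes r? (from e (inj₂ q))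
indicator-⊎ (no ¬p) (no ¬q) r? e = indicator-no r? ([ ¬p , ¬q ]′ ∘ to e)

0≤indicator : {P : Set} (p? : Dec P) → 0ℚ ℚ.≤ indicator p?
0≤indicator (yes _) = ℚ.nonNegative⁻¹ 1ℚ
0≤indicator (no _)  = ℚ.≤-refl

indicator≤1 : {P : Set} (p? : Dec P) → indicator p? ℚ.≤ 1ℚ
indicator≤1 (yes _) = ℚ.≤-refl
indicator≤1 (no _)  = ℚ.nonNegative⁻¹ 1ℚ

under-indicator : {P : Set} (p? : Dec P) {x y : ℚ} → (P → x ≡ y) → indicator p? * x ≡ indicator p? * y
under-indicator (yes p)     h = cong (1ℚ *_) (h p)
under-indicator (no _) {x} {y} h = trans (ℚ.*-zeroˡ x) (sym (ℚ.*-zeroˡ y))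

avg : ∀ {n} .{{_ : NonZero n}} → (Fin n → ℚ) → ℚ
avg {n} f = recip n * sum f

E : ∀ n .{{_ : NonZero n}} p → (Vec (Fin n) p → ℚ) → ℚ
E n zero    f = f []
E n (suc p) f = avg λ x → E n p λ xs → f (x ∷ xs)

_^ℚ_ : ℚ → ℕ → ℚ
x ^ℚ zero  = 1ℚ
x ^ℚ suc n = x * x ^ℚ n

sum-const : ∀ n c → sum {n} (λ _ → c) ≡ nat n * c
sum-const zero    c = sym (trans (cong (_* c) nat-0) (ℚ.*-zeroˡ c))
sum-const (suc n) c = trans (cong (c ℚ.+_) (sum-const n c))
  (trans (solve 2 (λ c m → c :+ m :* c := (con 1ℚ :+ m) :* c) refl c (nat n))
  (cong (_* c) (sym (nat-suc n))))

sum-delta : ∀ {n} (i : Fin n) (f : Fin n → ℚ) → sum (λ j → indicator (i Fin.≟ j) * f j) ≡ f i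
sum-delta {suc n} zero f = trans
  (cong₂ ℚ._+_ (ℚ.*-identityˡ (f zero))
    (trans (sum-cong-≗ (λ j → ℚ.*-zeroˡ (f (suc j)))) (sum-replicate-zero n)))
  (ℚ.+-identityʳ (f zero))
sum-delta {suc n} (suc i) f = trans
  (cong₂ ℚ._+_ (ℚ.*-zeroˡ (f zero))
    (trans (sum-cong-≗ λ j → cong (_* f (suc j))
             (indicator-cong (suc i Fin.≟ suc j) (i Fin.≟ j) (mk⇔ Fin.suc-injective (cong suc))))
           (sum-delta i (f ∘ suc))))
  (ℚ.+-identityˡ (f (suc i)))

sum-indicator : ∀ {P : Fin m → Set} (P? : ∀ j → Dec (P j)) i → P i → (∀ {j} → P j → i ≡ j) →
                sum (λ j → indicator (P? j)) ≡ 1ℚ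
sum-indicator P? i p unique = trans
  (sum-cong-≗ λ j → trans (indicator-cong (P? j) (i Fin.≟ j) (mk⇔ unique (λ { refl → p })))
                          (sym (ℚ.*-identityʳ (indicator (i Fin.≟ j)))))
  (sum-delta i (λ _ → 1ℚ))

sum-indicator-none : ∀ {P : Fin m → Set} (P? : ∀ j → Dec (P j)) → (∀ j → ¬ P j) →
                     sum (λ j → indicator (P? j)) ≡ 0ℚ
sum-indicator-none {m} P? none = trans (sum-cong-≗ λ j → indicator-no (P? j) (none j)) (sum-replicate-zero m)

module _ {n} .{{_ : NonZero n}} where

  avg-cong : ∀ {f g : Fin n → ℚ} → (∀ x → f x ≡ g x) → avg f ≡ avg g
  avg-cong h = cong (recip n *_) (sum-cong-≗ h)

  avg-+ : ∀ f g → avg (λ x → f x ℚ.+ g x) ≡ avg f ℚ.+ avg g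
  avg-+ f g = trans (cong (recip n *_) (∑-distrib-+ f g)) (ℚ.*-distribˡ-+ (recip n) (sum f) (sum g))

  avg-* : ∀ c f → avg (λ x → c * f x) ≡ c * avg f
  avg-* c f = trans (cong (recip n *_) (sym (*-distribˡ-sum c f)))
    (solve 3 (λ r c s → r :* (c :* s) := c :* (r :* s)) refl (recip n) c (sum f))

  avg-const : ∀ c → avg {n} (λ _ → c) ≡ c
  avg-const c = trans (cong (recip n *_) (sum-const n c))
    (trans (solve 3 (λ r m c → r :* (m :* c) := (m :* r) :* c) refl (recip n) (nat n) c)
    (trans (cong (_* c) (nat*recip n)) (ℚ.*-identityˡ c)))

  avg-mono : ∀ {f g : Fin n → ℚ} → (∀ x → f x ℚ.≤ g x) → avg f ℚ.≤ avg g
  avg-mono h = ℚ.*-monoˡ-≤-nonNeg (recip n) {{ℚ.nonNegative (recip-nonNeg n)}} (sum-mono h)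
    where
    sum-mono : ∀ {n} {f g : Fin n → ℚ} → (∀ x → f x ℚ.≤ g x) → sum f ℚ.≤ sum g
    sum-mono {zero}  h = ℚ.≤-refl
    sum-mono {suc n} h = ℚ.+-mono-≤ (h zero) (sum-mono (h ∘ suc))

  avg-delta : ∀ (i : Fin n) (f : Fin n → ℚ) → avg (λ j → indicator (i Fin.≟ j) * f j) ≡ recip n * f i
  avg-delta i f = cong (recip n *_) (sum-delta i f)

avg-sum : ∀ {m n} .{{_ : NonZero n}} (f : Fin m → Fin n → ℚ) →
          avg (λ y → sum λ x → f x y) ≡ sum λ x → avg (f x)
avg-sum {m} {n} f = trans (cong (recip n *_) (sym (∑-comm f))) (*-distribˡ-sum (recip n) (λ x → sum (f x)))

avg-swap : ∀ {m n} .{{_ : NonZero m}} .{{_ : NonZero n}} (f : Fin m → Fin n → ℚ) →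
           avg (λ x → avg (f x)) ≡ avg λ y → avg λ x → f x y
avg-swap {m} {n} f = trans (cong (recip m *_) (sym (*-distribˡ-sum (recip n) (λ x → sum (f x)))))
  (trans (solve 3 (λ r s t → r :* (s :* t) := s :* (r :* t)) refl (recip m) (recip n) (sum λ x → sum (f x)))
  (cong (recip n *_) (trans (cong (recip m *_) (∑-comm f))
    (*-distribˡ-sum (recip m) (λ y → sum λ x → f x y)))))

module _ {n} .{{_ : NonZero n}} where

  E-cong : ∀ p {f g : Vec (Fin n) p → ℚ} → (∀ x → f x ≡ g x) → E n p f ≡ E n p g
  E-cong zero    h = h []
  E-cong (suc p) h = avg-cong λ x → E-cong p λ xs → h (x ∷ xs)

  E-+ : ∀ p (f g : Vec (Fin n) p → ℚ) → E n p (λ x → f x ℚ.+ g x) ≡ E n p f ℚ.+ E n p g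
  E-+ zero    f g = refl
  E-+ (suc p) f g = trans (avg-cong λ x → E-+ p (f ∘ (x ∷_)) (g ∘ (x ∷_))) (avg-+ _ _)

  E-* : ∀ p c (f : Vec (Fin n) p → ℚ) → E n p (λ x → c * f x) ≡ c * E n p f
  E-* zero    c f = refl
  E-* (suc p) c f = trans (avg-cong λ x → E-* p c (f ∘ (x ∷_))) (avg-* c _)

  E-const : ∀ p c → E n p (λ _ → c) ≡ c
  E-const zero    c = refl
  E-const (suc p) c = trans (avg-cong λ _ → E-const p c) (avg-const c)

  E-mono : ∀ p {f g : Vec (Fin n) p → ℚ} → (∀ x → f x ℚ.≤ g x) → E n p f ℚ.≤ E n p g
  E-mono zero    h = h []
  E-mono (suc p) h = avg-mono λ x → E-mono p λ xs → h (x ∷ xs)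

  E-avg : ∀ {m} .{{_ : NonZero m}} p (f : Vec (Fin n) p → Fin m → ℚ) →
          E n p (λ x → avg (f x)) ≡ avg λ y → E n p λ x → f x y
  E-avg zero    f = refl
  E-avg (suc p) f = trans (avg-cong λ x → E-avg p (f ∘ (x ∷_))) (avg-swap _)

  E-swap : ∀ {m} .{{_ : NonZero m}} p q (f : Vec (Fin n) p → Vec (Fin m) q → ℚ) →
           E n p (λ x → E m q (f x)) ≡ E m q λ y → E n p λ x → f x y
  E-swap p zero    f = refl
  E-swap p (suc q) f = trans (E-avg p _) (avg-cong λ y → E-swap p q λ x ys → f x (y ∷ ys))

  E-++ : ∀ p q (f : Vec (Fin n) (p + q) → ℚ) → E n (p + q) f ≡ E n p λ x → E n q λ y → f (x Vec.++ y)
  E-++ zero    q f = refl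
  E-++ (suc p) q f = avg-cong λ x → E-++ p q (f ∘ (x ∷_))

  E-sum : ∀ p {m} (f : Fin m → Vec (Fin n) p → ℚ) → E n p (λ x → sum λ j → f j x) ≡ sum λ j → E n p (f j)
  E-sum p {zero}  f = E-const p 0ℚ
  E-sum p {suc m} f = trans (E-+ p _ _) (cong (E n p (f zero) ℚ.+_) (E-sum p (f ∘ suc)))

  E-delta : ∀ p (x : Vec (Fin n) p) (f : Vec (Fin n) p → ℚ) →
            E n p (λ y → indicator (Vec.≡-dec Fin._≟_ x y) * f y) ≡ (recip n ^ℚ p) * f x
  E-delta zero    [] f = refl
  E-delta (suc p) (x ∷ xs) f = trans
    (avg-cong λ y → trans
      (E-cong p λ ys → trans
        (cong (_* f (y ∷ ys)) (indicator-× (x Fin.≟ y) (Vec.≡-dec Fin._≟_ xs ys) (Vec.≡-dec Fin._≟_ (x ∷ xs) (y ∷ ys))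
          (mk⇔ (λ eq → Vec.∷-injective eq) (λ (eq , eqs) → cong₂ _∷_ eq eqs))))
        (ℚ.*-assoc (indicator (x Fin.≟ y)) (indicator (Vec.≡-dec Fin._≟_ xs ys)) (f (y ∷ ys))))
      (trans (E-* p (indicator (x Fin.≟ y)) (λ ys → indicator (Vec.≡-dec Fin._≟_ xs ys) * f (y ∷ ys)))
             (cong (indicator (x Fin.≟ y) *_) (E-delta p xs (f ∘ (y ∷_))))))
    (trans (avg-delta x (λ y → (recip n ^ℚ p) * f (y ∷ xs))) (sym (ℚ.*-assoc (recip n) (recip n ^ℚ p) (f (x ∷ xs)))))

-- Probabilities of satisfaction as averages

lsum : ∀ {X : Set} → (X → ℚ) → List X → ℚ
lsum f []       = 0ℚ
lsum f (x ∷ xs) = f x ℚ.+ lsum f xs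

length-filter : ∀ {X : Set} {P : X → Set} (P? : ∀ x → Dec (P x)) xs →
                nat (length (filter P? xs)) ≡ lsum (λ x → indicator (P? x)) xs
length-filter P? []       = nat-0
length-filter P? (x ∷ xs) with P? x
... | yes _ = trans (nat-suc (length (filter P? xs))) (cong (1ℚ ℚ.+_) (length-filter P? xs))
... | no _  = trans (length-filter P? xs) (sym (ℚ.+-identityˡ _))

lsum-tabulate : ∀ {X : Set} {n} (f : X → ℚ) (g : Fin n → X) → lsum f (List.tabulate g) ≡ sum (f ∘ g)
lsum-tabulate {n = zero}  f g = refl
lsum-tabulate {n = suc n} f g = cong (f (g zero) ℚ.+_) (lsum-tabulate f (g ∘ suc))

lsum-++ : ∀ {X : Set} (f : X → ℚ) xs ys → lsum f (xs ++ ys) ≡ lsum f xs ℚ.+ lsum f ys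
lsum-++ f []       ys = sym (ℚ.+-identityˡ _)
lsum-++ f (x ∷ xs) ys = trans (cong (f x ℚ.+_) (lsum-++ f xs ys)) (sym (ℚ.+-assoc (f x) _ _))

lsum-map : ∀ {X Y : Set} (f : Y → ℚ) (g : X → Y) xs → lsum f (List.map g xs) ≡ lsum (f ∘ g) xs
lsum-map f g []       = refl
lsum-map f g (x ∷ xs) = cong (f (g x) ℚ.+_) (lsum-map f g xs)

lsum-cartesian : ∀ {X Y Z : Set} (f : Z → ℚ) (g : X → Y → Z) xs ys →
                 lsum f (cartesianProductWith g xs ys) ≡ lsum (λ x → lsum (λ y → f (g x y)) ys) xs
lsum-cartesian f g []       ys = refl
lsum-cartesian f g (x ∷ xs) ys = trans (lsum-++ f (List.map (g x) ys) _)
  (cong₂ ℚ._+_ (lsum-map f (g x) ys) (lsum-cartesian f g xs ys))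

E-lsum : ∀ n .{{_ : NonZero n}} p .{{_ : NonZero (n ℕ.^ p)}} (f : Vec (Fin n) p → ℚ) →
         E n p f ≡ lsum f (tuples n p) * recip (n ℕ.^ p)
E-lsum n zero    f = trans (solve 1 (λ x → x := (x :+ con 0ℚ) :* con 1ℚ) refl (f []))
  (cong ((f [] ℚ.+ 0ℚ) *_) (sym recip-1))
E-lsum n (suc p) f = trans
  (avg-cong λ x → trans (E-lsum n p (f ∘ (x ∷_))) (ℚ.*-comm (inner x) (recip (n ℕ.^ p))))
  (trans (avg-* (recip (n ℕ.^ p)) inner)
  (trans (solve 3 (λ a b c → a :* (b :* c) := c :* (b :* a)) refl (recip (n ℕ.^ p)) (recip n) (sum inner))
  (cong₂ _*_
    (sym (trans (lsum-cartesian f _∷_ (allFin n) (tuples n p)) (lsum-tabulate inner id)))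
    (sym (recip-* n (n ℕ.^ p))))))
  where
  instance
    n^p≢0 = ℕ.m^n≢0 n p
  inner : Fin n → ℚ
  inner x = lsum (λ y → f (x ∷ y)) (tuples n p)

⟨⟩-E : ∀ (φ : Formula σ c p) (A : Structure σ c) →
       ⟨ φ , A ⟩ ≡ E (size A) p λ ρ → indicator (A ⊨? φ [ ρ ])
⟨⟩-E {p = p} φ A = trans (/≡nat*recip (length (filter (λ ρ → A ⊨? φ [ ρ ]) (tuples (size A) p))) (size A ℕ.^ p))
  (trans (cong (_* recip (size A ℕ.^ p)) (length-filter (λ ρ → A ⊨? φ [ ρ ]) (tuples (size A) p)))
  (sym (E-lsum (size A) p _)))
  where instance
    size^p≢0 = ℕ.m^n≢0 (size A) p

nat-mono : ∀ {m n} → m ≤ n → nat m ℚ.≤ nat n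
nat-mono {m} {n} m≤n = ℚ.≤-trans (ℚ.≤-reflexive (sym (ℚ.+-identityʳ (nat m))))
  (ℚ.≤-trans (ℚ.+-monoʳ-≤ (nat m) (nat-nonNeg (n ℕ.∸ m)))
    (ℚ.≤-reflexive (trans (sym (nat-+ m (n ℕ.∸ m))) (cong nat (ℕ.m+[n∸m]≡n m≤n)))))

recip-antitone : ∀ {m n} .{{_ : NonZero m}} .{{_ : NonZero n}} → m ≤ n → recip n ℚ.≤ recip m
recip-antitone {m} {n} m≤n = ℚ.≤-trans
  (ℚ.≤-reflexive (trans (sym (ℚ.*-identityʳ (recip n))) (cong (recip n *_) (sym (nat*recip m)))))
  (ℚ.≤-trans
    (ℚ.*-monoˡ-≤-nonNeg (recip n) {{ℚ.nonNegative (recip-nonNeg n)}}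
      (ℚ.*-monoʳ-≤-nonNeg (recip m) {{ℚ.nonNegative (recip-nonNeg m)}} (nat-mono m≤n)))
    (ℚ.≤-reflexive (trans (solve 3 (λ x y z → x :* (y :* z) := (y :* x) :* z) refl (recip n) (nat n) (recip m))
      (trans (cong (_* recip m) (nat*recip n)) (ℚ.*-identityˡ (recip m))))))

recip-suc : ∀ n .{{_ : NonZero n}} → recip n ≡ recip n * recip (suc n) ℚ.+ recip (suc n)
recip-suc n = begin
  r                                    ≡⟨ trans (sym (ℚ.*-identityʳ r)) (cong (r *_) (sym (nat*recip (suc n)))) ⟩
  r * (nat (suc n) * s)            ≡⟨ cong (λ x → r * (x * s)) (nat-suc n) ⟩
  r * ((1ℚ ℚ.+ nat n) * s)         ≡⟨ solve 3 (λ r x s → r :* ((con 1ℚ :+ x) :* s) := r :* s :+ (x :* r) :* s) refl r (nat n) s ⟩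
  r * s ℚ.+ (nat n * r) * s      ≡⟨ cong (λ x → r * s ℚ.+ x * s) (nat*recip n) ⟩
  r * s ℚ.+ 1ℚ * s                 ≡⟨ cong (r * s ℚ.+_) (ℚ.*-identityˡ s) ⟩
  r * s ℚ.+ s                        ∎
  where
  open ≡-Reasoning
  r = recip n
  s = recip (suc n)

recip-strict : ∀ n .{{_ : NonZero n}} → recip (suc n) ℚ.< recip n
recip-strict n = subst (ℚ._< recip n) (ℚ.+-identityˡ (recip (suc n)))
  (subst (0ℚ ℚ.+ recip (suc n) ℚ.<_) (sym (recip-suc n)) (ℚ.+-monoˡ-< (recip (suc n)) gap-pos))
  where
  gap-pos : 0ℚ ℚ.< recip n * recip (suc n)
  gap-pos = subst (ℚ._< recip n * recip (suc n)) (ℚ.*-zeroʳ (recip n))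
    (ℚ.*-monoʳ-<-pos (recip n) {{ℚ.positive (recip-pos n)}} (recip-pos (suc n)))

recip-below : ∀ {ε} → 0ℚ ℚ.< ε → ∃ λ M → recip (suc M) ℚ.< ε
recip-below {ε} 0<ε = search ε (ℚ.positive 0<ε)
  where
  search : ∀ ε → ℚ.Positive ε → ∃ λ M → recip (suc M) ℚ.< ε
  -- A positive fraction with denominator `suc d` is at least 1 / (d + 1), hence greater than 1 / (d
  -- + 2).
  search ε@(ℚ.mkℚ (+ suc c) d _) _ = suc d , ℚ.<-≤-trans (recip-strict (suc d)) (begin
    recip (suc d)                    ≡⟨ trans (sym (ℚ.*-identityˡ (recip (suc d)))) (cong (_* recip (suc d)) (sym nat-1)) ⟩
    nat 1 * recip (suc d)          ≤⟨ ℚ.*-monoʳ-≤-nonNeg (recip (suc d)) {{ℚ.nonNegative (recip-nonNeg (suc d))}} (nat-mono {1} (s≤s z≤n)) ⟩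
    nat (suc c) * recip (suc d)    ≡⟨ /≡nat*recip (suc c) (suc d) ⟨
    + suc c ℚ./ suc d                ≡⟨ ℚ.↥p/↧p≡p ε ⟩
    ε                                ∎)
    where open ℚ.≤-Reasoning

probability : (A : Structure σ c) → Guarded σ c p → ℚ
probability {p = p} A φ = E (size A) p λ ρ → indicator (A ⊩? φ [ ρ ])

⟨compile⟩≡probability : ∀ (A : Structure σ c) (φ : Guarded σ c p) → ⟨ compile φ , A ⟩ ≡ probability A φ
⟨compile⟩≡probability {p = p} A φ = trans (⟨⟩-E (compile φ) A) (E-cong p λ ρ →
  indicator-cong (A ⊨? compile φ [ ρ ]) (A ⊩? φ [ ρ ]) (⊨-compile A φ))

-- Exhibits 1 / |A| as the probability of a local formula, so that it converges along with the
-- structures.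
probability-var≡var : (A : Structure σ c) → probability A (eqᵍ {n = 2} (var zero) (var (suc zero))) ≡ recip (size A)
probability-var≡var A = trans
  (avg-cong λ x → trans
    (avg-cong λ y → trans (indicator-cong (A ⊩? eqᵍ (var zero) (var (suc zero)) [ x ∷ y ∷ [] ]) (x Fin.≟ y) ⇔.refl)
      (sym (ℚ.*-identityʳ (indicator (x Fin.≟ y)))))
    (avg-delta x (λ _ → 1ℚ)))
  (trans (avg-const (recip (size A) * 1ℚ)) (ℚ.*-identityʳ (recip (size A))))

-- With a constant available, one free variable is enough to recover the size; this is all that the
-- weaker hypothesis on the gadgets offers.
probability-con≡var : (A : Structure σ c) (i : Fin c) → probability A (eqᵍ {n = 1} (con i) (var zero)) ≡ recip (size A)
probability-con≡var A i = trans
  (avg-cong λ y → trans (indicator-cong (A ⊩? eqᵍ (con i) (var zero) [ y ∷ [] ]) (constant A i Fin.≟ y) ⇔.refl)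
    (sym (ℚ.*-identityʳ (indicator (constant A i Fin.≟ y)))))
  (trans (avg-delta (constant A i) (λ _ → 1ℚ)) (ℚ.*-identityʳ (recip (size A))))

*-mono-≤ : ∀ {a b c d} → 0ℚ ℚ.≤ a → 0ℚ ℚ.≤ d → a ℚ.≤ b → c ℚ.≤ d → a * c ℚ.≤ b * d
*-mono-≤ {a} {b} {c} {d} 0≤a 0≤d a≤b c≤d = ℚ.≤-trans
  (ℚ.*-monoˡ-≤-nonNeg a {{ℚ.nonNegative 0≤a}} c≤d)
  (ℚ.*-monoʳ-≤-nonNeg d {{ℚ.nonNegative 0≤d}} a≤b)

0≤+ : ∀ {a b} → 0ℚ ℚ.≤ a → 0ℚ ℚ.≤ b → 0ℚ ℚ.≤ a ℚ.+ b
0≤+ 0≤a 0≤b = ℚ.+-mono-≤ 0≤a 0≤b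

0≤* : ∀ {a b} → 0ℚ ℚ.≤ a → 0ℚ ℚ.≤ b → 0ℚ ℚ.≤ a * b
0≤* {a} {b} 0≤a 0≤b = subst (ℚ._≤ a * b) (ℚ.*-zeroʳ a) (ℚ.*-monoˡ-≤-nonNeg a {{ℚ.nonNegative 0≤a}} 0≤b)

-- Sampling a vertex of A * G

power-pred : ∀ l .{{_ : NonZero l}} n .{{_ : NonZero n}} → (recip n ^ℚ l) * nat n ≡ recip n ^ℚ ℕ.pred l
power-pred (suc l) n = trans (solve 3 (λ r x n → (r :* x) :* n := (n :* r) :* x) refl (recip n) (recip n ^ℚ l) (nat n))
  (trans (cong (_* (recip n ^ℚ l)) (nat*recip n)) (ℚ.*-identityˡ (recip n ^ℚ l)))

^-nonNeg : ∀ {x} l → 0ℚ ℚ.≤ x → 0ℚ ℚ.≤ x ^ℚ l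
^-nonNeg zero    0≤x = ℚ.nonNegative⁻¹ 1ℚ
^-nonNeg (suc l) 0≤x = 0≤* 0≤x (^-nonNeg l 0≤x)

module Sampling {σ : Signature} {k : ℕ} .{{_ : NonZero k}} (A : BaseStructure σ k) (G : Gadget σ k) where

  open Product A G

  H : Structure σ k
  H = structure G

  instance
    X≢0 : NonZero (size X)
    X≢0 = size≢0 X

  isEdge? : ∀ e → Dec (IsEdge e)
  isEdge? e = T? (interp A zero e)

  nonRoot? : ∀ v → Dec (NonRoot v)
  nonRoot? v = map′ (λ ¬r l r → ¬r (l , r)) (λ { nr (l , r) → nr l r }) (¬? (isRoot? v))

  edgeᵢ : Vec (V A) k → ℚ
  edgeᵢ e = indicator (isEdge? e)

  nonRootᵢ : V H → ℚ
  nonRootᵢ v = indicator (nonRoot? v)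

  _≟ᵢ_ : V X → V X → ℚ
  x ≟ᵢ y = indicator (x Fin.≟ y)

  -- The sum over the nonroot vertices of all copies is |A|^k |H| times a mean over `k`-tuples and
  -- gadget vertices. Dividing by |X| leaves this factor.
  copyWeight : ℚ
  copyWeight = (nat (size A) ^ℚ k) * nat (size H) * recip (size X)

  baseWeight : ℚ
  baseWeight = nat (size A) * recip (size X)

  onCopy : (V X → ℚ) → Vec (V A) k → ℚ
  onCopy f e = avg λ v → nonRootᵢ v * f (copy e v)

  private
    C : ℚ
    C = (nat (size A) ^ℚ k) * nat (size H)

    hitsBase : V X → ℚ
    hitsBase q = avg λ a → base a ≟ᵢ q

    hitsCopy : V X → ℚ
    hitsCopy q = E (size A) k λ e → avg λ v → edgeᵢ e * (nonRootᵢ v * (copy e v ≟ᵢ q))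

    power-recip : ∀ n .{{_ : NonZero n}} l → (nat n ^ℚ l) * (recip n ^ℚ l) ≡ 1ℚ
    power-recip n zero    = refl
    power-recip n (suc l) = trans
      (solve 4 (λ x y z t → (x :* y) :* (z :* t) := (x :* z) :* (y :* t)) refl (nat n) (nat n ^ℚ l) (recip n) (recip n ^ℚ l))
      (cong₂ _*_ (nat*recip n) (power-recip n l))

    copy-zero : ∀ {e v x} → (IsEdge e → NonRoot v → x ≡ 0ℚ) → edgeᵢ e * (nonRootᵢ v * x) ≡ 0ℚ
    copy-zero {e} {v} {x} h with isEdge? e | nonRoot? v
    ... | no _  | nr?    = ℚ.*-zeroˡ (indicator nr? * x)
    ... | yes _ | no _   = trans (ℚ.*-identityˡ (0ℚ * x)) (ℚ.*-zeroˡ x)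
    ... | yes p | yes nr = trans (ℚ.*-identityˡ (1ℚ * x)) (trans (ℚ.*-identityˡ x) (h p nr))

    -- A partition of unity: the factors turn the means back into counts, and `q` is hit by exactly
    -- one base vertex or exactly one pair of an edge and a nonroot vertex.
    covered : ∀ q → nat (size A) * hitsBase q ℚ.+ C * hitsCopy q ≡ 1ℚ
    covered q with pointView q
    ... | isBase a = trans (cong₂ ℚ._+_ (trans (cong (nat (size A) *_) hits) cancel) (trans (cong (C *_) misses) (ℚ.*-zeroʳ C)))
                           (ℚ.+-identityʳ 1ℚ)
      where
      hits : hitsBase (base a) ≡ recip (size A) * 1ℚ
      hits = trans (avg-cong λ a′ → trans
          (indicator-cong (base a′ Fin.≟ base a) (a Fin.≟ a′) (mk⇔ (sym ∘ base-injective) (cong base ∘ sym)))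
          (sym (ℚ.*-identityʳ (indicator (a Fin.≟ a′)))))
        (avg-delta a (λ _ → 1ℚ))
      cancel : nat (size A) * (recip (size A) * 1ℚ) ≡ 1ℚ
      cancel = trans (cong (nat (size A) *_) (ℚ.*-identityʳ _)) (nat*recip (size A))
      misses : hitsCopy (base a) ≡ 0ℚ
      misses = trans (E-cong k λ e → trans (avg-cong λ v → copy-zero {e} {v} λ p nr →
          indicator-no (copy e v Fin.≟ base a) λ eq → let (l , r , _) = copy-base p eq in nr l r)
        (avg-const 0ℚ)) (E-const k 0ℚ)
    ... | isCopy {e₀} {v₀} p₀ nr₀ = trans (cong₂ ℚ._+_ (trans (cong (nat (size A) *_) misses) (ℚ.*-zeroʳ (nat (size A)))) (trans (cong (C *_) hits) cancel))
                                         (ℚ.+-identityˡ 1ℚ)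
      where
      misses : hitsBase (copy e₀ v₀) ≡ 0ℚ
      misses = trans (avg-cong λ a → indicator-no (base a Fin.≟ copy e₀ v₀) λ eq →
        let (l , r , _) = copy-base p₀ (sym eq) in nr₀ l r) (avg-const 0ℚ)
      same : ∀ e v → edgeᵢ e * (nonRootᵢ v * (copy e v ≟ᵢ copy e₀ v₀)) ≡
                     indicator (Vec.≡-dec Fin._≟_ e₀ e) * (indicator (v₀ Fin.≟ v) * 1ℚ)
      same e v = begin
        edgeᵢ e * (nonRootᵢ v * (copy e v ≟ᵢ copy e₀ v₀))
          ≡⟨ cong (edgeᵢ e *_) (indicator-× (nonRoot? v) hit? (nonRoot? v ×-dec hit?) ⇔.refl) ⟨
        edgeᵢ e * indicator (nonRoot? v ×-dec hit?)
          ≡⟨ indicator-× (isEdge? e) (nonRoot? v ×-dec hit?) (isEdge? e ×-dec nonRoot? v ×-dec hit?) ⇔.refl ⟨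
        indicator (isEdge? e ×-dec nonRoot? v ×-dec hit?)
          ≡⟨ indicator-× e? v? (isEdge? e ×-dec nonRoot? v ×-dec hit?) (mk⇔
               (λ (p , nr , eq) → let (e≡ , v≡) = copy-injective p p₀ nr eq in sym e≡ , sym v≡)
               (λ { (refl , refl) → p₀ , nr₀ , refl })) ⟩
        indicator e? * indicator v?
          ≡⟨ cong (indicator e? *_) (ℚ.*-identityʳ (indicator v?)) ⟨
        indicator e? * (indicator v? * 1ℚ) ∎
        where
        open ≡-Reasoning
        hit? = copy e v Fin.≟ copy e₀ v₀
        e? = Vec.≡-dec Fin._≟_ e₀ e
        v? = v₀ Fin.≟ v
      hits : hitsCopy (copy e₀ v₀) ≡ (recip (size A) ^ℚ k) * (recip (size H) * 1ℚ)
      hits = trans (E-cong k λ e → trans (avg-cong (same e))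
          (trans (avg-* (indicator (Vec.≡-dec Fin._≟_ e₀ e)) λ v → indicator (v₀ Fin.≟ v) * 1ℚ)
            (cong (indicator (Vec.≡-dec Fin._≟_ e₀ e) *_) (avg-delta v₀ (λ _ → 1ℚ)))))
        (E-delta k e₀ (λ _ → recip (size H) * 1ℚ))
      cancel : C * ((recip (size A) ^ℚ k) * (recip (size H) * 1ℚ)) ≡ 1ℚ
      cancel = trans
        (solve 4 (λ x y z t → (x :* y) :* (z :* (t :* con 1ℚ)) := (x :* z) :* (y :* t)) refl
          (nat (size A) ^ℚ k) (nat (size H)) (recip (size A) ^ℚ k) (recip (size H)))
        (cong₂ _*_ (power-recip (size A) k) (nat*recip (size H)))

  -- Inserting the partition of unity `covered` and interchanging averages moves `f` to the points
  -- that are hit.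
  expand : ∀ f → avg f ≡ baseWeight * avg (f ∘ base) ℚ.+ copyWeight * E (size A) k (λ e → edgeᵢ e * onCopy f e)
  expand f = begin
    avg f
      ≡⟨ avg-cong (λ q → trans (sym (ℚ.*-identityʳ (f q))) (cong (f q *_) (sym (covered q)))) ⟩
    avg (λ q → f q * (a₀ * hitsBase q ℚ.+ C * hitsCopy q))
      ≡⟨ avg-cong (λ q → solve 5 (λ f n x c y → f :* (n :* x :+ c :* y) := n :* (f :* x) :+ c :* (f :* y)) refl
           (f q) a₀ (hitsBase q) C (hitsCopy q)) ⟩
    avg (λ q → a₀ * (f q * hitsBase q) ℚ.+ C * (f q * hitsCopy q))
      ≡⟨ trans (avg-+ (λ q → a₀ * (f q * hitsBase q)) (λ q → C * (f q * hitsCopy q)))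
           (cong₂ ℚ._+_ (avg-* a₀ (λ q → f q * hitsBase q)) (avg-* C (λ q → f q * hitsCopy q))) ⟩
    a₀ * avg (λ q → f q * hitsBase q) ℚ.+ C * avg (λ q → f q * hitsCopy q)
      ≡⟨ cong₂ (λ x y → a₀ * x ℚ.+ C * y) onBases onCopies ⟩
    a₀ * (r * avg (f ∘ base)) ℚ.+ C * (r * E (size A) k (λ e → edgeᵢ e * onCopy f e))
      ≡⟨ cong₂ ℚ._+_ (sym (ℚ.*-assoc a₀ r _)) (sym (ℚ.*-assoc C r _)) ⟩
    baseWeight * avg (f ∘ base) ℚ.+ copyWeight * E (size A) k (λ e → edgeᵢ e * onCopy f e) ∎
    where
    open ≡-Reasoning
    a₀ = nat (size A)
    r = recip (size X)
    at-point : ∀ x → avg (λ q → f q * (x ≟ᵢ q)) ≡ r * f x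
    at-point x = trans (avg-cong λ q → ℚ.*-comm (f q) (x ≟ᵢ q)) (avg-delta x f)
    onBases : avg (λ q → f q * hitsBase q) ≡ r * avg (f ∘ base)
    onBases = begin
      avg (λ q → f q * hitsBase q)                    ≡⟨ avg-cong (λ q → avg-* (f q) (λ a → base a ≟ᵢ q)) ⟨
      avg (λ q → avg λ a → f q * (base a ≟ᵢ q))       ≡⟨ avg-swap (λ q a → f q * (base a ≟ᵢ q)) ⟩
      avg (λ a → avg λ q → f q * (base a ≟ᵢ q))       ≡⟨ avg-cong (λ a → at-point (base a)) ⟩
      avg (λ a → r * f (base a))                      ≡⟨ avg-* r (f ∘ base) ⟩
      r * avg (f ∘ base)                              ∎
    onCopies : avg (λ q → f q * hitsCopy q) ≡ r * E (size A) k (λ e → edgeᵢ e * onCopy f e)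
    onCopies = begin
      avg (λ q → f q * hitsCopy q)
        ≡⟨ avg-cong (λ q → trans (E-cong k λ e → avg-* (f q) (term q e)) (E-* k (f q) (λ e → avg (term q e)))) ⟨
      avg (λ q → E (size A) k λ e → avg λ v → f q * term q e v)
        ≡⟨ E-avg k (λ e q → avg λ v → f q * term q e v) ⟨
      E (size A) k (λ e → avg λ q → avg λ v → f q * term q e v)
        ≡⟨ E-cong k (λ e → avg-swap λ q v → f q * term q e v) ⟩
      E (size A) k (λ e → avg λ v → avg λ q → f q * term q e v)
        ≡⟨ E-cong k (λ e → avg-cong λ v → single-copy e v) ⟩
      E (size A) k (λ e → avg λ v → r * (edgeᵢ e * (nonRootᵢ v * f (copy e v))))
        ≡⟨ E-cong k (λ e → trans (avg-* r (λ v → edgeᵢ e * (nonRootᵢ v * f (copy e v))))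
             (cong (r *_) (avg-* (edgeᵢ e) (λ v → nonRootᵢ v * f (copy e v))))) ⟩
      E (size A) k (λ e → r * (edgeᵢ e * onCopy f e))
        ≡⟨ E-* k r (λ e → edgeᵢ e * onCopy f e) ⟩
      r * E (size A) k (λ e → edgeᵢ e * onCopy f e) ∎
      where
      term : V X → Vec (V A) k → V H → ℚ
      term q e v = edgeᵢ e * (nonRootᵢ v * (copy e v ≟ᵢ q))
      single-copy : ∀ e v → avg (λ q → f q * term q e v) ≡ r * (edgeᵢ e * (nonRootᵢ v * f (copy e v)))
      single-copy e v = trans
        (avg-cong λ q → solve 4 (λ f x y z → f :* (x :* (y :* z)) := (x :* y) :* (f :* z)) refl
          (f q) (edgeᵢ e) (nonRootᵢ v) (copy e v ≟ᵢ q))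
        (trans (avg-* (edgeᵢ e * nonRootᵢ v) (λ q → f q * (copy e v ≟ᵢ q)))
        (trans (cong (edgeᵢ e * nonRootᵢ v *_) (at-point (copy e v)))
        (solve 4 (λ x y r f → (x :* y) :* (r :* f) := r :* (x :* (y :* f))) refl
          (edgeᵢ e) (nonRootᵢ v) r (f (copy e v)))))

  -- Densities and weights of one sampling step

  edgeDensity : ℚ
  edgeDensity = E (size A) k edgeᵢ

  nonRootDensity : ℚ
  nonRootDensity = avg nonRootᵢ

  -- When the gadget has no vertex besides its roots, there is nothing to sample
  -- in the copies, but the ratio copyWeight need not be bounded.
  copyWeightIf : Dec (k < size H) → ℚ
  copyWeightIf (yes _) = copyWeight
  copyWeightIf (no _)  = 0ℚ

  newCopyW : ℚ
  newCopyW = copyWeightIf (k ℕ.<? size H)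

  -- A prescribed edge has mass |A|^(-k) among all `k`-tuples. This factor vanishes as |A| → ∞.
  oldCopyW : ℚ
  oldCopyW = newCopyW * (recip (size A) ^ℚ k)

  -- Written as a complementary probability instead of |A| / |X|, so that it converges as soon as
  -- `newCopyW` and the densities do.
  baseW : ℚ
  baseW = 1ℚ ℚ.+ ℚ.- (newCopyW * (edgeDensity * nonRootDensity))

  -- Pigeonhole: a nonroot vertex and the `k` distinct roots would be `suc k` vertices.
  all-roots : ¬ (k < size H) → ∀ v → nonRootᵢ v ≡ 0ℚ
  all-roots k≮h v = indicator-no (nonRoot? v) λ nr → k≮h (Fin.injective⇒≤ (inj nr _ _))
    where
    inj : NonRoot v → ∀ i j → (v ◂ root G) i ≡ (v ◂ root G) j → i ≡ j
    inj nr zero    zero    _  = refl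
    inj nr zero    (suc j) eq = contradiction (sym eq) (nr j)
    inj nr (suc i) zero    eq = contradiction eq (nr i)
    inj nr (suc i) (suc j) eq = cong suc (root-distinct G eq)

  copyWeight≡newCopyW : ∀ (g : V H → ℚ) → copyWeight * avg (λ v → nonRootᵢ v * g v) ≡ newCopyW * avg (λ v → nonRootᵢ v * g v)
  copyWeight≡newCopyW g = by-cases (k ℕ.<? size H)
    where
    mean = avg λ v → nonRootᵢ v * g v
    by-cases : ∀ d → copyWeight * mean ≡ copyWeightIf d * mean
    by-cases (yes _) = refl
    by-cases (no ¬p) = trans (cong (copyWeight *_) mean≡0)
      (trans (ℚ.*-zeroʳ copyWeight) (sym (ℚ.*-zeroˡ mean)))
      where
      mean≡0 : mean ≡ 0ℚ
      mean≡0 = trans (avg-cong λ v → trans (cong (_* g v) (all-roots ¬p v)) (ℚ.*-zeroˡ (g v))) (avg-const 0ℚ)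

  expand-new : ∀ f → avg f ≡ baseWeight * avg (f ∘ base) ℚ.+ newCopyW * E (size A) k (λ e → edgeᵢ e * onCopy f e)
  expand-new f = trans (expand f) (cong (baseWeight * avg (f ∘ base) ℚ.+_) (begin
    copyWeight * E (size A) k (λ e → edgeᵢ e * onCopy f e)
      ≡⟨ E-* k copyWeight (λ e → edgeᵢ e * onCopy f e) ⟨
    E (size A) k (λ e → copyWeight * (edgeᵢ e * onCopy f e))
      ≡⟨ E-cong k (λ e → trans (move copyWeight (edgeᵢ e) (onCopy f e))
           (trans (cong (edgeᵢ e *_) (copyWeight≡newCopyW (f ∘ copy e))) (sym (move newCopyW (edgeᵢ e) (onCopy f e))))) ⟩
    E (size A) k (λ e → newCopyW * (edgeᵢ e * onCopy f e))
      ≡⟨ E-* k newCopyW (λ e → edgeᵢ e * onCopy f e) ⟩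
    newCopyW * E (size A) k (λ e → edgeᵢ e * onCopy f e) ∎))
    where
    open ≡-Reasoning
    move : ∀ x y z → x * (y * z) ≡ y * (x * z)
    move = solve 3 (λ x y z → x :* (y :* z) := y :* (x :* z)) refl

  onCopy-1 : ∀ e → edgeᵢ e * onCopy (λ _ → 1ℚ) e ≡ nonRootDensity * edgeᵢ e
  onCopy-1 e = trans (cong (edgeᵢ e *_) (avg-cong λ v → ℚ.*-identityʳ (nonRootᵢ v))) (ℚ.*-comm (edgeᵢ e) nonRootDensity)

  -- The expansion of the constant function 1, for `w` either `copyWeight` or `newCopyW`: the
  -- weights add up to a probability distribution.
  total : (w : ℚ) → 1ℚ ≡ baseWeight * avg {size A} (λ _ → 1ℚ) ℚ.+ w * E (size A) k (λ e → edgeᵢ e * onCopy (λ _ → 1ℚ) e) →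
          1ℚ ≡ baseWeight ℚ.+ w * (edgeDensity * nonRootDensity)
  total w eq = trans eq (cong₂ ℚ._+_
    (trans (cong (baseWeight *_) (avg-const {size A} 1ℚ)) (ℚ.*-identityʳ baseWeight))
    (cong (w *_) (trans (E-cong k onCopy-1) (trans (E-* k nonRootDensity edgeᵢ) (ℚ.*-comm nonRootDensity edgeDensity)))))

  baseWeight≡baseW : baseWeight ≡ baseW
  baseWeight≡baseW = begin
    baseWeight                                ≡⟨ solve 2 (λ b c → b := (b :+ c) :+ :- c) refl baseWeight used ⟩
    (baseWeight ℚ.+ used) ℚ.+ ℚ.- used          ≡⟨ cong (ℚ._+ ℚ.- used) (total newCopyW (trans (sym (avg-const {size X} 1ℚ)) (expand-new (λ _ → 1ℚ)))) ⟨
    baseW                                     ∎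
    where
    open ≡-Reasoning
    used = newCopyW * (edgeDensity * nonRootDensity)

  -- |X| / (|A|^k |H|), the number of vertices relative to that of all pairs.
  ratio : ℚ
  ratio = (recip (size A) ^ℚ k) * (nat (size A) * recip (size H)) ℚ.+ edgeDensity * nonRootDensity

  -- In the expansion of 1 the base term |A| / |X| is rewritten as a multiple of `copyWeight`.
  -- Convergence of the weight is thereby reduced to that of its inverse.
  copyWeight*ratio : copyWeight * ratio ≡ 1ℚ
  copyWeight*ratio = sym (begin
    1ℚ
      ≡⟨ total copyWeight (trans (sym (avg-const {size X} 1ℚ)) (expand (λ _ → 1ℚ))) ⟩
    a * r ℚ.+ copyWeight * (edgeDensity * nonRootDensity)
      ≡⟨ cong (ℚ._+ copyWeight * (edgeDensity * nonRootDensity)) (begin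
           a * r
             ≡⟨ solve 2 (λ a r → a :* r := con 1ℚ :* con 1ℚ :* (a :* r)) refl a r ⟩
           1ℚ * 1ℚ * (a * r)
             ≡⟨ cong₂ (λ x y → x * y * (a * r)) (power-recip (size A) k) (nat*recip (size H)) ⟨
           (aᵏ * a⁻ᵏ) * (h * h⁻¹) * (a * r)
             ≡⟨ solve 6 (λ aᵏ a⁻ᵏ h h⁻¹ a r →
                  (aᵏ :* a⁻ᵏ) :* (h :* h⁻¹) :* (a :* r) := aᵏ :* h :* r :* (a⁻ᵏ :* (a :* h⁻¹)))
                  refl aᵏ a⁻ᵏ h h⁻¹ a r ⟩
           copyWeight * (a⁻ᵏ * (a * h⁻¹)) ∎) ⟩
    copyWeight * (a⁻ᵏ * (a * h⁻¹)) ℚ.+ copyWeight * (edgeDensity * nonRootDensity)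
      ≡⟨ ℚ.*-distribˡ-+ copyWeight (a⁻ᵏ * (a * h⁻¹)) (edgeDensity * nonRootDensity) ⟨
    copyWeight * ratio ∎)
    where
    open ≡-Reasoning
    a = nat (size A)
    r = recip (size X)
    aᵏ = nat (size A) ^ℚ k
    a⁻ᵏ = recip (size A) ^ℚ k
    h = nat (size H)
    h⁻¹ = recip (size H)

  nonRootDensity≡ : nonRootDensity ≡ 1ℚ ℚ.+ ℚ.- (nat k * recip (size H))
  nonRootDensity≡ = begin
    nonRootDensity
      ≡⟨ solve 2 (λ u s → u := (u :+ s) :+ :- s) refl nonRootDensity roots ⟩
    (nonRootDensity ℚ.+ roots) ℚ.+ ℚ.- roots
      ≡⟨ cong₂ (λ x y → x ℚ.+ ℚ.- y)
           (trans (sym (avg-+ nonRootᵢ isRootᵢ)) (trans (avg-cong partition) (avg-const 1ℚ))) roots≡ ⟩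
    1ℚ ℚ.+ ℚ.- (nat k * recip (size H)) ∎
    where
    open ≡-Reasoning
    isRootᵢ : V H → ℚ
    isRootᵢ v = sum λ l → indicator (root G l Fin.≟ v)
    roots = avg isRootᵢ
    roots≡ : roots ≡ nat k * recip (size H)
    roots≡ = trans (avg-sum λ l v → indicator (root G l Fin.≟ v)) (trans
      (sum-cong-≗ λ l → trans (avg-cong λ v → sym (ℚ.*-identityʳ (indicator (root G l Fin.≟ v))))
        (trans (avg-delta (root G l) (λ _ → 1ℚ)) (ℚ.*-identityʳ (recip (size H)))))
      (sum-const k (recip (size H))))
    partition : ∀ v → nonRootᵢ v ℚ.+ isRootᵢ v ≡ 1ℚ
    partition v with isRoot? v
    ... | yes (l , r) = cong (0ℚ ℚ.+_)
      (sum-indicator (λ l → root G l Fin.≟ v) l r λ r′ → root-distinct G (trans r (sym r′)))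
    ... | no ¬r = cong (1ℚ ℚ.+_) (sum-indicator-none (λ l → root G l Fin.≟ v) λ l r → ¬r (l , r))

  Fresh? : ∀ {m} (es : Fin m → Vec (V A) k) e → Dec (∀ j → e ≢ es j)
  Fresh? es e = Fin.all? λ j → ¬? (Vec.≡-dec Fin._≟_ e (es j))

  freshᵢ : ∀ {m} (es : Fin m → Vec (V A) k) → Vec (V A) k → ℚ
  freshᵢ es e = indicator (Fresh? es e)

  module _ {m} (es : Fin m → Vec (V A) k) (edges : ∀ j → IsEdge (es j))
           (distinct : ∀ {i j} → es i ≡ es j → i ≡ j) where

    _≟es_ : ∀ j e → Dec (es j ≡ e)
    j ≟es e = Vec.≡-dec Fin._≟_ (es j) e

    edge-split : ∀ e → edgeᵢ e ≡ sum (λ j → indicator (j ≟es e)) ℚ.+ edgeᵢ e * freshᵢ es e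
    edge-split e with Fin.any? (_≟es e)
    ... | yes (j , refl) = sym (trans
      (cong₂ ℚ._+_ (sum-indicator (_≟es e) j refl (distinct ∘ sym))
        (trans (cong (edgeᵢ e *_) (indicator-no (Fresh? es e) λ fresh → fresh j refl)) (ℚ.*-zeroʳ (edgeᵢ e))))
      (sym (indicator-yes (isEdge? e) (edges j))))
    ... | no none = sym (trans
      (cong₂ ℚ._+_ (sum-indicator-none (_≟es e) λ j eq → none (j , eq))
        (trans (cong (edgeᵢ e *_) (indicator-yes (Fresh? es e) λ j eq → none (j , sym eq))) (ℚ.*-identityʳ (edgeᵢ e))))
      (ℚ.+-identityˡ (edgeᵢ e)))

    -- The sampling step behind the constructors `baseᵖ`, `oldᵖ` and `newᵖ`: `edge-split` separates
    -- the edges with a slot, each of which then contributes by `E-delta`.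
    expand-slots : ∀ f → avg f ≡ baseW * avg (f ∘ base)
      ℚ.+ (sum (λ j → oldCopyW * onCopy f (es j))
      ℚ.+ newCopyW * E (size A) k (λ e → (edgeᵢ e * freshᵢ es e) * onCopy f e))
    expand-slots f = trans (expand-new f) (cong₂ ℚ._+_ (cong (_* avg (f ∘ base)) baseWeight≡baseW) (begin
      newCopyW * E (size A) k (λ e → edgeᵢ e * g e)
        ≡⟨ cong (newCopyW *_) (trans (E-cong k pointwise) (E-+ k oldPart newPart)) ⟩
      newCopyW * (E (size A) k oldPart ℚ.+ E (size A) k newPart)
        ≡⟨ ℚ.*-distribˡ-+ newCopyW (E (size A) k oldPart) (E (size A) k newPart) ⟩
      newCopyW * E (size A) k oldPart ℚ.+ newCopyW * E (size A) k newPart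
        ≡⟨ cong (ℚ._+ newCopyW * E (size A) k newPart) (begin
          newCopyW * E (size A) k oldPart
            ≡⟨ cong (newCopyW *_) (E-sum k λ j e → indicator (j ≟es e) * g e) ⟩
          newCopyW * sum (λ j → E (size A) k λ e → indicator (j ≟es e) * g e)
            ≡⟨ *-distribˡ-sum newCopyW (λ j → E (size A) k λ e → indicator (j ≟es e) * g e) ⟩
          sum (λ j → newCopyW * E (size A) k λ e → indicator (j ≟es e) * g e)
            ≡⟨ sum-cong-≗ (λ j → trans (cong (newCopyW *_) (E-delta k (es j) g))
                 (sym (ℚ.*-assoc newCopyW (recip (size A) ^ℚ k) (g (es j))))) ⟩
          sum (λ j → oldCopyW * g (es j)) ∎) ⟩
      sum (λ j → oldCopyW * g (es j)) ℚ.+ newCopyW * E (size A) k newPart ∎))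
      where
      open ≡-Reasoning
      g = onCopy f
      oldPart newPart : Vec (V A) k → ℚ
      oldPart e = sum λ j → indicator (j ≟es e) * g e
      newPart e = (edgeᵢ e * freshᵢ es e) * g e
      sum-*ʳ : ∀ {m} (x : Fin m → ℚ) y → sum x * y ≡ sum λ j → x j * y
      sum-*ʳ x y = trans (ℚ.*-comm (sum x) y) (trans (*-distribˡ-sum y x) (sum-cong-≗ λ j → ℚ.*-comm y (x j)))
      pointwise : ∀ e → edgeᵢ e * g e ≡ oldPart e ℚ.+ newPart e
      pointwise e = trans (cong (_* g e) (edge-split e))
        (trans (ℚ.*-distribʳ-+ (g e) (sum λ j → indicator (j ≟es e)) (edgeᵢ e * freshᵢ es e))
               (cong (ℚ._+ newPart e) (sum-*ʳ (λ j → indicator (j ≟es e)) (g e))))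

  recipᴬ recipᴴ : ℚ
  recipᴬ = recip (size A)
  recipᴴ = recip (size H)

  ⟨R⟩≡edgeDensity : ⟨ R[x] k , A ⟩ ≡ edgeDensity
  ⟨R⟩≡edgeDensity = trans (⟨⟩-E (R[x] k) A) (E-cong k λ e →
    indicator-cong (A ⊨? R[x] k [ e ]) (isEdge? e) (≡-⇔ (cong IsEdge
      (trans (sym (Vec.tabulate-∘ (eval A e) var)) (Vec.tabulate∘lookup e)))))

  -- Since k ≥ 1, the possibly unbounded factor |A| cancels against |A|^(-k), and only convergent
  -- quantities remain.
  ratio≡ : ratio ≡ (recipᴬ ^ℚ ℕ.pred k) * recipᴴ ℚ.+ edgeDensity * nonRootDensity
  ratio≡ = cong (ℚ._+ edgeDensity * nonRootDensity) (trans
    (sym (ℚ.*-assoc (recipᴬ ^ℚ k) (nat (size A)) recipᴴ))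
    (cong (_* recipᴴ) (power-pred k (size A))))

  copyWeight-nonNeg : 0ℚ ℚ.≤ copyWeight
  copyWeight-nonNeg = 0≤* (0≤* (^-nonNeg k (nat-nonNeg (size A))) (nat-nonNeg (size H))) (recip-nonNeg (size X))

  -- 1 - k / |H| is least for |H| = k + 1, where it equals 1 / (k + 1).
  nonRootDensity-≥ : k < size H → recip (suc k) ℚ.≤ nonRootDensity
  nonRootDensity-≥ k<h = begin
    r
      ≡⟨ solve 2 (λ x y → y := (y :+ x) :+ :- x) refl (nat k * r) r ⟩
    (r ℚ.+ nat k * r) ℚ.+ ℚ.- (nat k * r)
      ≡⟨ cong (ℚ._+ ℚ.- (nat k * r)) (trans
           (solve 2 (λ r x → r :+ x :* r := (con 1ℚ :+ x) :* r) refl r (nat k))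
           (trans (cong (_* r) (sym (nat-suc k))) (nat*recip (suc k)))) ⟩
    1ℚ ℚ.+ ℚ.- (nat k * r)
      ≤⟨ ℚ.+-monoʳ-≤ 1ℚ (ℚ.neg-antimono-≤ (ℚ.*-monoˡ-≤-nonNeg (nat k) {{ℚ.nonNegative (nat-nonNeg k)}}
           (recip-antitone k<h))) ⟩
    1ℚ ℚ.+ ℚ.- (nat k * recipᴴ)
      ≡⟨ nonRootDensity≡ ⟨
    nonRootDensity ∎
    where
    open ℚ.≤-Reasoning
    r = recip (suc k)

  ratio-≥ : ∀ {ε} → 0ℚ ℚ.≤ ε → ε ℚ.≤ edgeDensity → k < size H → ε * recip (suc k) ℚ.≤ ratio
  ratio-≥ {ε} 0≤ε ε≤d k<h = begin
    ε * recip (suc k)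
      ≤⟨ *-mono-≤ 0≤ε (ℚ.≤-trans (recip-nonNeg (suc k)) u≥) ε≤d u≥ ⟩
    edgeDensity * nonRootDensity
      ≡⟨ ℚ.+-identityˡ (edgeDensity * nonRootDensity) ⟨
    0ℚ ℚ.+ edgeDensity * nonRootDensity
      ≤⟨ ℚ.+-monoˡ-≤ (edgeDensity * nonRootDensity)
           (0≤* (^-nonNeg k (recip-nonNeg (size A))) (0≤* (nat-nonNeg (size A)) (recip-nonNeg (size H)))) ⟩
    ratio ∎
    where
    open ℚ.≤-Reasoning
    u≥ = nonRootDensity-≥ k<h

  average : ∀ p → (Vec (V X) p → ℚ) → ℚ
  average = E (size X)

  -- `E` averages over the head outermost while patterns sample it last, so averages are
  -- interchanged.
  average-suc : ∀ p (F : Vec (V X) (suc p) → ℚ) → average p (λ q → avg λ x → F (x ∷ q)) ≡ average (suc p) F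
  average-suc p F = E-avg p λ q x → F (x ∷ q)

-- Convergent sequences of rationals

Eventually : (ℕ → Set) → Set
Eventually P = ∃ λ N → ∀ n → N ≤ n → P n

Eventually-× : ∀ {P Q : ℕ → Set} → Eventually P → Eventually Q → Eventually λ n → P n × Q n
Eventually-× (N , p) (M , q) = N ⊔ M , λ n le → p n (ℕ.m⊔n≤o⇒m≤o N M le) , q n (ℕ.m⊔n≤o⇒n≤o N M le)

Eventually-map : ∀ {P Q : ℕ → Set} → (∀ n → P n → Q n) → Eventually P → Eventually Q
Eventually-map f (N , p) = N , λ n le → f n (p n le)

always : ∀ {P : ℕ → Set} → (∀ n → P n) → Eventually P
always p = 0 , λ n _ → p n

half+half : ∀ ε → ½ * ε ℚ.+ ½ * ε ≡ ε
half+half ε = trans (sym (ℚ.*-distribʳ-+ ε ½ ½)) (ℚ.*-identityˡ ε)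

half-pos : ∀ {ε} → 0ℚ ℚ.< ε → 0ℚ ℚ.< ½ * ε
half-pos {ε} 0<ε = subst (ℚ._< ½ * ε) (ℚ.*-zeroʳ ½) (ℚ.*-monoʳ-<-pos ½ 0<ε)

scale-below : ∀ {ε B} → 0ℚ ℚ.< ε → 0ℚ ℚ.≤ B → ∃ λ δ → 0ℚ ℚ.< δ × B * δ ℚ.< ε
scale-below {ε} {B} 0<ε 0≤B = δ , 0<δ , subst (B * δ ℚ.<_) total
  (subst (ℚ._< B * δ ℚ.+ δ) (ℚ.+-identityʳ (B * δ)) (ℚ.+-monoʳ-< (B * δ) 0<δ))
  where
  -- `B` may be 0, hence the division by `B + 1`.
  D = B ℚ.+ 1ℚ
  instance
    D-pos : ℚ.Positive D
    D-pos = ℚ.nonNeg+pos⇒pos B {{ℚ.nonNegative 0≤B}} 1ℚ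
    D≢0 : ℚ.NonZero D
    D≢0 = ℚ.pos⇒nonZero D
    1/D-pos : ℚ.Positive (ℚ.1/ D)
    1/D-pos = ℚ.1/pos⇒pos D
  δ = ℚ.1/ D * ε
  0<δ : 0ℚ ℚ.< δ
  0<δ = subst (ℚ._< δ) (ℚ.*-zeroʳ (ℚ.1/ D)) (ℚ.*-monoʳ-<-pos (ℚ.1/ D) 0<ε)
  total : B * δ ℚ.+ δ ≡ ε
  total = trans (solve 3 (λ b d e → b :* (d :* e) :+ d :* e := ((b :+ con 1ℚ) :* d) :* e) refl B (ℚ.1/ D) ε)
    (trans (cong (_* ε) (ℚ.*-inverseʳ D)) (ℚ.*-identityˡ ε))

-- Records rather than functions, so that the sequence can be inferred.
record Converges (x : ℕ → ℚ) : Set where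
  constructor converges
  field cauchy : Convergent x
open Converges

record Bounded (x : ℕ → ℚ) : Set where
  constructor bounded
  field
    bound         : ℚ
    bound-nonNeg  : 0ℚ ℚ.≤ bound
    bound-bounds  : Eventually λ n → ℚ.∣ x n ∣ ℚ.≤ bound

record Null (x : ℕ → ℚ) : Set where
  constructor null
  field vanishes : ∀ ε → 0ℚ ℚ.< ε → Eventually λ n → ℚ.∣ x n ∣ ℚ.< ε
open Null

convergent⇒bounded : ∀ {x} → Converges x → Bounded x
convergent⇒bounded {x} cx = let (N , h) = cauchy cx 1ℚ (ℚ.positive⁻¹ 1ℚ) in
  bounded (1ℚ ℚ.+ ℚ.∣ x N ∣) (0≤+ (ℚ.nonNegative⁻¹ 1ℚ) (ℚ.0≤∣p∣ (x N))) (N , λ n le →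
    ℚ.≤-trans (ℚ.≤-reflexive (cong ℚ.∣_∣ (solve 2 (λ a b → a := (a :+ :- b) :+ b) refl (x n) (x N))))
    (ℚ.≤-trans (ℚ.∣p+q∣≤∣p∣+∣q∣ (x n ℚ.- x N) (x N))
      (ℚ.+-monoˡ-≤ ℚ.∣ x N ∣ (ℚ.<⇒≤ (h n N le ℕ.≤-refl)))))

-- The Cauchy criterion passes to a sequence whose differences are controlled by those of two Cauchy
-- sequences. Sums, products, inverses and eventual equality are instances.
convergent-lipschitz : ∀ {x y z} B → 0ℚ ℚ.≤ B → ∀ N →
  (∀ m n → N ≤ m → N ≤ n → ℚ.∣ z m ℚ.- z n ∣ ℚ.≤ B * (ℚ.∣ x m ℚ.- x n ∣ ℚ.+ ℚ.∣ y m ℚ.- y n ∣)) →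
  Converges x → Converges y → Converges z
convergent-lipschitz {x} {y} {z} B 0≤B N lip cx cy .cauchy ε 0<ε =
  let (δ , 0<δ , Bδ<ε) = scale-below 0<ε 0≤B
      (N₁ , hx) = cauchy cx (½ * δ) (half-pos 0<δ)
      (N₂ , hy) = cauchy cy (½ * δ) (half-pos 0<δ)
      le₀ = λ {i} (le : N ⊔ (N₁ ⊔ N₂) ≤ i) → ℕ.m⊔n≤o⇒m≤o N (N₁ ⊔ N₂) le
      le₁ = λ {i} (le : N ⊔ (N₁ ⊔ N₂) ≤ i) → ℕ.m⊔n≤o⇒m≤o N₁ N₂ (ℕ.m⊔n≤o⇒n≤o N (N₁ ⊔ N₂) le)
      le₂ = λ {i} (le : N ⊔ (N₁ ⊔ N₂) ≤ i) → ℕ.m⊔n≤o⇒n≤o N₁ N₂ (ℕ.m⊔n≤o⇒n≤o N (N₁ ⊔ N₂) le)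
  in N ⊔ (N₁ ⊔ N₂) , λ m n m≥ n≥ →
    ℚ.≤-<-trans (lip m n (le₀ m≥) (le₀ n≥)) (ℚ.≤-<-trans
      (ℚ.*-monoˡ-≤-nonNeg B {{ℚ.nonNegative 0≤B}}
        (ℚ.≤-trans (ℚ.<⇒≤ (ℚ.+-mono-< (hx m n (le₁ m≥) (le₁ n≥)) (hy m n (le₂ m≥) (le₂ n≥))))
                   (ℚ.≤-reflexive (half+half δ))))
      Bδ<ε)

convergent-cong : ∀ {x y} → Eventually (λ n → x n ≡ y n) → Converges x → Converges y
convergent-cong {x} {y} (N , eq) cx = convergent-lipschitz {x} {x} 1ℚ (ℚ.nonNegative⁻¹ 1ℚ) N
  (λ m n m≥ n≥ → ℚ.≤-trans
    (ℚ.≤-reflexive (cong ℚ.∣_∣ (sym (cong₂ ℚ._-_ (eq m m≥) (eq n n≥)))))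
    (ℚ.≤-trans (ℚ.≤-reflexive (sym (ℚ.+-identityʳ _)))
      (ℚ.≤-trans (ℚ.+-monoʳ-≤ ℚ.∣ x m ℚ.- x n ∣ (ℚ.0≤∣p∣ (x m ℚ.- x n)))
        (ℚ.≤-reflexive (sym (ℚ.*-identityˡ _)))))) cx cx

convergent-≗ : ∀ {x y} → (∀ n → x n ≡ y n) → Converges x → Converges y
convergent-≗ eq = convergent-cong (always eq)

convergent-const : ∀ q → Converges λ _ → q
convergent-const q .cauchy ε 0<ε = 0 , λ _ _ _ _ → subst (ℚ._< ε) (sym (cong ℚ.∣_∣ (ℚ.+-inverseʳ q))) 0<ε

module _ {x y : ℕ → ℚ} where

  convergent-+ : Converges x → Converges y → Converges λ n → x n ℚ.+ y n
  convergent-+ = convergent-lipschitz 1ℚ (ℚ.nonNegative⁻¹ 1ℚ) 0 λ m n _ _ → ℚ.≤-trans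
    (ℚ.≤-reflexive (cong ℚ.∣_∣ (solve 4 (λ a b c d → (a :+ b) :+ :- (c :+ d) := (a :+ :- c) :+ (b :+ :- d)) refl
      (x m) (y m) (x n) (y n))))
    (ℚ.≤-trans (ℚ.∣p+q∣≤∣p∣+∣q∣ (x m ℚ.- x n) (y m ℚ.- y n)) (ℚ.≤-reflexive (sym (ℚ.*-identityˡ _))))

  convergent-* : Converges x → Converges y → Converges λ n → x n * y n
  convergent-* cx cy =
    let bounded B 0≤B (N₁ , hx) = convergent⇒bounded cx
        bounded C 0≤C (N₂ , hy) = convergent⇒bounded cy
    in convergent-lipschitz (C ℚ.+ B) (0≤+ 0≤C 0≤B) (N₁ ⊔ N₂) (λ m n m≥ n≥ →
      let dx = x m ℚ.- x n
          dy = y m ℚ.- y n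
          bx = hx m (ℕ.m⊔n≤o⇒m≤o N₁ N₂ m≥)
          by = hy n (ℕ.m⊔n≤o⇒n≤o N₁ N₂ n≥)
      in ℚ.≤-trans
        (ℚ.≤-reflexive (cong ℚ.∣_∣ (solve 4 (λ a b c d →
          a :* b :+ :- (c :* d) := d :* (a :+ :- c) :+ a :* (b :+ :- d)) refl (x m) (y m) (x n) (y n))))
        (ℚ.≤-trans (ℚ.∣p+q∣≤∣p∣+∣q∣ (y n * dx) (x m * dy))
        (ℚ.≤-trans (ℚ.≤-reflexive (cong₂ ℚ._+_ (ℚ.∣p*q∣≡∣p∣*∣q∣ (y n) dx) (ℚ.∣p*q∣≡∣p∣*∣q∣ (x m) dy)))
        (ℚ.≤-trans (ℚ.+-mono-≤ (weaken by 0≤B (ℚ.0≤∣p∣ dx)) (weaken′ bx 0≤C (ℚ.0≤∣p∣ dy)))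
          (ℚ.≤-reflexive (sym (ℚ.*-distribˡ-+ (C ℚ.+ B) ℚ.∣ dx ∣ ℚ.∣ dy ∣))))))) cx cy
    where
    weaken : ∀ {a B C d} → a ℚ.≤ C → 0ℚ ℚ.≤ B → 0ℚ ℚ.≤ d → a * d ℚ.≤ (C ℚ.+ B) * d
    weaken {a} {B} {C} {d} a≤C 0≤B 0≤d = ℚ.*-monoʳ-≤-nonNeg d {{ℚ.nonNegative 0≤d}}
      (ℚ.≤-trans (ℚ.≤-reflexive (sym (ℚ.+-identityʳ a))) (ℚ.+-mono-≤ a≤C 0≤B))
    weaken′ : ∀ {a B C d} → a ℚ.≤ B → 0ℚ ℚ.≤ C → 0ℚ ℚ.≤ d → a * d ℚ.≤ (C ℚ.+ B) * d
    weaken′ {a} {B} {C} {d} a≤B 0≤C 0≤d = ℚ.*-monoʳ-≤-nonNeg d {{ℚ.nonNegative 0≤d}}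
      (ℚ.≤-trans (ℚ.≤-reflexive (sym (ℚ.+-identityˡ a))) (ℚ.+-mono-≤ 0≤C a≤B))

convergent-neg : ∀ {x} → Converges x → Converges λ n → ℚ.- x n
convergent-neg {x} cx = convergent-≗ (λ n → solve 1 (λ a → con (ℚ.- 1ℚ) :* a := :- a) refl (x n))
  (convergent-* (convergent-const (ℚ.- 1ℚ)) cx)

convergent-sum : ∀ {x : Fin m → ℕ → ℚ} → (∀ j → Converges (x j)) → Converges λ n → sum λ j → x j n
convergent-sum {zero}  cx = convergent-const 0ℚ
convergent-sum {suc m} cx = convergent-+ (cx zero) (convergent-sum (cx ∘ suc))

convergent-^ : ∀ {x} l → Converges x → Converges λ n → x n ^ℚ l
convergent-^ zero    cx = convergent-const 1ℚ
convergent-^ (suc l) cx = convergent-* cx (convergent-^ l cx)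

-- If y x = 1 and y′ x′ = 1, then y - y′ = y y′ (x′ - x), so `y` varies at most `B * B` times as
-- much as `x`. Boundedness of `y` expresses that `x` stays away from 0.
convergent-inverse : ∀ {x y} → Bounded y → Eventually (λ n → y n * x n ≡ 1ℚ) → Converges x → Converges y
convergent-inverse {x} {y} (bounded B 0≤B hB) inv cx =
  let (N , h) = Eventually-× hB inv
  in convergent-lipschitz {x} {x} (B * B) (0≤* 0≤B 0≤B) N (λ m n m≥ n≥ →
    let (bm , im) = h m m≥
        (bn , in′) = h n n≥
        d = x n ℚ.- x m
    in ℚ.≤-trans (ℚ.≤-reflexive (cong ℚ.∣_∣ (identity (x m) (x n) (y m) (y n) im in′)))
      (ℚ.≤-trans (ℚ.≤-reflexive (trans (ℚ.∣p*q∣≡∣p∣*∣q∣ (y m * y n) d)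
        (cong₂ _*_ (ℚ.∣p*q∣≡∣p∣*∣q∣ (y m) (y n)) (abs-swap (x n) (x m)))))
      (*-mono-≤ (0≤* (ℚ.0≤∣p∣ (y m)) (ℚ.0≤∣p∣ (y n))) (0≤+ (ℚ.0≤∣p∣ (x m ℚ.- x n)) (ℚ.0≤∣p∣ (x m ℚ.- x n)))
        (*-mono-≤ (ℚ.0≤∣p∣ (y m)) 0≤B bm bn)
        (ℚ.≤-trans (ℚ.≤-reflexive (sym (ℚ.+-identityʳ ℚ.∣ x m ℚ.- x n ∣)))
          (ℚ.+-monoʳ-≤ ℚ.∣ x m ℚ.- x n ∣ (ℚ.0≤∣p∣ (x m ℚ.- x n))))))) cx cx
  where
  abs-swap : ∀ a b → ℚ.∣ a ℚ.- b ∣ ≡ ℚ.∣ b ℚ.- a ∣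
  abs-swap a b = trans (cong ℚ.∣_∣ (solve 2 (λ a b → a :+ :- b := :- (b :+ :- a)) refl a b)) (ℚ.∣-p∣≡∣p∣ (b ℚ.- a))
  identity : ∀ x x′ y y′ → y * x ≡ 1ℚ → y′ * x′ ≡ 1ℚ → y ℚ.- y′ ≡ (y * y′) * (x′ ℚ.- x)
  identity x x′ y y′ eq eq′ = begin
    y ℚ.- y′                                      ≡⟨ solve 2 (λ y y′ → y :+ :- y′ := y :* con 1ℚ :+ :- (y′ :* con 1ℚ)) refl y y′ ⟩
    y * 1ℚ ℚ.- y′ * 1ℚ                        ≡⟨ cong₂ (λ s t → y * s ℚ.- y′ * t) eq′ eq ⟨
    y * (y′ * x′) ℚ.- y′ * (y * x)        ≡⟨ solve 4 (λ x x′ y y′ → y :* (y′ :* x′) :+ :- (y′ :* (y :* x)) := (y :* y′) :* (x′ :+ :- x)) refl x x′ y y′ ⟩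
    (y * y′) * (x′ ℚ.- x)                     ∎
    where open ≡-Reasoning

null⇒convergent : ∀ {x} → Null x → Converges x
null⇒convergent {x} nx .cauchy ε 0<ε = let (N , h) = vanishes nx (½ * ε) (half-pos 0<ε) in
  N , λ m n m≥ n≥ → ℚ.≤-<-trans (ℚ.∣p-q∣≤∣p∣+∣q∣ (x m) (x n))
    (subst (ℚ.∣ x m ∣ ℚ.+ ℚ.∣ x n ∣ ℚ.<_) (half+half ε) (ℚ.+-mono-< (h m m≥) (h n n≥)))

bounded-*-null : ∀ {x y} → Bounded x → Null y → Null λ n → x n * y n
bounded-*-null {x} {y} (bounded B 0≤B hB) ny .vanishes ε 0<ε =
  let (δ , 0<δ , Bδ<ε) = scale-below 0<ε 0≤B
  in Eventually-map (λ n (b , s) → ℚ.≤-<-trans (ℚ.≤-reflexive (ℚ.∣p*q∣≡∣p∣*∣q∣ (x n) (y n)))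
       (ℚ.≤-<-trans (*-mono-≤ (ℚ.0≤∣p∣ (x n)) (ℚ.<⇒≤ 0<δ) b (ℚ.<⇒≤ s)) Bδ<ε))
     (Eventually-× hB (vanishes ny δ 0<δ))

null-*-bounded : ∀ {x y} → Null x → Bounded y → Null λ n → x n * y n
null-*-bounded {x} {y} nx b .vanishes ε 0<ε = Eventually-map
  (λ n → subst (λ z → ℚ.∣ z ∣ ℚ.< ε) (ℚ.*-comm (y n) (x n))) (vanishes (bounded-*-null b nx) ε 0<ε)

-- Patterns

-- How a tuple of vertices of A * G is sampled, the last element first: each
-- element is a base vertex, or lies in a copy met before, or in a new copy.
data Pattern (k : ℕ) : (n N m M : ℕ) → Set where
  nilᵖ  : Pattern k 0 0 0 0
  baseᵖ : ∀ {n N m M} → Pattern k n N m M → Pattern k (suc n) (suc N) m M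
  oldᵖ  : ∀ {n N m M} → Fin m → Pattern k n N m M → Pattern k (suc n) N m (suc M)
  newᵖ  : ∀ {n N m M} → Pattern k n N m M → Pattern k (suc n) (k + N) (suc m) (suc M)

NoOld : ∀ {k n N m M} → Pattern k n N m M → Set
NoOld nilᵖ       = ⊤
NoOld (baseᵖ P)  = NoOld P
NoOld (oldᵖ j P) = ⊥
NoOld (newᵖ P)   = NoOld P

noOld? : ∀ {k n N m M} (P : Pattern k n N m M) → Dec (NoOld P)
noOld? nilᵖ       = yes tt
noOld? (baseᵖ P)  = noOld? P
noOld? (oldᵖ j P) = no λ ()
noOld? (newᵖ P)   = noOld? P

prod : (Fin m → ℚ) → ℚ
prod {zero}  f = 1ℚ
prod {suc m} f = f zero * prod (f ∘ suc)

prod-cong : {f g : Fin m → ℚ} → (∀ j → f j ≡ g j) → prod f ≡ prod g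
prod-cong {zero}  h = refl
prod-cong {suc m} h = cong₂ _*_ (h zero) (prod-cong (h ∘ suc))

indicator-all : {P : Fin m → Set} (P? : ∀ j → Dec (P j)) (all? : Dec (∀ j → P j)) →
                indicator all? ≡ prod λ j → indicator (P? j)
indicator-all {zero}  P? all? = indicator-yes all? λ ()
indicator-all {suc m} P? all? = trans
  (indicator-× (P? zero) (Fin.all? (P? ∘ suc)) all?
    (mk⇔ (λ h → h zero , h ∘ suc) (λ { (p , h) zero → p ; (p , h) (suc j) → h j })))
  (cong (indicator (P? zero) *_) (indicator-all (P? ∘ suc) (Fin.all? (P? ∘ suc))))

module Patterns (σ : Signature) (k : ℕ) .{{_ : NonZero k}} where

  open Decomposition σ k public

  private variable
    N M : ℕ

  kinds : Pattern k n N m M → Vec (Kind N m M) n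
  kinds nilᵖ       = []
  kinds (baseᵖ P)  = inj₁ zero ∷ Vec.map liftBase (kinds P)
  kinds (oldᵖ j P) = inj₂ (j , zero) ∷ Vec.map liftSlot (kinds P)
  kinds (newᵖ P)   = inj₂ (zero , zero) ∷ Vec.map (mapKind (k ↑ʳ_) suc suc) (kinds P)

  edges : Pattern k n N m M → Edges N m
  edges nilᵖ       = λ ()
  edges (baseᵖ P)  = Vec.map suc ∘ edges P
  edges (oldᵖ j P) = edges P
  edges (newᵖ P)   = addEdge (edges P)

  -- The side conditions of a pattern are guarded formulas too, so they can be absorbed into the
  -- formulas whose probabilities converge.
  validᴬ : Pattern k n N m M → Guarded (σ ∪R k) 0 N
  validᴬ nilᵖ       = ⊤ᵍ
  validᴬ (baseᵖ P)  = substᵍ (var ∘ suc) (validᴬ P)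
  validᴬ (oldᵖ j P) = validᴬ P
  validᴬ (newᵖ P)   = andᵍ (andᵍ (edgeᵍ _) (freshᵍ (edges P))) (substᵍ (var ∘ (k ↑ʳ_)) (validᴬ P))

  validᴴ : Pattern k n N m M → Guarded σ k M
  validᴴ nilᵖ       = ⊤ᵍ
  validᴴ (baseᵖ P)  = validᴴ P
  validᴴ (oldᵖ j P) = andᵍ nonRootᵍ (substᵍ (var ∘ suc) (validᴴ P))
  validᴴ (newᵖ P)   = andᵍ nonRootᵍ (substᵍ (var ∘ suc) (validᴴ P))

  -- For a slot with one variable, all variables of its formula are merged.
  slotᵍ : Guarded σ k M → Guarded σ k 1
  slotᵍ β = andᵍ nonRootᵍ (substᵍ (λ _ → var zero) β)

  -- All copies are copies of the same gadget, so the slot formulas and the sentence combine into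
  -- one formula of `G`, with a free variable for each sampled gadget vertex.
  jointᵍ : Pattern k n N m M → (Fin m → Guarded σ k M) → Guarded σ k 0 → Guarded σ k M
  jointᵍ {m = m} P β γ = andᵍ (validᴴ P) (andᵍ (allᵍ m β) (substᵍ (λ ()) γ))

  -- Averages along a pattern

  module PatternSampling (A : BaseStructure σ k) (G : Gadget σ k) where

    open Correctness A G public
    open Product A G using (base; copy; IsEdge; NonRoot)
    open Sampling A G public hiding (H)

    Vᴬ : Pattern k n N m M → Vec (V A) N → ℚ
    Vᴬ P ρ = indicator (A ⊩? validᴬ P [ ρ ])

    Vᴴ : Pattern k n N m M → Vec (V H) M → ℚ
    Vᴴ P w = indicator (H ⊩? validᴴ P [ w ])

    -- A single tuple `w` serves all slots, because each of its entries is read in one slot only.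
    points : Pattern k n N m M → Vec (V A) N → Vec (V H) M → Vec (V X) n
    points P ρ w = Vec.map (point ρ (λ _ → w) (edges P)) (kinds P)

    weight : Pattern k n N m M → ℚ
    weight nilᵖ       = 1ℚ
    weight (baseᵖ P)  = baseW * weight P
    weight (oldᵖ j P) = oldCopyW * weight P
    weight (newᵖ P)   = newCopyW * weight P

    mean : Pattern k n N m M → (Vec (V A) N → Vec (V H) M → ℚ) → ℚ
    mean {N = N} {M = M} P f = E (size A) N λ ρ → E (size H) M λ w → Vᴬ P ρ * (Vᴴ P w * f ρ w)

    -- The contribution of the pattern to the average of F over all tuples.
    term : Pattern k n N m M → (Vec (V X) n → ℚ) → ℚ
    term P F = weight P * mean P λ ρ w → F (points P ρ w)

    slotEdges : Pattern k n N m M → Vec (V A) N → Fin m → Vec (V A) k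
    slotEdges P ρ j = edge ρ (edges P j)

    module _ (P : Pattern k n N m M) where

      points-base : ∀ {a ρ w} → points (baseᵖ P) (a ∷ ρ) w ≡ base a ∷ points P ρ w
      points-base = cong (_ ∷_) (trans (sym (Vec.map-∘ _ _ (kinds P))) (Vec.map-cong
        (point-map suc id id (λ _ → refl) (λ j → edge-liftBase (edges P j)) (λ _ _ → refl)) (kinds P)))

      points-old : ∀ {j ρ v w} → points (oldᵖ j P) ρ (v ∷ w) ≡ copy (slotEdges P ρ j) v ∷ points P ρ w
      points-old = cong (_ ∷_) (trans (sym (Vec.map-∘ _ _ (kinds P))) (Vec.map-cong
        (point-map id id suc (λ _ → refl) (λ _ → refl) (λ _ _ → refl)) (kinds P)))

      points-new : ∀ {e ρ v w} → points (newᵖ P) (e Vec.++ ρ) (v ∷ w) ≡ copy e v ∷ points P ρ w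
      points-new {e} {ρ} = cong₂ _∷_ (cong (λ e → copy e _) (edge-new e))
        (trans (sym (Vec.map-∘ _ _ (kinds P))) (Vec.map-cong
          (point-map (k ↑ʳ_) suc suc (Vec.lookup-++ʳ e ρ) (λ j → edge-old e (edges P j)) (λ _ _ → refl)) (kinds P)))

      Vᴬ-base : ∀ {a ρ} → Vᴬ (baseᵖ P) (a ∷ ρ) ≡ Vᴬ P ρ
      Vᴬ-base {a} {ρ} = indicator-cong (A ⊩? validᴬ (baseᵖ P) [ a ∷ ρ ]) (A ⊩? validᴬ P [ ρ ])
        (⊩-subst A (λ _ → refl) (validᴬ P))

      ⊩-validᴬ-new : ∀ {e ρ} → (A ⊩ validᴬ (newᵖ P) [ e Vec.++ ρ ]) ⇔
                     ((IsEdge e × Fresh e ρ (edges P)) × A ⊩ validᴬ P [ ρ ])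
      ⊩-validᴬ-new {e} {ρ} = ×-⇔ (×-⇔ (⊩-edge e) (⊩-fresh (edges P) e)) (⊩-subst A (Vec.lookup-++ʳ e ρ) (validᴬ P))

      Vᴬ-new : ∀ {e ρ} → Vᴬ (newᵖ P) (e Vec.++ ρ) ≡ (edgeᵢ e * freshᵢ (slotEdges P ρ) e) * Vᴬ P ρ
      Vᴬ-new {e} {ρ} = trans
        (indicator-× (isEdge? e ×-dec Fresh? (slotEdges P ρ) e) (A ⊩? validᴬ P [ ρ ])
          (A ⊩? validᴬ (newᵖ P) [ e Vec.++ ρ ]) ⊩-validᴬ-new)
        (cong (_* Vᴬ P ρ) (indicator-× (isEdge? e) (Fresh? (slotEdges P ρ) e)
          (isEdge? e ×-dec Fresh? (slotEdges P ρ) e) ⇔.refl))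

      ⊩-validᴴ-cons : ∀ {v w} → (H ⊩ andᵍ nonRootᵍ (substᵍ (var ∘ suc) (validᴴ P)) [ v ∷ w ]) ⇔
                      (NonRoot v × H ⊩ validᴴ P [ w ])
      ⊩-validᴴ-cons {w = w} = ×-⇔ (⊩-nonRoot {w = w}) (⊩-subst H (λ _ → refl) (validᴴ P))

      Vᴴ-cons : ∀ {v w} → indicator (H ⊩? andᵍ nonRootᵍ (substᵍ (var ∘ suc) (validᴴ P)) [ v ∷ w ]) ≡
                nonRootᵢ v * Vᴴ P w
      Vᴴ-cons {v} {w} = indicator-× (nonRoot? v) (H ⊩? validᴴ P [ w ])
        (H ⊩? andᵍ nonRootᵍ (substᵍ (var ∘ suc) (validᴴ P)) [ v ∷ w ]) ⊩-validᴴ-cons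

    valid : (P : Pattern k n N m M) (ρ : Vec (V A) N) → A ⊩ validᴬ P [ ρ ] → Valid ρ (edges P)
    valid nilᵖ       ρ       v = record { isEdge = λ () ; distinct = λ { {()} } }
    valid (baseᵖ P)  (a ∷ ρ) v = Valid-liftBase (valid P ρ (to (⊩-subst A (λ _ → refl) (validᴬ P)) v))
    valid (oldᵖ j P) ρ       v = valid P ρ v
    valid (newᵖ P)   ρ       v with Vec.splitAt k ρ
    ... | e , ρ′ , refl = let ((p , fresh) , v′) = to (⊩-validᴬ-new P {e} {ρ′}) v
                          in Valid-addEdge (valid P ρ′ v′) p fresh

    proper : (P : Pattern k n N m M) (w : Vec (V H) M) → H ⊩ validᴴ P [ w ] →
             VecAll.All (Proper λ _ → w) (kinds P)
    proper nilᵖ       w       s = []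
    proper (baseᵖ P)  w       s = tt ∷ VecAll.map⁺ (VecAll.map (λ {κ} →
      proper-map suc id id (λ _ _ → refl) κ) (proper P w s))
    proper (oldᵖ j P) (v ∷ w) s = let (nr , s′) = to (⊩-validᴴ-cons P {v} {w}) s in
      nr ∷ VecAll.map⁺ (VecAll.map (λ {κ} → proper-map id id suc (λ _ _ → refl) κ) (proper P w s′))
    proper (newᵖ P)   (v ∷ w) s = let (nr , s′) = to (⊩-validᴴ-cons P {v} {w}) s in
      nr ∷ VecAll.map⁺ (VecAll.map (λ {κ} → proper-map (k ↑ʳ_) suc suc (λ _ _ → refl) κ) (proper P w s′))

    -- Slot j may use the tuple W j instead of w if they agree on the variables of slot j.
    Agrees : Vec (V H) M → Slots m M → Kind N m M → Set
    Agrees w W (inj₁ a)       = ⊤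
    Agrees w W (inj₂ (j , x)) = lookup (W j) x ≡ lookup w x

    pattern-names : (P : Pattern k n N m M) {ρ : Vec (V A) N} {w : Vec (V H) M} {W : Slots m M} →
                    VecAll.All (Agrees w W) (kinds P) → A ⊩ validᴬ P [ ρ ] → H ⊩ validᴴ P [ w ] →
                    Names (edges P) ρ W (kinds P) (points P ρ w)
    pattern-names P {ρ} {w} {W} agrees vᴬ vᴴ = record
      { valid = valid P ρ vᴬ ; proper = same-proper agrees (proper P w vᴴ) ; names = same-points agrees }
      where
      same-proper : ∀ {l} {κs : Vec (Kind _ _ _) l} → VecAll.All (Agrees w W) κs →
                    VecAll.All (Proper λ _ → w) κs → VecAll.All (Proper W) κs
      same-proper {κs = []}               _        _        = []
      same-proper {κs = inj₁ a ∷ κs}       (_ ∷ as) (p ∷ ps) = p ∷ same-proper as ps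
      same-proper {κs = inj₂ (j , x) ∷ κs} (a ∷ as) (p ∷ ps) = subst NonRoot (sym a) p ∷ same-proper as ps
      same-points : ∀ {l} {κs : Vec (Kind _ _ _) l} → VecAll.All (Agrees w W) κs →
                    Vec.map (point ρ W (edges P)) κs ≡ Vec.map (point ρ (λ _ → w) (edges P)) κs
      same-points {κs = []}               _        = refl
      same-points {κs = inj₁ a ∷ κs}       (_ ∷ as) = cong (_ ∷_) (same-points as)
      same-points {κs = inj₂ (j , x) ∷ κs} (a ∷ as) = cong₂ _∷_ (cong (copy _) a) (same-points as)

    mean-cong : (P : Pattern k n N m M) {f g : Vec (V A) N → Vec (V H) M → ℚ} →
                (∀ ρ w → A ⊩ validᴬ P [ ρ ] → H ⊩ validᴴ P [ w ] → f ρ w ≡ g ρ w) → mean P f ≡ mean P g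
    mean-cong P h = E-cong _ λ ρ → E-cong _ λ w →
      under-indicator (A ⊩? validᴬ P [ ρ ]) λ vᴬ → under-indicator (H ⊩? validᴴ P [ w ]) λ vᴴ → h ρ w vᴬ vᴴ

    mean-+ : (P : Pattern k n N m M) (f g : Vec (V A) N → Vec (V H) M → ℚ) →
             mean P (λ ρ w → f ρ w ℚ.+ g ρ w) ≡ mean P f ℚ.+ mean P g
    mean-+ {N = N} {M = M} P f g = trans
      (E-cong N λ ρ → trans
        (E-cong M λ w → solve 4 (λ x y f g → x :* (y :* (f :+ g)) := x :* (y :* f) :+ x :* (y :* g)) refl
          (Vᴬ P ρ) (Vᴴ P w) (f ρ w) (g ρ w))
        (E-+ M (λ w → Vᴬ P ρ * (Vᴴ P w * f ρ w)) (λ w → Vᴬ P ρ * (Vᴴ P w * g ρ w))))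
      (E-+ N (λ ρ → E (size H) M λ w → Vᴬ P ρ * (Vᴴ P w * f ρ w))
             (λ ρ → E (size H) M λ w → Vᴬ P ρ * (Vᴴ P w * g ρ w)))

    mean-* : (P : Pattern k n N m M) (x : ℚ) (f : Vec (V A) N → Vec (V H) M → ℚ) →
             mean P (λ ρ w → x * f ρ w) ≡ x * mean P f
    mean-* {N = N} {M = M} P x f = trans
      (E-cong N λ ρ → trans
        (E-cong M λ w → solve 4 (λ a b x f → a :* (b :* (x :* f)) := x :* (a :* (b :* f))) refl
          (Vᴬ P ρ) (Vᴴ P w) x (f ρ w))
        (E-* M x (λ w → Vᴬ P ρ * (Vᴴ P w * f ρ w))))
      (E-* N x (λ ρ → E (size H) M λ w → Vᴬ P ρ * (Vᴴ P w * f ρ w)))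

    mean-sum : (P : Pattern k n N m M) {l : ℕ} (f : Fin l → Vec (V A) N → Vec (V H) M → ℚ) →
               mean P (λ ρ w → sum λ j → f j ρ w) ≡ sum λ j → mean P (f j)
    mean-sum P {zero}  f = trans (mean-cong P λ _ _ _ _ → sym (ℚ.*-zeroˡ 0ℚ))
      (trans (mean-* P 0ℚ (λ _ _ → 0ℚ)) (ℚ.*-zeroˡ (mean P λ _ _ → 0ℚ)))
    mean-sum P {suc l} f = trans (mean-+ P (f zero) (λ ρ w → sum λ j → f (suc j) ρ w))
      (cong (mean P (f zero) ℚ.+_) (mean-sum P (f ∘ suc)))

    module _ (P : Pattern k n N m M) (F : Vec (V X) (suc n) → ℚ) where

      mean-base : mean (baseᵖ P) (λ ρ w → F (points (baseᵖ P) ρ w)) ≡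
                  mean P λ ρ w → avg λ a → F (base a ∷ points P ρ w)
      mean-base = sym (trans
        (E-cong N λ ρ → trans
          (E-cong M λ w → trans
            (cong (Vᴬ P ρ *_) (sym (avg-* (Vᴴ P w) (λ a → F (base a ∷ points P ρ w)))))
            (trans (sym (avg-* (Vᴬ P ρ) (λ a → Vᴴ P w * F (base a ∷ points P ρ w))))
              (avg-cong λ a → cong₂ (λ x y → x * (Vᴴ P w * F y))
                (sym (Vᴬ-base P {a} {ρ})) (sym (points-base P {a} {ρ} {w})))))
          (E-avg M λ w a → g a ρ w))
        (E-avg N λ ρ a → E (size H) M (g a ρ)))
        where
        g : V A → Vec (V A) N → Vec (V H) M → ℚ
        g a ρ w = Vᴬ (baseᵖ P) (a ∷ ρ) * (Vᴴ P w * F (points (baseᵖ P) (a ∷ ρ) w))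

      mean-old : ∀ j → mean (oldᵖ j P) (λ ρ w → F (points (oldᵖ j P) ρ w)) ≡
                 mean P λ ρ w → onCopy (λ x → F (x ∷ points P ρ w)) (slotEdges P ρ j)
      mean-old j = sym (E-cong N λ ρ → trans
        (E-cong M λ w → let f = λ v → F (copy (slotEdges P ρ j) v ∷ points P ρ w) in trans
          (cong (Vᴬ P ρ *_) (sym (avg-* (Vᴴ P w) (λ v → nonRootᵢ v * f v))))
          (trans (sym (avg-* (Vᴬ P ρ) (λ v → Vᴴ P w * (nonRootᵢ v * f v))))
            (avg-cong λ v → cong (Vᴬ P ρ *_) (trans
              (solve 3 (λ a b c → a :* (b :* c) := (b :* a) :* c) refl (Vᴴ P w) (nonRootᵢ v) (f v))
              (cong₂ (λ x y → x * F y) (sym (Vᴴ-cons P {v} {w})) (sym (points-old P {j} {ρ} {v} {w})))))))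
        (E-avg M λ w v → Vᴬ P ρ * (Vᴴ (oldᵖ j P) (v ∷ w) * F (points (oldᵖ j P) ρ (v ∷ w)))))

      mean-new : mean (newᵖ P) (λ ρ w → F (points (newᵖ P) ρ w)) ≡
                 mean P λ ρ w → E (size A) k λ e →
                   (edgeᵢ e * freshᵢ (slotEdges P ρ) e) * onCopy (λ x → F (x ∷ points P ρ w)) e
      mean-new = sym (trans
        (E-cong N λ ρ → trans
          (E-cong M λ w → trans
            (cong (Vᴬ P ρ *_) (sym (E-* k (Vᴴ P w) (inner ρ w))))
            (trans (sym (E-* k (Vᴬ P ρ) (λ e → Vᴴ P w * inner ρ w e)))
              (E-cong k λ e → pointwise ρ w e)))
          (trans (E-swap M k λ w e → avg λ v → g e ρ v w)
            (E-cong k λ e → E-avg M λ w v → g e ρ v w)))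
        (trans (E-swap N k λ ρ e → E (size H) (suc M) λ vw → full (e Vec.++ ρ) vw)
          (sym (E-++ k N λ ρ → E (size H) (suc M) (full ρ)))))
        where
        inner : Vec (V A) N → Vec (V H) M → Vec (V A) k → ℚ
        inner ρ w e = (edgeᵢ e * freshᵢ (slotEdges P ρ) e) * onCopy (λ x → F (x ∷ points P ρ w)) e
        full : Vec (V A) (k + N) → Vec (V H) (suc M) → ℚ
        full ρ w = Vᴬ (newᵖ P) ρ * (Vᴴ (newᵖ P) w * F (points (newᵖ P) ρ w))
        g : Vec (V A) k → Vec (V A) N → V H → Vec (V H) M → ℚ
        g e ρ v w = full (e Vec.++ ρ) (v ∷ w)
        pointwise : ∀ ρ w e → Vᴬ P ρ * (Vᴴ P w * inner ρ w e) ≡ avg λ v → g e ρ v w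
        pointwise ρ w e = begin
          Vᴬ P ρ * (Vᴴ P w * (ef * avg f))
            ≡⟨ solve 4 (λ a b c d → a :* (b :* (c :* d)) := ((c :* a) :* b) :* d) refl (Vᴬ P ρ) (Vᴴ P w) ef (avg f) ⟩
          ((ef * Vᴬ P ρ) * Vᴴ P w) * avg f
            ≡⟨ avg-* ((ef * Vᴬ P ρ) * Vᴴ P w) f ⟨
          avg (λ v → ((ef * Vᴬ P ρ) * Vᴴ P w) * f v)
            ≡⟨ avg-cong (λ v → trans
                 (solve 4 (λ a b c d → (a :* b) :* (c :* d) := a :* ((c :* b) :* d)) refl
                   (ef * Vᴬ P ρ) (Vᴴ P w) (nonRootᵢ v) (F (copy e v ∷ points P ρ w)))
                 (trans (cong (_* ((nonRootᵢ v * Vᴴ P w) * F (copy e v ∷ points P ρ w))) (sym (Vᴬ-new P {e} {ρ})))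
                   (cong (Vᴬ (newᵖ P) (e Vec.++ ρ) *_)
                     (cong₂ (λ x y → x * F y) (sym (Vᴴ-cons P {v} {w})) (sym (points-new P {e} {ρ} {v} {w})))))) ⟩
          avg (λ v → g e ρ v w) ∎
          where
          open ≡-Reasoning
          ef = edgeᵢ e * freshᵢ (slotEdges P ρ) e
          f : V H → ℚ
          f v = nonRootᵢ v * F (copy e v ∷ points P ρ w)

      -- `expand-slots` is applied at each sample of the shorter pattern. Its hypotheses hold
      -- wherever `Vᴬ P` does not vanish, which is all that `mean` sees; `mean-base`, `mean-old` and
      -- `mean-new` then absorb the new element by interchanging averages.
      term-split : term P (λ q → avg λ x → F (x ∷ q)) ≡
                   term (baseᵖ P) F ℚ.+ (sum (λ j → term (oldᵖ j P) F) ℚ.+ term (newᵖ P) F)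
      term-split = begin
        weight P * mean P (λ ρ w → avg (f ρ w))
          ≡⟨ cong (weight P *_) (mean-cong P λ ρ w vᴬ vᴴ →
               expand-slots (slotEdges P ρ) (Valid.isEdge (valid P ρ vᴬ)) (Valid.distinct (valid P ρ vᴬ)) (f ρ w)) ⟩
        weight P * mean P (λ ρ w → baseW * fᵇ ρ w ℚ.+ (sum (λ j → oldCopyW * fᵒ j ρ w) ℚ.+ newCopyW * fⁿ ρ w))
          ≡⟨ cong (weight P *_) (trans
               (mean-+ P (λ ρ w → baseW * fᵇ ρ w) (λ ρ w → sum (λ j → oldCopyW * fᵒ j ρ w) ℚ.+ newCopyW * fⁿ ρ w))
               (cong₂ ℚ._+_ (trans (mean-* P baseW fᵇ) (cong (baseW *_) (sym mean-base)))
                 (trans (mean-+ P (λ ρ w → sum (λ j → oldCopyW * fᵒ j ρ w)) (λ ρ w → newCopyW * fⁿ ρ w))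
                   (cong₂ ℚ._+_
                     (trans (mean-sum P (λ j ρ w → oldCopyW * fᵒ j ρ w))
                       (sum-cong-≗ λ j → trans (mean-* P oldCopyW (fᵒ j)) (cong (oldCopyW *_) (sym (mean-old j)))))
                     (trans (mean-* P newCopyW fⁿ) (cong (newCopyW *_) (sym mean-new))))))) ⟩
        weight P * (baseW * mᵇ ℚ.+ (sum (λ j → oldCopyW * mᵒ j) ℚ.+ newCopyW * mⁿ))
          ≡⟨ solve 6 (λ p b x s c y → p :* (b :* x :+ (s :+ c :* y)) := (b :* p) :* x :+ (p :* s :+ (c :* p) :* y)) refl
               (weight P) baseW mᵇ (sum λ j → oldCopyW * mᵒ j) newCopyW mⁿ ⟩
        term (baseᵖ P) F ℚ.+ (weight P * sum (λ j → oldCopyW * mᵒ j) ℚ.+ term (newᵖ P) F)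
          ≡⟨ cong (λ s → term (baseᵖ P) F ℚ.+ (s ℚ.+ term (newᵖ P) F)) (trans
               (*-distribˡ-sum (weight P) (λ j → oldCopyW * mᵒ j))
               (sum-cong-≗ λ j → solve 3 (λ p o x → p :* (o :* x) := (o :* p) :* x) refl (weight P) oldCopyW (mᵒ j))) ⟩
        term (baseᵖ P) F ℚ.+ (sum (λ j → term (oldᵖ j P) F) ℚ.+ term (newᵖ P) F) ∎
        where
        open ≡-Reasoning
        f : Vec (V A) N → Vec (V H) M → V X → ℚ
        f ρ w x = F (x ∷ points P ρ w)
        fᵇ fⁿ : Vec (V A) N → Vec (V H) M → ℚ
        fᵇ ρ w = avg (f ρ w ∘ base)
        fⁿ ρ w = E (size A) k λ e → (edgeᵢ e * freshᵢ (slotEdges P ρ) e) * onCopy (f ρ w) e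
        fᵒ : Fin m → Vec (V A) N → Vec (V H) M → ℚ
        fᵒ j ρ w = onCopy (f ρ w) (slotEdges P ρ j)
        mᵇ = mean (baseᵖ P) λ ρ w → F (points (baseᵖ P) ρ w)
        mᵒ = λ j → mean (oldᵖ j P) λ ρ w → F (points (oldᵖ j P) ρ w)
        mⁿ = mean (newᵖ P) λ ρ w → F (points (newᵖ P) ρ w)

    term-nil : ∀ F → term nilᵖ F ≡ F []
    term-nil F = trans
      (cong₂ (λ x y → 1ℚ * (x * (y * F []))) (indicator-yes (A ⊩? ⊤ᵍ [ [] ]) (⊩-⊤ A)) (indicator-yes (H ⊩? ⊤ᵍ [ [] ]) (⊩-⊤ H)))
      (solve 1 (λ f → con 1ℚ :* (con 1ℚ :* (con 1ℚ :* f)) := f) refl (F []))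

    InUnit : ℚ → Set
    InUnit x = 0ℚ ℚ.≤ x × x ℚ.≤ 1ℚ

    indicator-unit : {Q : Set} (q? : Dec Q) → InUnit (indicator q?)
    indicator-unit q? = 0≤indicator q? , indicator≤1 q?

    *-unit : ∀ {x y} → InUnit x → InUnit y → InUnit (x * y)
    *-unit (0≤x , x≤1) (0≤y , y≤1) = 0≤* 0≤x 0≤y , *-mono-≤ 0≤x (ℚ.nonNegative⁻¹ 1ℚ) x≤1 y≤1

    E-unit : ∀ {l} .{{_ : NonZero l}} p {f : Vec (Fin l) p → ℚ} → (∀ x → InUnit (f x)) → InUnit (E l p f)
    E-unit {l} p {f} h =
      subst (ℚ._≤ E l p f) (E-const p 0ℚ) (E-mono p (proj₁ ∘ h)) ,
      subst (E l p f ℚ.≤_) (E-const p 1ℚ) (E-mono p (proj₂ ∘ h))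

    mean-unit : (P : Pattern k n N m M) {f : Vec (V A) N → Vec (V H) M → ℚ} →
                (∀ ρ w → InUnit (f ρ w)) → InUnit (mean P f)
    mean-unit {N = N} {M = M} P h = E-unit N λ ρ → E-unit M λ w →
      *-unit (indicator-unit (A ⊩? validᴬ P [ ρ ])) (*-unit (indicator-unit (H ⊩? validᴴ P [ w ])) (h ρ w))

    ∣mean∣≤1 : (P : Pattern k n N m M) {f : Vec (V A) N → Vec (V H) M → ℚ} →
               (∀ ρ w → InUnit (f ρ w)) → ℚ.∣ mean P f ∣ ℚ.≤ 1ℚ
    ∣mean∣≤1 P h = let (0≤ , ≤1) = mean-unit P h in subst (ℚ._≤ 1ℚ) (sym (ℚ.0≤p⇒∣p∣≡p 0≤)) ≤1

    -- `W` fixes the tuple that each slot reads: `w` itself in general, or the only vertex of the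
    -- slot repeated when no copy is revisited.
    module WithSlots (P : Pattern k n N m M) (W : Vec (V H) M → Slots m M) where

      rectMean : Rect N m M → ℚ
      rectMean r = mean P λ ρ w → indicator (⟦ r ⟧ʳ? ρ (W w))

      rectsMean : Rects N m M → ℚ
      rectsMean L = mean P λ ρ w → indicator (⟦ L ⟧? ρ (W w))

      bothMean : Rect N m M → Rects N m M → ℚ
      bothMean r L = mean P λ ρ w → indicator (⟦ r ⟧ʳ? ρ (W w)) * indicator (⟦ L ⟧? ρ (W w))

      slotMean : (Fin m → Guarded σ k M) → Guarded σ k 0 → ℚ
      slotMean β γ = E (size H) M λ w →
        Vᴴ P w * (indicator (Fin.all? λ j → H ⊩? β j [ W w j ]) * indicator (H ⊩? γ [ [] ]))

      -- Base vertices and gadget vertices are sampled independently, so the mean of a rectangle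
      -- factors.
      rectMean≡ : ∀ α β γ → rectMean (α , β , γ) ≡ probability A (andᵍ (validᴬ P) α) * slotMean β γ
      rectMean≡ α β γ = trans
        (E-cong N λ ρ → trans
          (E-cong M λ w → trans
            (cong (λ x → Vᴬ P ρ * (Vᴴ P w * x)) (trans
              (indicator-× (A ⊩? α [ ρ ]) (b? w ×-dec c?) (⟦ α , β , γ ⟧ʳ? ρ (W w)) ⇔.refl)
              (cong (indicator (A ⊩? α [ ρ ]) *_) (indicator-× (b? w) c? (b? w ×-dec c?) ⇔.refl))))
            (trans
              (solve 4 (λ a b c d → a :* (b :* (c :* d)) := (a :* c) :* (b :* d)) refl
                (Vᴬ P ρ) (Vᴴ P w) (indicator (A ⊩? α [ ρ ])) (indicator (b? w) * indicator c?))
              (cong (_* (Vᴴ P w * (indicator (b? w) * indicator c?)))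
                (sym (indicator-× (A ⊩? validᴬ P [ ρ ]) (A ⊩? α [ ρ ]) (A ⊩? andᵍ (validᴬ P) α [ ρ ]) ⇔.refl)))))
          (trans (E-* M (a ρ) (λ w → Vᴴ P w * (indicator (b? w) * indicator c?)))
                 (ℚ.*-comm (a ρ) (slotMean β γ))))
        (trans (E-* N (slotMean β γ) a) (ℚ.*-comm (slotMean β γ) (E (size A) N a)))
        where
        a : Vec (V A) N → ℚ
        a ρ = indicator (A ⊩? andᵍ (validᴬ P) α [ ρ ])
        b? : ∀ w → Dec (∀ j → H ⊩ β j [ W w j ])
        b? w = Fin.all? λ j → H ⊩? β j [ W w j ]
        c? = H ⊩? γ [ [] ]

      bothMean-[] : ∀ r → bothMean r [] ≡ 0ℚ
      bothMean-[] r = trans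
        (mean-cong P λ ρ w _ _ → trans (ℚ.*-zeroʳ (indicator (⟦ r ⟧ʳ? ρ (W w)))) (sym (ℚ.*-zeroˡ 0ℚ)))
        (trans (mean-* P 0ℚ (λ _ _ → 0ℚ)) (ℚ.*-zeroˡ (mean P λ _ _ → 0ℚ)))

      -- Inclusion-exclusion, one rectangle at a time: x (y + z - y z) = x y + x z - (x y) z.
      -- Rectangles are closed under conjunction, so carrying `r` along leaves a recursion on `L`
      -- alone.
      bothMean-∷ : ∀ r r′ L → bothMean r (r′ ∷ L) ≡
                   rectMean (andʳ r r′) ℚ.+ (bothMean r L ℚ.+ ℚ.- 1ℚ * bothMean (andʳ r r′) L)
      bothMean-∷ r r′ L = trans
        (mean-cong P λ ρ w _ _ → let
            x = indicator (⟦ r ⟧ʳ? ρ (W w))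
            y = indicator (⟦ r′ ⟧ʳ? ρ (W w))
            z = indicator (⟦ L ⟧? ρ (W w))
            xy = indicator-× (⟦ r ⟧ʳ? ρ (W w)) (⟦ r′ ⟧ʳ? ρ (W w)) (⟦ andʳ r r′ ⟧ʳ? ρ (W w)) (⟦and⟧ʳ r r′)
          in trans
            (cong (x *_) (indicator-⊎ (⟦ r′ ⟧ʳ? ρ (W w)) (⟦ L ⟧? ρ (W w)) (⟦ r′ ∷ L ⟧? ρ (W w)) (mk⇔
              (λ { (here q) → inj₁ q ; (there q) → inj₂ q }) [ here , there ]′)))
            (trans
              (solve 3 (λ x y z → x :* (y :+ z :+ :- (y :* z)) := x :* y :+ (x :* z :+ con (ℚ.- 1ℚ) :* ((x :* y) :* z))) refl x y z)
              (cong (λ u → u ℚ.+ (x * z ℚ.+ ℚ.- 1ℚ * (u * z))) (sym xy))))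
        (trans (mean-+ P f₁ (λ ρ w → f₂ ρ w ℚ.+ ℚ.- 1ℚ * f₃ ρ w))
          (cong (mean P f₁ ℚ.+_) (trans (mean-+ P f₂ (λ ρ w → ℚ.- 1ℚ * f₃ ρ w))
            (cong (mean P f₂ ℚ.+_) (mean-* P (ℚ.- 1ℚ) f₃)))))
        where
        f₁ f₂ f₃ : Vec (V A) N → Vec (V H) M → ℚ
        f₁ ρ w = indicator (⟦ andʳ r r′ ⟧ʳ? ρ (W w))
        f₂ ρ w = indicator (⟦ r ⟧ʳ? ρ (W w)) * indicator (⟦ L ⟧? ρ (W w))
        f₃ ρ w = indicator (⟦ andʳ r r′ ⟧ʳ? ρ (W w)) * indicator (⟦ L ⟧? ρ (W w))

      bothMean-true : ∀ L → bothMean trueʳ L ≡ rectsMean L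
      bothMean-true L = mean-cong P λ ρ w _ _ → trans
        (cong (_* indicator (⟦ L ⟧? ρ (W w)))
          (indicator-yes (⟦ trueʳ ⟧ʳ? ρ (W w)) (⊩-⊤ A , (λ _ → ⊩-⊤ H) , ⊩-⊤ H)))
        (ℚ.*-identityˡ (indicator (⟦ L ⟧? ρ (W w))))

      mean-decompose : (∀ w → VecAll.All (Agrees w (W w)) (kinds P)) → ∀ φ →
                       (mean P λ ρ w → indicator (X ⊩? φ [ points P ρ w ])) ≡
                       rectsMean (decompose φ (edges P) (kinds P))
      mean-decompose agrees φ = mean-cong P λ ρ w vᴬ vᴴ →
        indicator-cong (X ⊩? φ [ points P ρ w ]) (⟦ decompose φ (edges P) (kinds P) ⟧? ρ (W w))
          (⇔.sym (decompose-correct φ (pattern-names P (agrees w) vᴬ vᴴ)))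

    module _ (P : Pattern k n N m M) where

      open WithSlots P (λ w _ → w)

      slotMean-joint : ∀ β γ → slotMean β γ ≡ probability H (jointᵍ P β γ)
      slotMean-joint β γ = E-cong M λ w → sym (trans
        (indicator-× (H ⊩? validᴴ P [ w ]) (b′? w ×-dec c′? w)
          (H ⊩? jointᵍ P β γ [ w ]) ⇔.refl)
        (cong (Vᴴ P w *_) (trans (indicator-× (b′? w) (c′? w) (b′? w ×-dec c′? w) ⇔.refl)
          (cong₂ _*_
            (indicator-cong (b′? w) (Fin.all? λ j → H ⊩? β j [ w ]) (⊩-all H m β))
            (indicator-cong (c′? w) (H ⊩? γ [ [] ]) (⊩-subst H (λ ()) γ))))))
        where
        b′? : ∀ w → Dec (H ⊩ allᵍ m β [ w ])
        b′? w = H ⊩? allᵍ m β [ w ]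
        c′? : ∀ w → Dec (H ⊩ substᵍ (λ ()) γ [ w ])
        c′? w = H ⊩? substᵍ (λ ()) γ [ w ]

      agrees-joint : ∀ w → VecAll.All (Agrees w (λ _ → w)) (kinds P)
      agrees-joint w = VecAll.universal (λ { (inj₁ a) → tt ; (inj₂ _) → refl }) (kinds P)

    -- The vertex with which a copy is first met; without `oldᵖ` it is the only one sampled there.
    slotValue : Pattern k n N m M → Vec (V H) M → Fin m → V H
    slotValue nilᵖ       w       = λ ()
    slotValue (baseᵖ P)  w       = slotValue P w
    slotValue (oldᵖ j P) (v ∷ w) = slotValue P w
    slotValue (newᵖ P)   (v ∷ w) = v ◂ slotValue P w

    Matches : Vec (V H) M → (Fin m → V H) → Kind N m M → Set
    Matches w s (inj₁ a)       = ⊤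
    Matches w s (inj₂ (j , x)) = s j ≡ lookup w x

    matches : (P : Pattern k n N m M) → NoOld P → ∀ w → VecAll.All (Matches w (slotValue P w)) (kinds P)
    matches nilᵖ      _ w       = []
    matches (baseᵖ P) o w       = tt ∷ VecAll.map⁺ (VecAll.map (λ { {inj₁ a} _ → tt ; {inj₂ _} q → q }) (matches P o w))
    matches (newᵖ P)  o (v ∷ w) = refl ∷ VecAll.map⁺ (VecAll.map (λ { {inj₁ a} _ → tt ; {inj₂ _} q → q }) (matches P o w))

    -- Without `oldᵖ` every gadget vertex has a slot of its own, so the factors are independent.
    product-mean : (P : Pattern k n N m M) → NoOld P → (g : Fin m → V H → ℚ) →
                   E (size H) M (λ w → Vᴴ P w * prod λ j → g j (slotValue P w j)) ≡
                   prod λ j → avg λ v → nonRootᵢ v * g j v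
    product-mean nilᵖ      _ g = trans (cong (_* 1ℚ) (indicator-yes (H ⊩? ⊤ᵍ [ [] ]) (⊩-⊤ H))) (ℚ.*-identityʳ 1ℚ)
    product-mean (baseᵖ P) o g = product-mean P o g
    product-mean {M = suc M} (newᵖ P) o g = trans
      (avg-cong λ v → trans
        (E-cong M λ w → trans
          (cong (_* (g zero v * rest w)) (Vᴴ-cons P {v} {w}))
          (solve 4 (λ a b c d → (a :* b) :* (c :* d) := (a :* c) :* (b :* d)) refl
            (nonRootᵢ v) (Vᴴ P w) (g zero v) (rest w)))
        (trans (E-* M (nonRootᵢ v * g zero v) (λ w → Vᴴ P w * rest w))
          (trans (cong ((nonRootᵢ v * g zero v) *_) (product-mean P o (g ∘ suc)))
            (ℚ.*-comm (nonRootᵢ v * g zero v) others))))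
      (trans (avg-* others (λ v → nonRootᵢ v * g zero v)) (ℚ.*-comm others (avg λ v → nonRootᵢ v * g zero v)))
      where
      rest : Vec (V H) M → ℚ
      rest w = prod λ j → g (suc j) (slotValue P w j)
      others = prod λ j → avg λ v → nonRootᵢ v * g (suc j) v

    module _ (P : Pattern k n N m M) where

      repeatValue : Vec (V H) M → Slots m M
      repeatValue w j = Vec.replicate M (slotValue P w j)

      agrees-repeat : NoOld P → ∀ w → VecAll.All (Agrees w (repeatValue w)) (kinds P)
      agrees-repeat o w = VecAll.map
        (λ { {inj₁ a} _ → tt ; {inj₂ (j , x)} q → trans (Vec.lookup-replicate x (slotValue P w j)) q }) (matches P o w)

      open WithSlots P repeatValue

      -- Only formulas with exactly one free variable are left: the slots separate by
      -- `product-mean`, and the sentence is given a dummy variable.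
      slotMean-repeat : NoOld P → ∀ β γ → slotMean β γ ≡
                        probability H (substᵍ {m = 1} (λ ()) γ) * prod λ j → probability H (slotᵍ (β j))
      slotMean-repeat o β γ = trans
        (E-cong M λ w → trans
          (cong (λ x → Vᴴ P w * (x * γᵢ)) (indicator-all (λ j → H ⊩? β j [ repeatValue w j ]) (Fin.all? λ j → H ⊩? β j [ repeatValue w j ])))
          (solve 3 (λ a b c → a :* (b :* c) := c :* (a :* b)) refl (Vᴴ P w) (prod λ j → g j (slotValue P w j)) γᵢ))
        (trans (E-* M γᵢ (λ w → Vᴴ P w * prod λ j → g j (slotValue P w j)))
          (cong₂ _*_ sentence (trans (product-mean P o g) (prod-cong slot))))
        where
        γᵢ = indicator (H ⊩? γ [ [] ])
        g : Fin m → V H → ℚ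
        g j v = indicator (H ⊩? β j [ Vec.replicate M v ])
        sentence : γᵢ ≡ probability H (substᵍ {m = 1} (λ ()) γ)
        sentence = sym (trans
          (avg-cong λ v → indicator-cong (H ⊩? substᵍ (λ ()) γ [ v ∷ [] ]) (H ⊩? γ [ [] ]) (⊩-subst H (λ ()) γ))
          (avg-const γᵢ))
        slot : ∀ j → avg (λ v → nonRootᵢ v * g j v) ≡ probability H (slotᵍ (β j))
        slot j = avg-cong λ v → sym (indicator-× (nonRoot? v) (H ⊩? β j [ Vec.replicate M v ])
          (H ⊩? slotᵍ (β j) [ v ∷ [] ])
          (×-⇔ (⊩-nonRoot {w = []}) (⊩-subst H (λ i → sym (Vec.lookup-replicate i v)) (β j))))

-- Convergence of the weights and of the contributions of patterns

module _ (h : ℕ → ℕ) (h≢0 : ∀ n → NonZero (h n)) where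

  private
    recip-h : ℕ → ℚ
    recip-h n = recip (h n) {{h≢0 n}}

  recip-null : TendsToInfinity h → Null recip-h
  recip-null h→∞ .vanishes ε 0<ε =
    let (M , M<ε) = recip-below 0<ε
        (N , large) = h→∞ (suc M)
    in N , λ n N≤n → ℚ.≤-<-trans
      (ℚ.≤-reflexive (ℚ.0≤p⇒∣p∣≡p (recip-nonNeg (h n) {{h≢0 n}})))
      (ℚ.≤-<-trans (recip-antitone {{_}} {{h≢0 n}} (large n N≤n)) M<ε)

  -- The values 1 / m with m ≤ k are separated from those with m > k.
  eventually-dichotomy : ∀ k .{{_ : NonZero k}} → Converges recip-h →
                         Eventually (λ n → k < h n) ⊎ Eventually (λ n → ¬ k < h n)
  eventually-dichotomy k ch = decide (k ℕ.<? h N)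
    where
    gap = recip k ℚ.- recip (suc k)
    0<gap : 0ℚ ℚ.< gap
    0<gap = subst (ℚ._< gap) (ℚ.+-inverseʳ (recip (suc k))) (ℚ.+-monoˡ-< (ℚ.- recip (suc k)) (recip-strict k))
    N = proj₁ (cauchy ch gap 0<gap)
    close = proj₂ (cauchy ch gap 0<gap)
    separated : ∀ m n → N ≤ m → N ≤ n → k < h m → ¬ (¬ k < h n)
    separated m n m≥ n≥ k<hm k≮hn = ℚ.<-irrefl refl (ℚ.≤-<-trans
      (ℚ.≤-trans gap≤ (ℚ.≤-reflexive (sym (ℚ.0≤p⇒∣p∣≡p (ℚ.≤-trans (ℚ.<⇒≤ 0<gap) gap≤))))) (close n m n≥ m≥))
      where
      gap≤ : gap ℚ.≤ recip-h n ℚ.- recip-h m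
      gap≤ = ℚ.+-mono-≤ (recip-antitone {{h≢0 n}} (ℕ.≮⇒≥ k≮hn)) (ℚ.neg-antimono-≤ (recip-antitone {{_}} {{h≢0 m}} k<hm))
    decide : Dec (k < h N) → _
    decide (yes p) = inj₁ (N , λ n n≥ → decidable-stable (k ℕ.<? h n) (separated N n ℕ.≤-refl n≥ p))
    decide (no ¬p) = inj₂ (N , λ n n≥ p → separated n N n≥ ℕ.≤-refl p ¬p)

guarded-converges : (B : ℕ → Structure σ c) → FOcLocConvergent p B → (φ : Guarded σ c p) →
                    Converges λ n → probability (B n) φ
guarded-converges B cB φ = convergent-≗ (λ n → ⟨compile⟩≡probability (B n) φ)
  (converges (cB (compile φ) (compile-local φ)))

-- On the gadget side the weights depend on 1 / |G| only, so one free variable suffices for them and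
-- they are shared by both claims.
module Limit (σ : Signature) (k : ℕ) .{{_ : NonZero k}} (A : ℕ → BaseStructure σ k) (G : ℕ → Gadget σ k)
             (A-converges : LocalConvergent A) (edges-positive : PositiveLimit λ n → ⟨ R[x] k , A n ⟩)
             (G-converges : FOcLocConvergent 1 (λ n → structure (G n))) where

  open Patterns σ k
  module S (n : ℕ) = PatternSampling (A n) (G n)

  private
    H : ℕ → Structure σ k
    H n = structure (G n)

  recipᴬ-converges : Converges S.recipᴬ
  recipᴬ-converges = convergent-≗ (λ n → probability-var≡var (A n))
    (guarded-converges A (A-converges 2) (eqᵍ (var zero) (var (suc zero))))

  recipᴴ-converges : Converges S.recipᴴ
  recipᴴ-converges = convergent-≗ (λ n → probability-con≡var (H n) firstRoot)
    (guarded-converges H G-converges (eqᵍ (con firstRoot) (var zero)))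

  edgeDensity-converges : Converges S.edgeDensity
  edgeDensity-converges = convergent-≗ S.⟨R⟩≡edgeDensity
    (converges (A-converges k (R[x] k) (compile-local (relᵍ zero (tabulate var)))))

  nonRootDensity-converges : Converges S.nonRootDensity
  nonRootDensity-converges = convergent-≗ (λ n → sym (S.nonRootDensity≡ n))
    (convergent-+ (convergent-const 1ℚ) (convergent-neg (convergent-* (convergent-const (nat k)) recipᴴ-converges)))

  ratio-converges : Converges S.ratio
  ratio-converges = convergent-≗ (λ n → sym (S.ratio≡ n))
    (convergent-+ (convergent-* (convergent-^ (ℕ.pred k) recipᴬ-converges) recipᴴ-converges)
                  (convergent-* edgeDensity-converges nonRootDensity-converges))

  copyWeight-bounded : Eventually (λ n → k < size (H n)) → Bounded S.copyWeight
  copyWeight-bounded large = bounded (ℚ.1/ δ) (ℚ.<⇒≤ (ℚ.positive⁻¹ (ℚ.1/ δ)))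
    (Eventually-map bounds (Eventually-× large (proj₂ (proj₂ edges-positive))))
    where
    ε = proj₁ edges-positive
    0<ε = proj₁ (proj₂ edges-positive)
    -- The lower bound for `ratio` given by `ratio-≥`; its inverse bounds `copyWeight`.
    δ = ε * recip (suc k)
    instance
      δ-pos : ℚ.Positive δ
      δ-pos = ℚ.pos*pos⇒pos ε {{ℚ.positive 0<ε}} (recip (suc k)) {{ℚ.positive (recip-pos (suc k))}}
      δ≢0 : ℚ.NonZero δ
      δ≢0 = ℚ.pos⇒nonZero δ
      1/δ-pos : ℚ.Positive (ℚ.1/ δ)
      1/δ-pos = ℚ.1/pos⇒pos δ
    bounds : ∀ n → k < size (H n) × ε ℚ.≤ ⟨ R[x] k , A n ⟩ → ℚ.∣ S.copyWeight n ∣ ℚ.≤ ℚ.1/ δ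
    bounds n (k<h , ε≤) = begin
      ℚ.∣ w ∣                           ≡⟨ ℚ.0≤p⇒∣p∣≡p (S.copyWeight-nonNeg n) ⟩
      w                                 ≡⟨ trans (sym (ℚ.*-identityʳ w)) (cong (w *_) (sym (ℚ.*-inverseʳ δ))) ⟩
      w * (δ * ℚ.1/ δ)              ≡⟨ ℚ.*-assoc w δ (ℚ.1/ δ) ⟨
      w * δ * ℚ.1/ δ                ≤⟨ ℚ.*-monoʳ-≤-nonNeg (ℚ.1/ δ) {{ℚ.pos⇒nonNeg (ℚ.1/ δ)}}
                                             (ℚ.*-monoˡ-≤-nonNeg w {{ℚ.nonNegative (S.copyWeight-nonNeg n)}}
                                               (S.ratio-≥ n (ℚ.<⇒≤ 0<ε) (subst (ε ℚ.≤_) (S.⟨R⟩≡edgeDensity n) ε≤) k<h)) ⟩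
      w * S.ratio n * ℚ.1/ δ        ≡⟨ cong (_* ℚ.1/ δ) (S.copyWeight*ratio n) ⟩
      1ℚ * ℚ.1/ δ                     ≡⟨ ℚ.*-identityˡ (ℚ.1/ δ) ⟩
      ℚ.1/ δ                            ∎
      where
      open ℚ.≤-Reasoning
      w = S.copyWeight n

  newCopyW-converges : Converges S.newCopyW
  newCopyW-converges = [ when-large , when-small ]′
    (eventually-dichotomy (size ∘ H) (λ n → size≢0 (H n)) k recipᴴ-converges)
    where
    positive : ∀ n (d : Dec (k < size (H n))) → k < size (H n) → S.copyWeight n ≡ S.copyWeightIf n d
    positive n (yes _) _ = refl
    positive n (no ¬p) p = contradiction p ¬p
    vanishing : ∀ n (d : Dec (k < size (H n))) → ¬ k < size (H n) → 0ℚ ≡ S.copyWeightIf n d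
    vanishing n (yes p) ¬p = contradiction p ¬p
    vanishing n (no _)  _  = refl
    when-large : Eventually (λ n → k < size (H n)) → Converges S.newCopyW
    when-large large = convergent-cong
      (Eventually-map (λ n → positive n (k ℕ.<? size (H n))) large)
      (convergent-inverse (copyWeight-bounded large) (always S.copyWeight*ratio) ratio-converges)
    when-small : Eventually (λ n → ¬ k < size (H n)) → Converges S.newCopyW
    when-small small = convergent-cong
      (Eventually-map (λ n → vanishing n (k ℕ.<? size (H n))) small) (convergent-const 0ℚ)

  oldCopyW-converges : Converges S.oldCopyW
  oldCopyW-converges = convergent-* newCopyW-converges (convergent-^ k recipᴬ-converges)

  baseW-converges : Converges S.baseW
  baseW-converges = convergent-+ (convergent-const 1ℚ)
    (convergent-neg (convergent-* newCopyW-converges (convergent-* edgeDensity-converges nonRootDensity-converges)))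

  weight-converges : ∀ {N M} (P : Pattern k n N m M) → Converges λ i → S.weight i P
  weight-converges nilᵖ       = convergent-const 1ℚ
  weight-converges (baseᵖ P)  = convergent-* baseW-converges (weight-converges P)
  weight-converges (oldᵖ j P) = convergent-* oldCopyW-converges (weight-converges P)
  weight-converges (newᵖ P)   = convergent-* newCopyW-converges (weight-converges P)

  -- Induction on `p` for all `F`: averaging out the head gives a function of shorter tuples, and
  -- `term-split` writes each of its terms as a finite sum of terms of one-step longer patterns.
  terms⇒average : ∀ p {F : ∀ i → Vec (V (A i ⊛ G i)) p → ℚ} →
                  (∀ {N m M} (P : Pattern k p N m M) → Converges λ i → S.term i P (F i)) →
                  Converges λ i → E (size (A i ⊛ G i)) {{size≢0 (A i ⊛ G i)}} p (F i)
  terms⇒average zero {F} hF = convergent-≗ (λ i → S.term-nil i (F i)) (hF nilᵖ)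
  terms⇒average (suc p) {F} hF = convergent-≗ (λ i → S.average-suc i p (F i))
    (terms⇒average p λ P → convergent-≗ (λ i → sym (S.term-split i P (F i)))
      (convergent-+ (hF (baseᵖ P)) (convergent-+ (convergent-sum λ j → hF (oldᵖ j P)) (hF (newᵖ P)))))

  module _ {N M} (P : Pattern k n N m M) (W : ∀ i → Vec (V (H i)) M → S.Slots i m M)
           (slots-converge : ∀ β γ → Converges λ i → S.WithSlots.slotMean i P (W i) β γ) where

    private module W (i : ℕ) = S.WithSlots i P (W i)

    rectMean-converges : ∀ r → Converges λ i → W.rectMean i r
    rectMean-converges (α , β , γ) = convergent-≗ (λ i → sym (W.rectMean≡ i α β γ))
      (convergent-* (guarded-converges A (A-converges N) (andᵍ (validᴬ P) α)) (slots-converge β γ))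

    bothMean-converges : ∀ r L → Converges λ i → W.bothMean i r L
    bothMean-converges r []       = convergent-≗ (λ i → sym (W.bothMean-[] i r)) (convergent-const 0ℚ)
    bothMean-converges r (r′ ∷ L) = convergent-≗ (λ i → sym (W.bothMean-∷ i r r′ L))
      (convergent-+ (rectMean-converges (andʳ r r′)) (convergent-+ (bothMean-converges r L)
        (convergent-* (convergent-const (ℚ.- 1ℚ)) (bothMean-converges (andʳ r r′) L))))

    term-converges : (∀ i w → VecAll.All (S.Agrees i w (W i w)) (kinds P)) → (ψ : Guarded σ 0 n) →
                     Converges λ i → S.term i P λ q → indicator (A i ⊛ G i ⊩? ψ [ q ])
    term-converges agrees ψ = convergent-* (weight-converges P)
      (convergent-≗ (λ i → trans (W.bothMean-true i L) (sym (W.mean-decompose i (agrees i) ψ)))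
        (bothMean-converges trueʳ L))
      where
      L = decompose ψ (edges P) (kinds P)

  -- One `oldᵖ` is enough: it contributes |A|^(-k) with k ≥ 1, and all other factors are bounded.
  weight-null : TendsToInfinity (size ∘ A) → ∀ {N M} (P : Pattern k n N m M) → ¬ NoOld P → Null λ i → S.weight i P
  weight-null a→∞ nilᵖ       o = contradiction tt o
  weight-null a→∞ (baseᵖ P)  o = bounded-*-null (convergent⇒bounded baseW-converges) (weight-null a→∞ P o)
  weight-null a→∞ (oldᵖ j P) _ = null-*-bounded oldCopyW-null (convergent⇒bounded (weight-converges P))
    where
    power-null : ∀ l .{{_ : NonZero l}} → Null λ i → S.recipᴬ i ^ℚ l
    power-null (suc l) = null-*-bounded (recip-null (size ∘ A) (λ i → size≢0 (A i)) a→∞)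
      (convergent⇒bounded (convergent-^ l recipᴬ-converges))
    oldCopyW-null : Null S.oldCopyW
    oldCopyW-null = bounded-*-null (convergent⇒bounded newCopyW-converges) (power-null k)
  weight-null a→∞ (newᵖ P)   o = bounded-*-null (convergent⇒bounded newCopyW-converges) (weight-null a→∞ P o)

  convergent-prod : ∀ {x : Fin m → ℕ → ℚ} → (∀ j → Converges (x j)) → Converges λ i → prod λ j → x j i
  convergent-prod {zero}  cx = convergent-const 1ℚ
  convergent-prod {suc m} cx = convergent-* (cx zero) (convergent-prod (cx ∘ suc))

  Terms-converge : Set
  Terms-converge = ∀ {n N m M} (P : Pattern k n N m M) (ψ : Guarded σ 0 n) →
                   Converges λ i → S.term i P λ q → indicator (A i ⊛ G i ⊩? ψ [ q ])

  terms-converge : ConstantLocalConvergent H → Terms-converge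
  terms-converge cG {M = M} P ψ = term-converges P (λ i w _ → w)
    (λ β γ → convergent-≗ (λ i → sym (S.slotMean-joint i P β γ)) (guarded-converges H (cG M) (jointᵍ P β γ)))
    (λ i → S.agrees-joint i P) ψ

  terms-converge-large : TendsToInfinity (size ∘ A) → Terms-converge
  terms-converge-large a→∞ P ψ with noOld? P
  ... | yes o = term-converges P (λ i → S.repeatValue i P)
    (λ β γ → convergent-≗ (λ i → sym (S.slotMean-repeat i P o β γ))
      (convergent-* (guarded-converges H G-converges (substᵍ (λ ()) γ))
        (convergent-prod λ j → guarded-converges H G-converges (slotᵍ (β j)))))
    (λ i → S.agrees-repeat i P o) ψ
  -- The mean lies between 0 and 1, so the term vanishes in the limit without any control over
  -- gadget formulas in several variables.
  ... | no o = null⇒convergent (null-*-bounded (weight-null a→∞ P o)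
    (bounded 1ℚ (ℚ.nonNegative⁻¹ 1ℚ) (always λ i → S.∣mean∣≤1 i P λ ρ w →
      S.indicator-unit i (A i ⊛ G i ⊩? ψ [ S.points i P ρ w ]))))

  product-converges : Terms-converge → LocalConvergent (λ i → A i ⊛ G i)
  product-converges terms p φ local = let (ψ , φ⇔ψ) = local⇒guarded φ local in
    cauchy (convergent-≗
      (λ i → sym (trans (⟨⟩-E φ (A i ⊛ G i)) (E-cong {{size≢0 (A i ⊛ G i)}} p λ q →
        indicator-cong (A i ⊛ G i ⊨? φ [ q ]) (A i ⊛ G i ⊩? ψ [ q ]) (φ⇔ψ (A i ⊛ G i) q))))
      (terms⇒average p λ P → terms P ψ))

corollary5p5 : (σ : Signature) (k : ℕ) .{{_ : NonZero k}}
    (A : ℕ → BaseStructure σ k) (G : ℕ → Gadget σ k) →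
    LocalConvergent A →
    PositiveLimit (λ n → ⟨ R[x] k , A n ⟩) →
    (ConstantLocalConvergent (λ n → structure (G n)) →
    LocalConvergent (λ n → A n ⊛ G n))
    ×
    (TendsToInfinity (λ n → size (A n)) →
    FOcLocConvergent 1 (λ n → structure (G n)) →
    LocalConvergent (λ n → A n ⊛ G n))
corollary5p5 σ k A G A-converges positive =
  (λ G-converges → let open Limit σ k A G A-converges positive (G-converges 1)
                   in product-converges (terms-converge G-converges)) ,
  (λ a→∞ G-converges → let open Limit σ k A G A-converges positive G-converges
                       in product-converges (terms-converge-large a→∞))
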